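{- Let $n\ge 2$, $t\ge 3$, let $\Sigma^*=PG(V,\mathbb{F}_{q^t})=PG(tn-1,q^t)$, let $\Psi$ be a semilinear collineation of $\Sigma^*$ of order $t$ whose set of fixed points $\Sigma$ is a subgeometry isomorphic to $PG(tn-1,q)$, let $\mathcal D$ be a Desarguesian $(t-1)$-spread of $\Sigma$ and let $\Theta$ be a director space of $\mathcal D$. Let $i_1,i_2\in\{0,1,\dots,t-1\}$ with $\gcd(i_2-i_1,t)=1$, and put $\Gamma=\langle\Theta^{\Psi^i}: i\in\{0,\dots,t-1\}\setminus\{i_1,i_2\}\rangle_{q^t}$ and $\Lambda=\langle\Theta^{\Psi^{i_1}},\Theta^{\Psi^{i_2}}\rangle_{q^t}$. Then $\Gamma$ is an $(n(t-2)-1)$-dimensional subspace disjoint from $\Sigma$ and from $\Lambda$, $\Lambda$ has dimension $2n-1$, and the projection $p_{\Gamma,\Lambda}(\Sigma)$ is a scattered $\mathbb{F}_q$-linear set of $\Lambda$ of rank $tn$ of type $L_{\rho,f}$; in particular it is of pseudoregulus type with transversal spaces $\Theta^{\Psi^{i_1}}$ and $\Theta^{\Psi^{i_2}}$.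
   Context: Director spaces / Desarguesian spreads: if $\Theta$ is an $(n-1)$-dimensional subspace of $\Sigma^*$ such that $\Theta,\Theta^\Psi,\dots,\Theta^{\Psi^{t-1}}$ span $\Sigma^*$, then $\mathcal D(\Theta)=\{\langle P,P^\Psi,\dots,P^{\Psi^{t-1}}\rangle_{q^t}\cap\Sigma: P\in\Theta\}$ is a $(t-1)$-spread of $\Sigma$ (a partition of the points of $\Sigma$ into $(t-1)$-dimensional subspaces), called Desarguesian; a Desarguesian spread $\mathcal D$ of $\Sigma$ is one of the form $\mathcal D(\Theta)$, and the subspaces $\Theta^{\Psi^i}$, $i=0,\dots,t-1$, are its director spaces. Projection: if $\Gamma$ is a subspace of $\Sigma^*$ disjoint from $\Sigma$ and $\Lambda$ a subspace disjoint from $\Gamma$ with $\dim\Gamma+\dim\Lambda=\dim\Sigma^*-1$, then $p_{\Gamma,\Lambda}(\Sigma)=\{\langle\Gamma,P\rangle_{q^t}\cap\Lambda: P\in\Sigma\}$. Type $L_{\rho,f}$: writing $\Lambda=PG(V',\mathbb{F}_{q^t})$, a linear set of type $L_{\rho,f}$ is $\{\langle\mathbf u+\rho f(\mathbf u)\rangle_{q^t}:\mathbf u\in U_1\setminus\{\mathbf 0\}\}$ for some decomposition $V'=U_1\oplus U_2$ with $\dim U_1=\dim U_2=n$, some invertible semilinear $f:U_1\to U_2$ whose companion automorphism $\sigma$ satisfies $\mathrm{Fix}(\sigma)=\mathbb{F}_q$, and some $\rho\in\mathbb{F}_{q^t}^*$; its transversal spaces are $PG(U_1,\mathbb{F}_{q^t})$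 and $PG(U_2,\mathbb{F}_{q^t})$. A linear set $L_U$ ($U$ an $\mathbb F_q$-subspace) is scattered if $\dim_{\mathbb F_q}(U\cap\langle\mathbf u\rangle_{q^t})=1$ for all nonzero $\mathbf u\in U$. Pseudoregulus type: for $t,n\ge2$, a scattered $\mathbb{F}_q$-linear set $L$ of $PG(2n-1,q^t)$ of rank $tn$ such that (i) there are $(q^{nt}-1)/(q^t-1)$ pairwise disjoint lines each meeting $L$ in a linear set of rank $t$, and (ii) there are exactly two $(n-1)$-dimensional subspaces (transversal spaces) disjoint from $L$ meeting all these lines. -}

module Defs where

open import Level using (Level; suc)
open import Algebra.Bundles using (Ring; CommutativeRing)
open import Algebra.Apartness.Bundles using (HeytingField; HeytingCommutativeRing)
open import Algebra.Module.Bundles using (LeftModule)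
open import Algebra.Morphism.Structures using (IsGroupIsomorphism; IsRingIsomorphism; IsRingMonomorphism)
import Algebra.Module.Properties.LeftModule as LeftModuleProperties
import Algebra.Properties.CommutativeMonoid.Sum as Sum
open import Data.Nat.Base using (ℕ; _*_; _^_; _∸_; _<_)
open import Data.Nat.GeneralisedArithmetic using (fold)
open import Data.Fin.Base using (Fin; toℕ)
open import Data.Product.Base using (∃; ∃-syntax; Σ-syntax; _×_; _,_; proj₁; proj₂)
open import Data.Sum.Base using (_⊎_)
open import Data.Unit.Polymorphic.Base using (tt)
open import Function.Bundles using (Inverse; _⇔_)
import Relation.Binary.Construct.On as On
open import Relation.Binary.Definitions using (_Respects_)
open import Relation.Binary.PropositionalEquality.Core using (_≡_; _≢_)
open import Relation.Binary.PropositionalEquality.Properties using (setoid)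
open import Relation.Nullary.Negation using (¬_)
open import Relation.Unary using (Pred; _∈_; _∩_; _∪_; _≐_; _≬_; _⊥_; ⋃)
open import Relation.Unary.Polymorphic using (U)

-- For a carrier with finitely many elements `_#_` is forced to be the
-- negation of `_≈_`, so a HeytingField of finite cardinality is exactly
-- a finite field.
Field : (ℓ : Level) → Set (suc ℓ)
Field ℓ = HeytingField ℓ ℓ ℓ

ringOf : ∀ {ℓ} → Field ℓ → Ring ℓ ℓ
ringOf K = CommutativeRing.ring
  (HeytingCommutativeRing.commutativeRing (HeytingField.heytingCommutativeRing K))

HasCardinality : ∀ {ℓ} → Field ℓ → ℕ → Set ℓ
HasCardinality K q = Inverse (Ring.setoid (ringOf K)) (setoid (Fin q))

record FieldExtension (ℓ : Level) : Set (suc ℓ) where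
  field
    F K    : Field ℓ
    ι      : HeytingField.Carrier F → HeytingField.Carrier K
    ι-mono : IsRingMonomorphism (Ring.rawRing (ringOf F)) (Ring.rawRing (ringOf K)) ι

VectorSpace : ∀ {ℓ} → Field ℓ → Set (suc ℓ)
VectorSpace {ℓ} K = LeftModule (ringOf K) ℓ ℓ

record Subspace {ℓ} (K : Field ℓ) (V : VectorSpace K) : Set (suc ℓ) where
  open LeftModule V
  field
    ∣_∣       : Pred Carrierᴹ ℓ
    resp      : ∣_∣ Respects _≈ᴹ_
    0-closed  : 0ᴹ ∈ ∣_∣
    +-closed  : ∀ {u v} → u ∈ ∣_∣ → v ∈ ∣_∣ → u +ᴹ v ∈ ∣_∣
    *ₗ-closed : ∀ a {v} → v ∈ ∣_∣ → a *ₗ v ∈ ∣_∣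

open Subspace public using (∣_∣)

module _ {ℓ} {K : Field ℓ} {V : VectorSpace K} where
  open Ring (ringOf K) using (Carrier; -_; 1#; -‿inverseʳ)
    renaming (_≈_ to _≈ᴷ_; 0# to 0ᴷ)
  open LeftModule V
  open Sum +ᴹ-commutativeMonoid using (sum)

  infix 4 _≐ₛ_
  infixr 7 _⊓_

  _≐ₛ_ : Subspace K V → Subspace K V → Set ℓ
  S ≐ₛ T = ∣ S ∣ ≐ ∣ T ∣

  _⊓_ : Subspace K V → Subspace K V → Subspace K V
  S ⊓ T = record
    { ∣_∣       = ∣ S ∣ ∩ ∣ T ∣
    ; resp      = λ eq (s , t) → Subspace.resp S eq s , Subspace.resp T eq t
    ; 0-closed  = Subspace.0-closed S , Subspace.0-closed T
    ; +-closed  = λ (s , t) (s′ , t′) → Subspace.+-closed S s s′ , Subspace.+-closed T t t′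
    ; *ₗ-closed = λ a (s , t) → Subspace.*ₗ-closed S a s , Subspace.*ₗ-closed T a t
    }

  data Generated (X : Pred Carrierᴹ ℓ) : Pred Carrierᴹ ℓ where
    incl : ∀ {v} → v ∈ X → Generated X v
    resp : Generated X Respects _≈ᴹ_
    zero : Generated X 0ᴹ
    add  : ∀ {u v} → Generated X u → Generated X v → Generated X (u +ᴹ v)
    mul  : ∀ a {v} → Generated X v → Generated X (a *ₗ v)

  ⟨_⟩ : Pred Carrierᴹ ℓ → Subspace K V
  ⟨ X ⟩ = record
    { ∣_∣ = Generated X ; resp = resp ; 0-closed = zero ; +-closed = add ; *ₗ-closed = mul }

  linComb : ∀ {d} → (Fin d → Carrier) → (Fin d → Carrierᴹ) → Carrierᴹ
  linComb c e = sum (λ i → c i *ₗ e i)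

  record IsBasis (S : Subspace K V) {d : ℕ} (e : Fin d → Carrierᴹ) : Set ℓ where
    field
      member      : ∀ i → e i ∈ ∣ S ∣
      independent : ∀ c → linComb c e ≈ᴹ 0ᴹ → ∀ i → c i ≈ᴷ 0ᴷ
      spanning    : ∀ {v} → v ∈ ∣ S ∣ → ∃[ c ] v ≈ᴹ linComb c e

  -- The linear dimension; the projective dimension of the corresponding
  -- subspace of PG(V) is one less.
  HasDim : Subspace K V → ℕ → Set ℓ
  HasDim S d = Σ[ e ∈ (Fin d → Carrierᴹ) ] IsBasis S e

  asSpace : Subspace K V → VectorSpace K
  asSpace S = record
    { Carrierᴹ = ∃ ∣ S ∣
    ; _≈ᴹ_ = λ u v → proj₁ u ≈ᴹ proj₁ v
    ; _+ᴹ_ = λ (u , p) (v , r) → u +ᴹ v , Subspace.+-closed S p r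
    ; _*ₗ_ = λ a (v , p) → a *ₗ v , Subspace.*ₗ-closed S a p
    ; 0ᴹ = 0ᴹ , Subspace.0-closed S
    ; -ᴹ_ = λ (v , p) → -ᴹ v , Subspace.resp S (-1*v≈-v v) (Subspace.*ₗ-closed S (- 1#) p)
    ; isLeftModule = record
      { isLeftSemimodule = record
        { +ᴹ-isCommutativeMonoid = record
          { isMonoid = record
            { isSemigroup = record
              { isMagma = record
                { isEquivalence = On.isEquivalence proj₁ ≈ᴹ-isEquivalence
                ; ∙-cong = +ᴹ-cong
                }
              ; assoc = λ u v w → +ᴹ-assoc (proj₁ u) (proj₁ v) (proj₁ w)
              }
            ; identity = (λ v → +ᴹ-identityˡ (proj₁ v)) , (λ v → +ᴹ-identityʳ (proj₁ v))
            }
          ; comm = λ u v → +ᴹ-comm (proj₁ u) (proj₁ v)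
          }
        ; isPreleftSemimodule = record
          { *ₗ-cong = *ₗ-cong
          ; *ₗ-zeroˡ = λ v → *ₗ-zeroˡ (proj₁ v)
          ; *ₗ-distribʳ = λ v a b → *ₗ-distribʳ (proj₁ v) a b
          ; *ₗ-identityˡ = λ v → *ₗ-identityˡ (proj₁ v)
          ; *ₗ-assoc = λ a b v → *ₗ-assoc a b (proj₁ v)
          ; *ₗ-zeroʳ = *ₗ-zeroʳ
          ; *ₗ-distribˡ = λ a u v → *ₗ-distribˡ a (proj₁ u) (proj₁ v)
          }
        }
      ; -ᴹ‿cong = -ᴹ‿cong
      ; -ᴹ‿inverse = (λ v → -ᴹ‿inverseˡ (proj₁ v)) , (λ v → -ᴹ‿inverseʳ (proj₁ v))
      }
    }
    where
    -1*v≈-v : ∀ v → (- 1#) *ₗ v ≈ᴹ -ᴹ v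
    -1*v≈-v v = LeftModuleProperties.inverseʳ-uniqueᴹ V v ((- 1#) *ₗ v)
      (≈ᴹ-trans (+ᴹ-congʳ (≈ᴹ-sym (*ₗ-identityˡ v)))
      (≈ᴹ-trans (≈ᴹ-sym (*ₗ-distribʳ v 1# (- 1#)))
      (≈ᴹ-trans (*ₗ-congʳ (-‿inverseʳ 1#)) (*ₗ-zeroˡ v))))

whole : ∀ {ℓ} (K : Field ℓ) (V : VectorSpace K) → Subspace K V
whole K V = record
  { ∣_∣ = U ; resp = λ _ _ → tt ; 0-closed = tt ; +-closed = λ _ _ → tt ; *ₗ-closed = λ _ _ → tt }

-- For S ⊆ T this is S itself, seen inside the space T.
_↾_ : ∀ {ℓ} {K : Field ℓ} {V : VectorSpace K} →
      Subspace K V → (T : Subspace K V) → Subspace K (asSpace T)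
S ↾ T = record
  { ∣_∣       = λ v → proj₁ v ∈ ∣ S ∣
  ; resp      = Subspace.resp S
  ; 0-closed  = Subspace.0-closed S
  ; +-closed  = Subspace.+-closed S
  ; *ₗ-closed = λ a → Subspace.*ₗ-closed S a
  }

-- Points of PG(V) are represented by nonzero vectors, and identified by _∼_.
record Point {ℓ} (K : Field ℓ) (V : VectorSpace K) : Set ℓ where
  open LeftModule V
  field
    rep   : Carrierᴹ
    rep≉0 : rep ≉ᴹ 0ᴹ

open Point public using (rep)

PointSet : ∀ {ℓ} (K : Field ℓ) → VectorSpace K → Set (suc ℓ)
PointSet {ℓ} K V = Pred (Point K V) ℓ

module _ {ℓ} {K : Field ℓ} {V : VectorSpace K} where
  open LeftModule V

  infix 4 _on⟨_⟩ _∼_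

  _on⟨_⟩ : Point K V → Carrierᴹ → Set ℓ
  P on⟨ v ⟩ = ∃[ a ] rep P ≈ᴹ a *ₗ v

  _∼_ : Point K V → Point K V → Set ℓ
  P ∼ Q = P on⟨ rep Q ⟩

  PG : Subspace K V → PointSet K V
  PG S P = rep P ∈ ∣ S ∣

record SemilinearIso {ℓ} (K : Field ℓ) (V W : VectorSpace K) : Set ℓ where
  private
    module K = Ring (ringOf K)
    module V = LeftModule V
    module W = LeftModule W
  field
    σ          : K.Carrier → K.Carrier
    σ-iso      : IsRingIsomorphism K.rawRing K.rawRing σ
    map        : V.Carrierᴹ → W.Carrierᴹ
    map-iso    : IsGroupIsomorphism V.+ᴹ-rawGroup W.+ᴹ-rawGroup map
    semilinear : ∀ a v → map (a V.*ₗ v) W.≈ᴹ σ a W.*ₗ map v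

module _ {ℓ} {K : Field ℓ} {V : VectorSpace K} (ψ : SemilinearIso K V V) where
  open LeftModule V
  open SemilinearIso ψ
  private
    module ψ = IsGroupIsomorphism map-iso
    module σ = IsRingIsomorphism σ-iso

  onPoints : Point K V → Point K V
  onPoints P = record
    { rep   = map (rep P)
    ; rep≉0 = λ eq → Point.rep≉0 P (ψ.injective (≈ᴹ-trans eq (≈ᴹ-sym ψ.ε-homo)))
    }

  onSubspaces : Subspace K V → Subspace K V
  onSubspaces S = record
    { ∣_∣       = λ v → ∃[ u ] u ∈ ∣ S ∣ × v ≈ᴹ map u
    ; resp      = λ eq (u , p , e) → u , p , ≈ᴹ-trans (≈ᴹ-sym eq) e
    ; 0-closed  = 0ᴹ , Subspace.0-closed S , ≈ᴹ-sym ψ.ε-homo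
    ; +-closed  = λ (u , p , e) (u′ , p′ , e′) →
        u +ᴹ u′ , Subspace.+-closed S p p′ , ≈ᴹ-trans (+ᴹ-cong e e′) (≈ᴹ-sym (ψ.∙-homo u u′))
    ; *ₗ-closed = λ a (u , p , e) → let (b , σb≈a) = σ.surjective a in
        b *ₗ u , Subspace.*ₗ-closed S b p ,
        ≈ᴹ-trans (*ₗ-cong (Ring.sym (ringOf K) (σb≈a (Ring.refl (ringOf K)))) e)
                 (≈ᴹ-sym (semilinear b u))
    }

module _ {ℓ} {K : Field ℓ} {V : VectorSpace K} where
  open LeftModule V

  infixl 8 _^ᴾ[_]_ _^ˢ[_]_

  _^ᴾ[_]_ : Point K V → SemilinearIso K V V → ℕ → Point K V
  P ^ᴾ[ ψ ] i = fold P (onPoints ψ) i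

  _^ˢ[_]_ : Subspace K V → SemilinearIso K V V → ℕ → Subspace K V
  S ^ˢ[ ψ ] i = fold S (onSubspaces ψ) i

  -- The order of the induced collineation, not of the map on vectors.
  HasOrder : SemilinearIso K V V → ℕ → Set ℓ
  HasOrder ψ t =
    (∀ P → P ^ᴾ[ ψ ] t ∼ P) × (∀ k → 0 < k → k < t → ¬ (∀ P → P ^ᴾ[ ψ ] k ∼ P))

  Fix : SemilinearIso K V V → PointSet K V
  Fix ψ P = onPoints ψ P ∼ P

  -- 𝒟(Θ), a collection of subsets of Fix ψ.
  spreadOf : SemilinearIso K V V → ℕ → Subspace K V → Pred (PointSet K V) ℓ
  spreadOf ψ t Θ X = ∃[ P ] P ∈ PG Θ ×
    X ≐ PG ⟨ (λ v → Σ[ i ∈ Fin t ] rep (P ^ᴾ[ ψ ] toℕ i) ≈ᴹ v) ⟩ ∩ Fix ψ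

  -- Θ has linear dimension n, its conjugates span V, and 𝒟 = 𝒟(Θ).  That
  -- 𝒟(Θ) then partitions Fix ψ is a theorem, hence not required.
  Defines : SemilinearIso K V V → (n t : ℕ) → Subspace K V → Pred (PointSet K V) ℓ → Set (suc ℓ)
  Defines ψ n t Θ 𝒟 =
    HasDim Θ n ×
    ⟨ ⋃ (Fin t) (λ i → ∣ Θ ^ˢ[ ψ ] toℕ i ∣) ⟩ ≐ₛ whole K V ×
    𝒟 ≐ spreadOf ψ t Θ

  IsDesarguesianSpread : SemilinearIso K V V → (n t : ℕ) → Pred (PointSet K V) ℓ → Set (suc ℓ)
  IsDesarguesianSpread ψ n t 𝒟 = ∃[ Θ ] Defines ψ n t Θ 𝒟

  IsDirectorSpace : SemilinearIso K V V → (n t : ℕ) → Pred (PointSet K V) ℓ → Subspace K V → Set (suc ℓ)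
  IsDirectorSpace ψ n t 𝒟 Θ =
    ∃[ Θ₀ ] Defines ψ n t Θ₀ 𝒟 × Σ[ i ∈ Fin t ] Θ ≐ₛ Θ₀ ^ˢ[ ψ ] toℕ i

-- { ⟨Γ , P⟩ ∩ Λ : P ∈ X }: the subspace ⟨Γ , P⟩ ∩ Λ is required to be the
-- single point Q.
projection : ∀ {ℓ} {K : Field ℓ} {V : VectorSpace K} (Γ Λ : Subspace K V) →
             PointSet K V → PointSet K (asSpace Λ)
projection {V = V} Γ Λ X Q =
  ∃[ P ] P ∈ X × PG (⟨ ∣ Γ ∣ ∪ (rep P ≈ᴹ_) ⟩ ↾ Λ) ≐ (_∼ Q)
  where open LeftModule V

module _ {ℓ} (E : FieldExtension ℓ) where
  open FieldExtension E
  private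
    module F = Ring (ringOf F)
    module K = Ring (ringOf K)
    module ι = IsRingMonomorphism ι-mono

  restrictScalars : VectorSpace K → VectorSpace F
  restrictScalars V = record
    { Carrierᴹ = Carrierᴹ
    ; _≈ᴹ_ = _≈ᴹ_
    ; _+ᴹ_ = _+ᴹ_
    ; _*ₗ_ = λ a v → ι a *ₗ v
    ; 0ᴹ = 0ᴹ
    ; -ᴹ_ = -ᴹ_
    ; isLeftModule = record
      { isLeftSemimodule = record
        { +ᴹ-isCommutativeMonoid = +ᴹ-isCommutativeMonoid
        ; isPreleftSemimodule = record
          { *ₗ-cong = λ p → *ₗ-cong (ι.⟦⟧-cong p)
          ; *ₗ-zeroˡ = λ v → ≈ᴹ-trans (*ₗ-congʳ ι.0#-homo) (*ₗ-zeroˡ v)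
          ; *ₗ-distribʳ = λ v a b → ≈ᴹ-trans (*ₗ-congʳ (ι.+-homo a b)) (*ₗ-distribʳ v (ι a) (ι b))
          ; *ₗ-identityˡ = λ v → ≈ᴹ-trans (*ₗ-congʳ ι.1#-homo) (*ₗ-identityˡ v)
          ; *ₗ-assoc = λ a b v → ≈ᴹ-trans (*ₗ-congʳ (ι.*-homo a b)) (*ₗ-assoc (ι a) (ι b) v)
          ; *ₗ-zeroʳ = λ a → *ₗ-zeroʳ (ι a)
          ; *ₗ-distribˡ = λ a → *ₗ-distribˡ (ι a)
          }
        }
      ; -ᴹ‿cong = -ᴹ‿cong
      ; -ᴹ‿inverse = -ᴹ‿inverse
      }
    }
    where open LeftModule V

  FSubspace : VectorSpace K → Set (suc ℓ)
  FSubspace V = Subspace F (restrictScalars V)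

  module _ {V : VectorSpace K} where
    open LeftModule V

    overF : Subspace K V → FSubspace V
    overF S = record
      { ∣_∣       = ∣ S ∣
      ; resp      = Subspace.resp S
      ; 0-closed  = Subspace.0-closed S
      ; +-closed  = Subspace.+-closed S
      ; *ₗ-closed = λ a → Subspace.*ₗ-closed S (ι a)
      }

    linearSet : FSubspace V → PointSet K V
    linearSet W P = ∃[ u ] u ∈ ∣ W ∣ × u ≉ᴹ 0ᴹ × P on⟨ u ⟩

    IsScattered : FSubspace V → Set ℓ
    IsScattered W = ∀ u → u ∈ ∣ W ∣ → u ≉ᴹ 0ᴹ → HasDim (W ⊓ overF ⟨ u ≈ᴹ_ ⟩) 1

    IsScatteredLinearSet : ℕ → PointSet K V → Set (suc ℓ)
    IsScatteredLinearSet k L = ∃[ W ] HasDim W k × IsScattered W × L ≐ linearSet W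

    -- The points having coordinates in F with respect to some K-basis of V.
    IsSubgeometry : ℕ → PointSet K V → Set ℓ
    IsSubgeometry d X = Σ[ e ∈ (Fin d → Carrierᴹ) ] IsBasis (whole K V) e ×
      X ≐ linearSet ⟨ (λ v → Σ[ i ∈ Fin d ] e i ≈ᴹ v) ⟩

    -- L is of type L_{ρ,f} in V = U₁ ⊕ U₂, with transversal spaces U₁ and U₂.
    IsTypeLρf : ℕ → PointSet K V → (U₁ U₂ : Subspace K V) → Set ℓ
    IsTypeLρf n L U₁ U₂ =
      HasDim U₁ n × HasDim U₂ n ×
      (∀ v → ∃[ u₁ ] ∃[ u₂ ] u₁ ∈ ∣ U₁ ∣ × u₂ ∈ ∣ U₂ ∣ × v ≈ᴹ u₁ +ᴹ u₂) ×
      (∀ v → v ∈ ∣ U₁ ∣ → v ∈ ∣ U₂ ∣ → v ≈ᴹ 0ᴹ) ×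
      Σ[ f ∈ SemilinearIso K (asSpace U₁) (asSpace U₂) ]
        (∀ a → SemilinearIso.σ f a K.≈ a ⇔ (∃[ b ] a K.≈ ι b)) ×
        ∃[ ρ ] ¬ (ρ K.≈ K.0#) ×
          L ≐ (λ P → Σ[ u ∈ ∃ ∣ U₁ ∣ ] proj₁ u ≉ᴹ 0ᴹ ×
                       P on⟨ proj₁ u +ᴹ ρ *ₗ proj₁ (SemilinearIso.map f u) ⟩)

    -- L is of pseudoregulus type in PG(2n - 1, qᵗ), with transversal spaces
    -- T₁ and T₂; the lines s i form the pseudoregulus.  The rank of the linear
    -- set L ∩ PG(s) for L = linearSet W is the F-dimension of W ∩ s.
    IsPseudoregulusType : (q n t : ℕ) → PointSet K V → (T₁ T₂ : Subspace K V) → Set (suc ℓ)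
    IsPseudoregulusType q n t L T₁ T₂ =
      HasDim (whole K V) (2 * n) ×
      Σ[ W ∈ FSubspace V ] (HasDim W (t * n) × IsScattered W × L ≐ linearSet W) ×
      Σ[ N ∈ ℕ ] N * (q ^ t ∸ 1) ≡ q ^ (n * t) ∸ 1 ×
      Σ[ s ∈ (Fin N → Subspace K V) ]
        (∀ i → HasDim (s i) 2 × HasDim (W ⊓ overF (s i)) t) ×
        (∀ i j → i ≢ j → PG (s i) ⊥ PG (s j)) ×
        IsTransversal s T₁ × IsTransversal s T₂ × ¬ (T₁ ≐ₛ T₂) ×
        (∀ T → IsTransversal s T → T ≐ₛ T₁ ⊎ T ≐ₛ T₂)
      where
      IsTransversal : ∀ {N} → (Fin N → Subspace K V) → Subspace K V → Set ℓ
      IsTransversal s T = HasDim T n × PG T ⊥ L × (∀ i → PG T ≬ PG (s i))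

{-# OPTIONS --safe #-}

-- After rescaling, Ψ is induced by a σ-semilinear map φ fixing a basis of V; then σ ^ t = id,
-- φ ^ t = id and F is the fixed field of σ.  Let θ be a basis of Θ.  The vectors φ ^ i (θ j) span V,
-- so by counting they form a basis, and in the corresponding coordinates the vectors fixed by φ are
-- those whose component in Θ ^ Ψ ^ i has coordinates σ ^ i ∘ a for one a.  Projecting from Γ onto Λ
-- keeps the components at i₁ and i₂, so the image of Σ is { x + f x : x ∈ Θ₁ } with
-- f = φ ^ (i₂ - i₁) modulo t, whose companion τ has fixed field F because i₂ - i₁ is prime to t.
-- The pseudoregulus consists of the lines ⟨ x , f x ⟩.  An n-dimensional T meeting all of them
-- contains Θ₁ or Θ₂, or else is the graph of a linear map x ↦ γ x · f x; in the last case comparing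
-- the factors γ at x₁, x₂ and k x₁ + x₂ gives τ = id, which is impossible.

module Submission where

open import Defs
open import Algebra.Bundles using (Ring; CommutativeRing; CommutativeMonoid)
open import Algebra.Apartness.Bundles using (HeytingField; HeytingCommutativeRing)
open import Algebra.Apartness.Properties.HeytingCommutativeRing using (1#0; x-0≈x)
open import Algebra.Module.Bundles using (LeftModule)
open import Algebra.Morphism.Structures using (IsGroupIsomorphism; IsRingIsomorphism; IsRingMonomorphism)
import Algebra.Module.Construct.TensorUnit as TensorUnit
import Algebra.Module.Properties.LeftModule as LeftModuleProperties
import Algebra.Morphism.Construct.Composition as Composition
import Algebra.Morphism.Construct.Identity as Identity
import Algebra.Properties.AbelianGroup as AbelianGroupProperties
import Algebra.Properties.CommutativeMonoid.Sum as Sum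
import Algebra.Properties.CommutativeSemigroup as CommutativeSemigroupProperties
import Algebra.Properties.Ring as RingProperties
open import Data.Fin.Base as Fin using (Fin; toℕ; zero; suc; combine; remQuot; punchIn; punchOut; inject₁; fromℕ; funToFin; finToFun; _↑ˡ_; _↑ʳ_; splitAt)
import Data.Fin.Induction as Fin
import Data.Fin.Properties as Fin
open import Data.Nat.Base as ℕ using (ℕ; zero; suc; _*_; _^_; _∸_; _≤_; _<_; s≤s; z≤n; ∣_-_∣)
import Data.Nat.Properties as ℕ
open import Data.Nat.GCD using (gcd; GCD; gcd-GCD; module Bézout)
open import Data.Nat.GeneralisedArithmetic using (fold; fold-+)
open import Data.Product.Base using (∃; ∃-syntax; Σ-syntax; _×_; _,_; proj₁; proj₂)
open import Data.Sum.Base as ⊎ using (_⊎_; inj₁; inj₂; [_,_]′)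
open import Data.Unit.Polymorphic.Base using (tt)
open import Data.Vec.Functional using (insertAt; removeAt; _∷_; [])
import Data.Vec.Functional.Properties as Vec
open import Function.Base using (_∘_; id)
open import Function.Bundles using (Inverse; Equivalence; _⇔_; mk⇔)
open import Function.Definitions using (Injective)
open import Relation.Binary.Definitions using (Decidable)
import Relation.Binary.Reasoning.Setoid as ≈-Reasoning
open import Relation.Binary.PropositionalEquality.Core as ≡ using (_≡_; _≢_)
open import Relation.Binary.PropositionalEquality.Properties as ≡ using (setoid)
open import Relation.Nullary.Decidable as Dec using (Dec; yes; no; ¬?; decidable-stable)
open import Relation.Nullary.Negation using (¬_; contradiction)
open import Relation.Unary using (Pred; _∈_; _∪_; _⊥_; _≐_; _≬_; _⊆_; ⋃)

-- Dimension arguments are carried out by counting: coefficient vectors over a finite field are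
-- coded by `Fin (m ^ d)`, where an injective self-map is onto. The same codes make equality,
-- membership and the existence of coefficients decidable, which the case distinctions on
-- transversal spaces rely on. The obstacle is that `Ψ` speaks about points only: a fixed point is
-- merely an eigenvector of `map`, and the order `t` holds up to scalars. The remedy is the family
-- of test vectors `vec c`, the sum of one basis vector and `c` times another. `φ` sends `vec c` to
-- `vec (σ c)`, and proportional test vectors coincide, so facts about points become facts about the
-- scalar `c`. The exponent of `f` is taken as `toℕ i₂ + (t ∸ toℕ i₁)`, a natural number congruent
-- to the difference of the indices modulo `t`. The lines of the pseudoregulus are indexed by
-- normalised coordinate vectors, one for each point of a projective space of dimension n - 1 over
-- K; this is where their number comes from.

injective⇒surjective : ∀ {n} {f : Fin n → Fin n} → Injective _≡_ _≡_ f → ∀ y → ∃[ x ] f x ≡ y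
injective⇒surjective {suc n} {f} inj y with Fin.any? (λ x → f x Fin.≟ y)
... | yes hit = hit
... | no miss = contradiction
  (Fin.injective⇒≤ (λ {i} {j} eq → inj (Fin.punchOut-injective (y≢f i) (y≢f j) eq)))
  (ℕ.<-irrefl ≡.refl)
  where
  y≢f : ∀ x → y ≢ f x
  y≢f x eq = miss (x , ≡.sym eq)

-- Finite fields: search, inverses and the coding of coordinate vectors.

commRing : ∀ {ℓ} → Field ℓ → CommutativeRing ℓ ℓ
commRing K = HeytingCommutativeRing.commutativeRing (HeytingField.heytingCommutativeRing K)

module FiniteField {ℓ} (K : Field ℓ) {m : ℕ} (card : HasCardinality K m) where
  open CommutativeRing (commRing K) hiding (zero) renaming (_*_ to _·_)

  HCR = HeytingField.heytingCommutativeRing K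

  enum : Fin m → Carrier
  enum = Inverse.from card

  code : Carrier → Fin m
  code = Inverse.to card

  enum-code : ∀ a → enum (code a) ≈ a
  enum-code = Inverse.strictlyInverseʳ card

  code-enum : ∀ i → code (enum i) ≡ i
  code-enum = Inverse.strictlyInverseˡ card

  infix 4 _≟_

  _≟_ : Decidable _≈_
  a ≟ b = Dec.map′ (λ eq → trans (sym (enum-code a)) (trans (reflexive (≡.cong enum eq)) (enum-code b)))
                   (Inverse.to-cong card) (code a Fin.≟ code b)

  1≉0 : 1# ≉ 0#
  1≉0 eq = proj₂ (HeytingField.tight K 1# 0#) eq (1#0 HCR)

  -- Being unequal to zero does not directly give apartness, so the inverse is found by search. If
  -- the search fails, apartness from zero is impossible, since it would supply an inverse, and
  -- `tight` then forces `a ≈ 0#`.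
  inverse : ∀ {a} → a ≉ 0# → ∃[ b ] b · a ≈ 1#
  inverse {a} a≉0 with Fin.any? (λ i → enum i · a ≟ 1#)
  ... | yes (i , eq) = enum i , eq
  ... | no none = contradiction
    (proj₁ (HeytingField.tight K a 0#) (λ a#0 →
      let (b , ba≈1 , _) = HeytingField.#⇒invertible K a#0 in
      none (code b , trans (*-cong (enum-code b) (sym (x-0≈x HCR a))) ba≈1)))
    a≉0

  zero-product : ∀ {a b} → a ≉ 0# → a · b ≈ 0# → b ≈ 0#
  zero-product {a} {b} a≉0 ab≈0 = let (c , ca≈1) = inverse a≉0 in
    trans (sym (*-identityˡ b)) (trans (*-congʳ (sym ca≈1))
      (trans (*-assoc c a b) (trans (*-congˡ ab≈0) (zeroʳ c))))

  1<m : 1 < m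
  1<m = go (λ eq → 1≉0 (trans (sym (enum-code 1#)) (trans (reflexive (≡.cong enum eq)) (enum-code 0#))))
    where
    go : ∀ {k} {i j : Fin k} → i ≢ j → 1 < k
    go {suc zero} {zero} {zero} i≢j = contradiction ≡.refl i≢j
    go {suc (suc k)} _ = s≤s (s≤s z≤n)

  module _ {d : ℕ} where
    -- The base `m` digits of `k`, read as coordinates. Together with `codeᵛ` this is a bijection
    -- onto vectors up to pointwise `≈`, and it is what turns dimension statements into statements
    -- about self-maps of a finite set.
    enumᵛ : Fin (m ^ d) → Fin d → Carrier
    enumᵛ k j = enum (finToFun k j)

    codeᵛ : (Fin d → Carrier) → Fin (m ^ d)
    codeᵛ c = funToFin (λ j → code (c j))

    enumᵛ-codeᵛ : ∀ c j → enumᵛ (codeᵛ c) j ≈ c j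
    enumᵛ-codeᵛ c j = trans (reflexive (≡.cong enum (Fin.finToFun-funToFin (λ j → code (c j)) j))) (enum-code (c j))

    enumᵛ-≡codeᵛ : ∀ {k c} → k ≡ codeᵛ c → ∀ j → enumᵛ k j ≈ c j
    enumᵛ-≡codeᵛ {c = c} ≡.refl = enumᵛ-codeᵛ c

    enumᵛ-injective : ∀ {k l} → (∀ j → enumᵛ k j ≈ enumᵛ l j) → k ≡ l
    enumᵛ-injective {k} {l} eq = ≡.trans (≡.sym (Fin.funToFin-finToFin {d} k))
      (≡.trans (funToFin-cong d (λ j → ≡.trans (≡.sym (code-enum _))
        (≡.trans (Inverse.to-cong card (eq j)) (code-enum _))))
      (Fin.funToFin-finToFin {d} l))
      where
      funToFin-cong : ∀ d {f g : Fin d → Fin m} → (∀ j → f j ≡ g j) → funToFin f ≡ funToFin g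
      funToFin-cong zero _ = ≡.refl
      funToFin-cong (suc d) f≗g = ≡.cong₂ combine (f≗g zero) (funToFin-cong d (f≗g ∘ suc))

    anyᵛ? : ∀ {p} {P : Pred (Fin d → Carrier) p} → (∀ {a b} → (∀ j → a j ≈ b j) → P a → P b) →
            (∀ a → Dec (P a)) → Dec (∃ P)
    anyᵛ? P-resp P? = Dec.map′ (λ (k , p) → enumᵛ k , p)
      (λ (a , p) → codeᵛ a , P-resp (λ j → sym (enumᵛ-codeᵛ a j)) p) (Fin.any? (P? ∘ enumᵛ))

  allOrCounterexample : ∀ {p} {P : Pred Carrier p} → (∀ {a b} → a ≈ b → P a → P b) →
                        (∀ a → Dec (P a)) → (∀ a → P a) ⊎ ∃[ a ] ¬ P a
  allOrCounterexample P-resp P? with Fin.any? (¬? ∘ P? ∘ enum)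
  ... | yes (i , ¬p) = inj₂ (enum i , ¬p)
  ... | no none = inj₁ (λ a → P-resp (enum-code a)
          (decidable-stable (P? _) (λ ¬p → none (code a , ¬p))))

-- Linear combinations, doubly indexed families, bases and dimension counting.

module LinearAlgebra {ℓ} (K : Field ℓ) (V : VectorSpace K) where
  open CommutativeRing (commRing K) hiding (zero) renaming (_*_ to _·_)
  open LeftModule V
  open Sum +ᴹ-commutativeMonoid
  open AbelianGroupProperties +ᴹ-abelianGroup using (∙-cancelˡ)
  open AbelianGroupProperties +-abelianGroup using (xyx⁻¹≈y)
  open LeftModuleProperties V using (inverseʳ-uniqueᴹ)
  private module ≈ᴹ-Reasoning = ≈-Reasoning ≈ᴹ-setoid

  Vectors : ℕ → Set ℓ
  Vectors d = Fin d → Carrierᴹ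

  Scalars : ℕ → Set ℓ
  Scalars d = Fin d → Carrier

  -- Opaque, so that unification never unfolds the sum.
  opaque
    lc : ∀ {d} → Scalars d → Vectors d → Carrierᴹ
    lc = linComb {K = K} {V = V}

    lc² : ∀ {m n} → (Fin m → Scalars n) → (Fin m → Vectors n) → Carrierᴹ
    lc² c b = sum (λ i → lc (c i) (b i))

  Independent : ∀ {d} → Vectors d → Set ℓ
  Independent x = ∀ a → lc a x ≈ᴹ 0ᴹ → ∀ j → a j ≈ 0#

  Spans : ∀ {d} → Vectors d → Pred Carrierᴹ ℓ
  Spans x v = ∃[ a ] v ≈ᴹ lc a x

  opaque
    unfolding lc

    mkBasis : ∀ {S : Subspace K V} {d} {x : Vectors d} → (∀ j → x j ∈ ∣ S ∣) → Independent x →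
              (∀ {v} → v ∈ ∣ S ∣ → Spans x v) → IsBasis S x
    mkBasis member independent spanning = record { member = member ; independent = independent ; spanning = spanning }

    basis-independent : ∀ {S : Subspace K V} {d} {x : Vectors d} → IsBasis S x → Independent x
    basis-independent = IsBasis.independent

    basis-spanning : ∀ {S : Subspace K V} {d} {x : Vectors d} → IsBasis S x → ∀ {v} → v ∈ ∣ S ∣ → Spans x v
    basis-spanning = IsBasis.spanning

  opaque
    unfolding lc

    lc-cong : ∀ {d} {a b : Scalars d} {x y : Vectors d} → (∀ j → a j ≈ b j) → (∀ j → x j ≈ᴹ y j) → lc a x ≈ᴹ lc b y
    lc-cong a≈b x≈y = sum-cong-≋ (λ j → *ₗ-cong (a≈b j) (x≈y j))

  lc-congˡ : ∀ {d} {a b : Scalars d} {x : Vectors d} → (∀ j → a j ≈ b j) → lc a x ≈ᴹ lc b x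
  lc-congˡ a≈b = lc-cong a≈b (λ _ → ≈ᴹ-refl)

  lc-congʳ : ∀ {d} {a : Scalars d} {x y : Vectors d} → (∀ j → x j ≈ᴹ y j) → lc a x ≈ᴹ lc a y
  lc-congʳ = lc-cong (λ _ → refl)

  opaque
    unfolding lc

    lc-+ : ∀ {d} (a b : Scalars d) (x : Vectors d) → lc (λ j → a j + b j) x ≈ᴹ lc a x +ᴹ lc b x
    lc-+ a b x = ≈ᴹ-trans (sum-cong-≋ (λ j → *ₗ-distribʳ (x j) (a j) (b j)))
      (∑-distrib-+ (λ j → a j *ₗ x j) (λ j → b j *ₗ x j))

    lc-+ʳ : ∀ {d} (a : Scalars d) (x y : Vectors d) → lc a (λ j → x j +ᴹ y j) ≈ᴹ lc a x +ᴹ lc a y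
    lc-+ʳ a x y = ≈ᴹ-trans (sum-cong-≋ (λ j → *ₗ-distribˡ (a j) (x j) (y j)))
      (∑-distrib-+ (λ j → a j *ₗ x j) (λ j → a j *ₗ y j))

  *ₗ-sum : ∀ {d} k (x : Vectors d) → k *ₗ sum x ≈ᴹ sum (λ j → k *ₗ x j)
  *ₗ-sum {zero} k x = *ₗ-zeroʳ k
  *ₗ-sum {suc d} k x = ≈ᴹ-trans (*ₗ-distribˡ k _ _) (+ᴹ-congˡ (*ₗ-sum k (x ∘ suc)))

  opaque
    unfolding lc

    lc-* : ∀ {d} k (a : Scalars d) (x : Vectors d) → lc (λ j → k · a j) x ≈ᴹ k *ₗ lc a x
    lc-* k a x = ≈ᴹ-trans (sum-cong-≋ (λ j → *ₗ-assoc k (a j) (x j))) (≈ᴹ-sym (*ₗ-sum k (λ j → a j *ₗ x j)))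

  sum-0 : ∀ {d} {x : Vectors d} → (∀ j → x j ≈ᴹ 0ᴹ) → sum x ≈ᴹ 0ᴹ
  sum-0 {d} x≈0 = ≈ᴹ-trans (sum-cong-≋ x≈0) (sum-replicate-zero d)

  opaque
    unfolding lc

    lc-0 : ∀ {d} {a : Scalars d} {x : Vectors d} → (∀ j → a j ≈ 0#) → lc a x ≈ᴹ 0ᴹ
    lc-0 {x = x} a≈0 = sum-0 (λ j → ≈ᴹ-trans (*ₗ-congʳ (a≈0 j)) (*ₗ-zeroˡ (x j)))

  opaque
    unfolding lc

    lc-suc : ∀ {d} (a : Scalars (suc d)) (x : Vectors (suc d)) → lc a x ≈ᴹ a zero *ₗ x zero +ᴹ lc (a ∘ suc) (x ∘ suc)
    lc-suc a x = ≈ᴹ-refl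

  opaque
    unfolding lc²

    lc²-[] : ∀ {n} (c : Fin 0 → Scalars n) (b : Fin 0 → Vectors n) → lc² c b ≈ᴹ 0ᴹ
    lc²-[] c b = ≈ᴹ-refl

    lc²-suc : ∀ {m n} (c : Fin (suc m) → Scalars n) (b : Fin (suc m) → Vectors n) →
              lc² c b ≈ᴹ lc (c zero) (b zero) +ᴹ lc² (c ∘ suc) (b ∘ suc)
    lc²-suc c b = ≈ᴹ-refl

    lc²-cong : ∀ {m n} {c d : Fin m → Scalars n} {b b′ : Fin m → Vectors n} →
               (∀ i j → c i j ≈ d i j) → (∀ i j → b i j ≈ᴹ b′ i j) → lc² c b ≈ᴹ lc² d b′
    lc²-cong c≈d b≈b′ = sum-cong-≋ (λ i → lc-cong (c≈d i) (b≈b′ i))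

    lc²-0 : ∀ {m n} {c : Fin m → Scalars n} {b : Fin m → Vectors n} → (∀ i j → c i j ≈ 0#) → lc² c b ≈ᴹ 0ᴹ
    lc²-0 c≈0 = sum-0 (λ i → lc-0 (c≈0 i))

    lc²-removeAt : ∀ {m n} i (c : Fin (suc m) → Scalars n) (b : Fin (suc m) → Vectors n) →
                   lc² c b ≈ᴹ lc (c i) (b i) +ᴹ lc² (removeAt c i) (removeAt b i)
    lc²-removeAt i c b = sum-remove {i = i} (λ i → lc (c i) (b i))

    lc²-last : ∀ {m n} (c : Fin (suc m) → Scalars n) (b : Fin (suc m) → Vectors n) →
               lc² c b ≈ᴹ lc² (c ∘ inject₁) (b ∘ inject₁) +ᴹ lc (c (fromℕ m)) (b (fromℕ m))
    lc²-last c b = sum-init-last (λ i → lc (c i) (b i))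

  lc-pair : ∀ (c : Scalars 2) u w → lc c (u ∷ w ∷ []) ≈ᴹ c zero *ₗ u +ᴹ c (suc zero) *ₗ w
  lc-pair c u w = ≈ᴹ-trans (lc-suc c (u ∷ w ∷ [])) (+ᴹ-congˡ (≈ᴹ-trans (lc-suc (c ∘ suc) (w ∷ []))
    (≈ᴹ-trans (+ᴹ-congˡ (lc-0 (λ ()))) (+ᴹ-identityʳ _))))

  opaque
    unfolding lc

    sum-*ₗ : ∀ {d} (a : Scalars d) (x : Vectors d) → sum (λ j → a j *ₗ x j) ≈ᴹ lc a x
    sum-*ₗ a x = ≈ᴹ-refl

    lc²-sum : ∀ {m n} {c : Fin m → Scalars n} {b : Fin m → Vectors n} {x : Vectors m} →
              (∀ i → lc (c i) (b i) ≈ᴹ x i) → lc² c b ≈ᴹ sum x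
    lc²-sum = sum-cong-≋

  -1*ₗ : ∀ v → (- 1#) *ₗ v ≈ᴹ -ᴹ v
  -1*ₗ v = inverseʳ-uniqueᴹ v ((- 1#) *ₗ v)
    (≈ᴹ-trans (+ᴹ-congʳ (≈ᴹ-sym (*ₗ-identityˡ v)))
    (≈ᴹ-trans (≈ᴹ-sym (*ₗ-distribʳ v 1# (- 1#)))
    (≈ᴹ-trans (*ₗ-congʳ (-‿inverseʳ 1#)) (*ₗ-zeroˡ v))))

  δ : ∀ {d} → Fin d → Scalars d
  δ zero zero = 1#
  δ zero (suc _) = 0#
  δ (suc i) zero = 0#
  δ (suc i) (suc j) = δ i j

  opaque
    unfolding lc

    lc-δ : ∀ {d} i (x : Vectors d) → lc (δ i) x ≈ᴹ x i
    lc-δ zero x = ≈ᴹ-trans (+ᴹ-cong (*ₗ-identityˡ _) (lc-0 {a = λ _ → 0#} {x ∘ suc} (λ _ → refl))) (+ᴹ-identityʳ (x zero))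
    lc-δ (suc i) x = ≈ᴹ-trans (+ᴹ-cong (*ₗ-zeroˡ _) (lc-δ i (x ∘ suc))) (+ᴹ-identityˡ _)

  δ-off : ∀ {d} {i j : Fin d} → i ≢ j → δ i j ≈ 0#
  δ-off {i = zero} {zero} i≢j = contradiction ≡.refl i≢j
  δ-off {i = zero} {suc j} _ = refl
  δ-off {i = suc i} {zero} _ = refl
  δ-off {i = suc i} {suc j} i≢j = δ-off (i≢j ∘ ≡.cong suc)

  δ-diagonal : ∀ {d} (i : Fin d) → δ i i ≈ 1#
  δ-diagonal zero = refl
  δ-diagonal (suc i) = δ-diagonal i

  sum-splitAt : ∀ m {n} (x : Vectors (m ℕ.+ n)) → sum x ≈ᴹ sum (x ∘ (_↑ˡ n)) +ᴹ sum (x ∘ (m ↑ʳ_))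
  sum-splitAt zero x = ≈ᴹ-sym (+ᴹ-identityˡ _)
  sum-splitAt (suc m) x = ≈ᴹ-trans (+ᴹ-congˡ (sum-splitAt m (x ∘ suc))) (≈ᴹ-sym (+ᴹ-assoc _ _ _))

  sum-combine : ∀ m {n} (x : Vectors (m * n)) → sum x ≈ᴹ sum (λ i → sum (λ j → x (combine {m} i j)))
  sum-combine zero x = ≈ᴹ-refl
  sum-combine (suc m) {n} x = ≈ᴹ-trans (sum-splitAt n x) (+ᴹ-congˡ (sum-combine m (x ∘ (n ↑ʳ_))))

  -- The conjugates of a basis carry two indices, the power of `φ` and the basis vector. `lc²` keeps
  -- them apart so that whole rows can be removed or shifted; flattening serves the places where a
  -- single index is required, as in `IsBasis`.
  flatten : ∀ {a} {A : Set a} {m n} → (Fin m → Fin n → A) → Fin (m * n) → A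
  flatten {m = m} {n} f k = let (i , j) = remQuot {m} n k in f i j

  unflatten : ∀ {a} {A : Set a} {m n} → (Fin (m * n) → A) → Fin m → Fin n → A
  unflatten f i j = f (combine i j)

  flatten-unflatten : ∀ {a} {A : Set a} {m n} (f : Fin (m * n) → A) k → flatten {m = m} {n} (unflatten f) k ≡ f k
  flatten-unflatten {m = m} {n} f k = ≡.cong f (Fin.combine-remQuot {m} n k)

  unflatten-flatten : ∀ {a} {A : Set a} {m n} (f : Fin m → Fin n → A) i j → flatten f (combine i j) ≡ f i j
  unflatten-flatten f i j = ≡.cong (λ p → f (proj₁ p) (proj₂ p)) (Fin.remQuot-combine i j)

  opaque
    unfolding lc lc²

    lc-flatten : ∀ {m n} (c : Fin m → Scalars n) (b : Fin m → Vectors n) → lc (flatten c) (flatten b) ≈ᴹ lc² c b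
    lc-flatten {m} {n} c b = ≈ᴹ-trans (sum-combine m {n} (λ k → flatten c k *ₗ flatten b k)) (sum-cong-≋ (λ i → sum-cong-≋ (λ j →
      ≈ᴹ-reflexive (≡.cong₂ _*ₗ_ (unflatten-flatten c i j) (unflatten-flatten b i j)))))

  Independent² : ∀ {m n} → (Fin m → Vectors n) → Set ℓ
  Independent² b = ∀ c → lc² c b ≈ᴹ 0ᴹ → ∀ i j → c i j ≈ 0#

  flatten-independent : ∀ {m n} {b : Fin m → Vectors n} → Independent² b → Independent (flatten b)
  flatten-independent {m} {n} {b} ind a eq k = trans (reflexive (≡.sym (flatten-unflatten {m = m} {n} a k)))
    (ind (unflatten a) (≈ᴹ-trans (≈ᴹ-sym (lc-flatten _ b))
      (≈ᴹ-trans (lc-congˡ (λ k → reflexive (flatten-unflatten {m = m} {n} a k))) eq)) _ _)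

  unflatten-independent : ∀ {m n} {b : Fin m → Vectors n} → Independent (flatten b) → Independent² b
  unflatten-independent {b = b} ind c eq i j = trans (reflexive (≡.sym (unflatten-flatten c i j)))
    (ind (flatten c) (≈ᴹ-trans (lc-flatten c b) eq) (combine i j))

  flatten-isBasis : ∀ {m n} {b : Fin m → Vectors n} {S : Subspace K V} → (∀ i j → b i j ∈ ∣ S ∣) → Independent² b →
                    (∀ {v} → v ∈ ∣ S ∣ → ∃[ c ] v ≈ᴹ lc² c b) → IsBasis S (flatten b)
  flatten-isBasis {b = b} member ind spans = mkBasis (λ k → member _ _) (flatten-independent ind)
    (λ v∈S → let (c , eq) = spans v∈S in flatten c , ≈ᴹ-trans eq (≈ᴹ-sym (lc-flatten c b)))

  x-y≈0 : ∀ {a b} → a - b ≈ 0# → a ≈ b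
  x-y≈0 {a} {b} eq = trans (RingProperties.+-inverseˡ-unique ring a (- b) eq) (RingProperties.-‿involutive ring b)

  lc-injective : ∀ {d} {x : Vectors d} → Independent x → ∀ {a b} → lc a x ≈ᴹ lc b x → ∀ j → a j ≈ b j
  lc-injective {x = x} ind {a} {b} eq j = x-y≈0 (ind (λ j → a j - b j) (∙-cancelˡ (lc b x) _ _ (begin
    lc b x +ᴹ lc (λ j → a j - b j) x  ≈⟨ lc-+ b (λ j → a j - b j) x ⟨
    lc (λ j → b j + (a j - b j)) x    ≈⟨ lc-congˡ (λ j → trans (sym (+-assoc _ _ _)) (xyx⁻¹≈y (b j) (a j))) ⟩
    lc a x                            ≈⟨ eq ⟩
    lc b x                            ≈⟨ +ᴹ-identityʳ _ ⟨
    lc b x +ᴹ 0ᴹ                      ∎)) j)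
    where open ≈ᴹ-Reasoning

  lc²-injective : ∀ {m n} {b : Fin m → Vectors n} → Independent² b → ∀ {c d} → lc² c b ≈ᴹ lc² d b → ∀ i j → c i j ≈ d i j
  lc²-injective {b = b} ind {c} {d} eq i j = trans (reflexive (≡.sym (unflatten-flatten c i j)))
    (trans (lc-injective (flatten-independent ind) (≈ᴹ-trans (lc-flatten c b) (≈ᴹ-trans eq (≈ᴹ-sym (lc-flatten d b)))) (combine i j))
      (reflexive (unflatten-flatten d i j)))

  sum∈ : ∀ {d} {x : Vectors d} (S : Subspace K V) → (∀ j → x j ∈ ∣ S ∣) → sum x ∈ ∣ S ∣
  sum∈ {zero} S _ = Subspace.0-closed S
  sum∈ {suc d} S x∈S = Subspace.+-closed S (x∈S zero) (sum∈ S (x∈S ∘ suc))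

  opaque
    unfolding lc

    lc∈ : ∀ {d} {x : Vectors d} (S : Subspace K V) → (∀ j → x j ∈ ∣ S ∣) → ∀ a → lc a x ∈ ∣ S ∣
    lc∈ S x∈S a = sum∈ S (λ j → Subspace.*ₗ-closed S (a j) (x∈S j))

  cancel∈ : ∀ (S : Subspace K V) {u v w} → u ≈ᴹ v +ᴹ w → u ∈ ∣ S ∣ → w ∈ ∣ S ∣ → v ∈ ∣ S ∣
  cancel∈ S {u} {v} {w} eq u∈S w∈S = Subspace.resp S (begin
    u +ᴹ (- 1# *ₗ w)    ≈⟨ +ᴹ-cong eq (-1*ₗ w) ⟩
    (v +ᴹ w) +ᴹ (-ᴹ w)  ≈⟨ +ᴹ-assoc v w _ ⟩
    v +ᴹ (w +ᴹ (-ᴹ w))  ≈⟨ +ᴹ-congˡ (-ᴹ‿inverseʳ w) ⟩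
    v +ᴹ 0ᴹ             ≈⟨ +ᴹ-identityʳ v ⟩
    v                   ∎) (Subspace.+-closed S u∈S (Subspace.*ₗ-closed S (- 1#) w∈S))
    where open ≈ᴹ-Reasoning

  span : ∀ {d} → Vectors d → Subspace K V
  span x = record
    { ∣_∣ = Spans x
    ; resp = λ eq (a , v≈) → a , ≈ᴹ-trans (≈ᴹ-sym eq) v≈
    ; 0-closed = (λ _ → 0#) , ≈ᴹ-sym (lc-0 (λ _ → refl))
    ; +-closed = λ (a , u≈) (b , v≈) → (λ j → a j + b j) , ≈ᴹ-trans (+ᴹ-cong u≈ v≈) (≈ᴹ-sym (lc-+ a b x))
    ; *ₗ-closed = λ k (a , v≈) → (λ j → k · a j) , ≈ᴹ-trans (*ₗ-congˡ v≈) (≈ᴹ-sym (lc-* k a x))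
    }

  x∈span : ∀ {d} (x : Vectors d) j → x j ∈ ∣ span x ∣
  x∈span x j = δ j , ≈ᴹ-sym (lc-δ j x)

  row∈span : ∀ {m n} (b : Fin m → Vectors n) i j → b i j ∈ ∣ span (flatten b) ∣
  row∈span b i j = Subspace.resp (span (flatten b)) (≈ᴹ-reflexive (unflatten-flatten b i j)) (x∈span (flatten b) (combine i j))

  span-flatten⇒lc² : ∀ {m n} (b : Fin m → Vectors n) {v} → v ∈ ∣ span (flatten b) ∣ → ∃[ c ] v ≈ᴹ lc² c b
  span-flatten⇒lc² {m} {n} b (a , v≈) = unflatten a , ≈ᴹ-trans v≈ (≈ᴹ-trans
    (lc-congˡ (λ k → reflexive (≡.sym (flatten-unflatten {m = m} {n} a k)))) (lc-flatten (unflatten a) b))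

  lc²∈span : ∀ {m n} (b : Fin m → Vectors n) c → lc² c b ∈ ∣ span (flatten b) ∣
  lc²∈span b c = flatten c , ≈ᴹ-sym (lc-flatten c b)

  span-isBasis : ∀ {d} {x : Vectors d} → Independent x → IsBasis (span x) x
  span-isBasis {x = x} ind = mkBasis (x∈span x) ind id

  isBasis-resp : ∀ {S T : Subspace K V} {d} {x : Vectors d} → S ≐ₛ T → IsBasis S x → IsBasis T x
  isBasis-resp (S⊆T , T⊆S) basis = record
    { member = λ j → S⊆T (member j)
    ; independent = independent
    ; spanning = λ v∈T → spanning (T⊆S v∈T)
    }
    where open IsBasis basis

  basis⊆span : ∀ {S : Subspace K V} {d} {x : Vectors d} → IsBasis S x → S ≐ₛ span x
  basis⊆span {S} {x = x} basis =
    basis-spanning basis , λ (a , eq) → Subspace.resp S (≈ᴹ-sym eq) (lc∈ S (IsBasis.member basis) a)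

  ⟨⟩-least : ∀ {X : Pred Carrierᴹ ℓ} (S : Subspace K V) → X ⊆ ∣ S ∣ → Generated {K = K} {V = V} X ⊆ ∣ S ∣
  ⟨⟩-least S X⊆S (incl v∈X) = X⊆S v∈X
  ⟨⟩-least S X⊆S (resp eq g) = Subspace.resp S eq (⟨⟩-least S X⊆S g)
  ⟨⟩-least S X⊆S zero = Subspace.0-closed S
  ⟨⟩-least S X⊆S (add g h) = Subspace.+-closed S (⟨⟩-least S X⊆S g) (⟨⟩-least S X⊆S h)
  ⟨⟩-least S X⊆S (mul k g) = Subspace.*ₗ-closed S k (⟨⟩-least S X⊆S g)

  module _ {m : ℕ} (card : HasCardinality K m) where
    open FiniteField K card

    *ₗ-zero-product : ∀ {k v} → k ≉ 0# → k *ₗ v ≈ᴹ 0ᴹ → v ≈ᴹ 0ᴹ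
    *ₗ-zero-product {k} {v} k≉0 kv≈0 = let (h , hk≈1) = inverse k≉0 in begin
      v               ≈⟨ *ₗ-identityˡ v ⟨
      1# *ₗ v         ≈⟨ *ₗ-congʳ hk≈1 ⟨
      (h · k) *ₗ v    ≈⟨ *ₗ-assoc h k v ⟩
      h *ₗ (k *ₗ v)   ≈⟨ *ₗ-congˡ kv≈0 ⟩
      h *ₗ 0ᴹ         ≈⟨ *ₗ-zeroʳ h ⟩
      0ᴹ              ∎
      where open ≈ᴹ-Reasoning

    module _ {S : Subspace K V} {d : ℕ} {e : Vectors d} (basis : IsBasis S e) where
  
      -- Sending `e`-coordinates of a vector to its `x`-coordinates is injective, because the latter
      -- recover the vector; hence it is onto, and both `a` and the zero vector are values. If
      -- `lc a x` vanishes, both values come from the same vector, so they agree.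
      spanning⇒independent : {x : Vectors d} → (∀ {v} → v ∈ ∣ S ∣ → Spans x v) → Independent x
      spanning⇒independent {x} spans a ax≈0 j =
        let (k , gk≡a) = injective⇒surjective g-injective (codeᵛ a)
            (l , gl≡0) = injective⇒surjective g-injective (codeᵛ {d} (λ _ → 0#))
            k≡l = v-injective (≈ᴹ-trans (≈ᴹ-trans (g-hits gk≡a) ax≈0)
                    (≈ᴹ-sym (≈ᴹ-trans (g-hits gl≡0) (lc-0 (λ _ → refl)))))
        in trans (sym (enumᵛ-≡codeᵛ {c = a} gk≡a j)) (enumᵛ-≡codeᵛ {c = λ _ → 0#} (≡.trans (≡.cong g k≡l) gl≡0) j)
        where
        v : Fin (m ^ d) → Carrierᴹ
        v k = lc (enumᵛ k) e
        g : Fin (m ^ d) → Fin (m ^ d)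
        g k = codeᵛ (proj₁ (spans (lc∈ S (IsBasis.member basis) (enumᵛ k))))
        v-injective : ∀ {k l} → v k ≈ᴹ v l → k ≡ l
        v-injective eq = enumᵛ-injective (lc-injective (basis-independent basis) eq)
        g-hits : ∀ {k b} → g k ≡ codeᵛ b → v k ≈ᴹ lc b x
        g-hits {k} {b} eq = ≈ᴹ-trans (proj₂ (spans (lc∈ S (IsBasis.member basis) (enumᵛ k)))) (lc-congˡ (λ i →
          trans (sym (enumᵛ-codeᵛ {d} _ i)) (enumᵛ-≡codeᵛ {c = b} eq i)))
        g-injective : Injective _≡_ _≡_ g
        g-injective {k} {l} eq = v-injective (≈ᴹ-trans (g-hits eq) (≈ᴹ-sym (g-hits ≡.refl)))

      -- Dual count: passing from `x`-coordinates to `e`-coordinates is injective by independence of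
      -- `x`, hence onto, so the `e`-coordinates of every vector of `S` are reached.
      independent⇒spanning : {x : Vectors d} → (∀ j → x j ∈ ∣ S ∣) → Independent x →
                             ∀ {v} → v ∈ ∣ S ∣ → Spans x v
      independent⇒spanning {x} x∈S ind {v} v∈S =
        let (c , v≈ce) = basis-spanning basis v∈S
            (k , gk≡c) = injective⇒surjective g-injective (codeᵛ c)
        in enumᵛ {d} k , ≈ᴹ-trans v≈ce (≈ᴹ-sym (g-hits gk≡c))
        where
        coords : (k : Fin (m ^ d)) → ∃[ c ] lc (enumᵛ k) x ≈ᴹ lc c e
        coords k = basis-spanning basis (lc∈ S x∈S (enumᵛ k))
        g : Fin (m ^ d) → Fin (m ^ d)
        g k = codeᵛ (proj₁ (coords k))
        g-hits : ∀ {k c} → g k ≡ codeᵛ c → lc (enumᵛ k) x ≈ᴹ lc c e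
        g-hits {k} {c} eq = ≈ᴹ-trans (proj₂ (coords k)) (lc-congˡ (λ i →
          trans (sym (enumᵛ-codeᵛ {d} _ i)) (enumᵛ-≡codeᵛ {c = c} eq i)))
        g-injective : Injective _≡_ _≡_ g
        g-injective {k} {l} eq = enumᵛ-injective (lc-injective ind (≈ᴹ-trans (g-hits eq) (≈ᴹ-sym (g-hits ≡.refl))))

      independent⇒isBasis : {x : Vectors d} → (∀ j → x j ∈ ∣ S ∣) → Independent x → IsBasis S x
      independent⇒isBasis x∈S ind = mkBasis x∈S ind (independent⇒spanning x∈S ind)

    module _ {d : ℕ} {e : Vectors d} (basis : IsBasis (whole K V) e) where
  
      ≈ᴹ-dec : Decidable _≈ᴹ_
      ≈ᴹ-dec u v = let (a , u≈) = basis-spanning basis {u} tt ; (b , v≈) = basis-spanning basis {v} tt in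
        Dec.map′ (λ a≈b → ≈ᴹ-trans u≈ (≈ᴹ-trans (lc-congˡ a≈b) (≈ᴹ-sym v≈)))
                 (λ u≈v → lc-injective (basis-independent basis) (≈ᴹ-trans (≈ᴹ-sym u≈) (≈ᴹ-trans u≈v v≈)))
                 (Fin.all? (λ j → a j ≟ b j))

      -- A search over the finitely many coefficient vectors; it is what lets `lifts?` be decided.
      member? : ∀ {S : Subspace K V} {d′} {x : Vectors d′} → IsBasis S x → ∀ v → Dec (v ∈ ∣ S ∣)
      member? {S} {x = x} basisS v =
        Dec.map′ (proj₂ (basis⊆span basisS)) (proj₁ (basis⊆span basisS))
          (anyᵛ? (λ a≈b eq → ≈ᴹ-trans eq (lc-congˡ a≈b)) (λ a → ≈ᴹ-dec v (lc a x)))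

-- Restriction of scalars, and the dimension of a space of known cardinality.

module _ {ℓ} (E : FieldExtension ℓ) (V : VectorSpace (FieldExtension.K E)) where
  open FieldExtension E
  open LeftModule V
  private
    module F = LinearAlgebra F (restrictScalars E V)
    module K = LinearAlgebra K V

  restrict-lc : ∀ {d} (b : F.Scalars d) (x : K.Vectors d) → F.lc b x ≈ᴹ K.lc (ι ∘ b) x
  restrict-lc {zero} b x = ≈ᴹ-trans (F.lc-0 (λ ())) (≈ᴹ-sym (K.lc-0 (λ ())))
  restrict-lc {suc d} b x = ≈ᴹ-trans (F.lc-suc b x) (≈ᴹ-trans (+ᴹ-congˡ (restrict-lc (b ∘ suc) (x ∘ suc))) (≈ᴹ-sym (K.lc-suc (ι ∘ b) x)))

module FiniteSpace {ℓ} (K : Field ℓ) (V : VectorSpace K) {q : ℕ} (card : HasCardinality K q)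
  {t : ℕ} (size : Inverse (LeftModule.≈ᴹ-setoid V) (setoid (Fin (q ^ t)))) where
  open CommutativeRing (commRing K) hiding (zero) renaming (_*_ to _·_)
  open LeftModule V
  open LinearAlgebra K V
  open FiniteField K card

  private
    vec : Fin (q ^ t) → Carrierᴹ
    vec = Inverse.from size

    vec-≡ : ∀ {v k} → Inverse.to size v ≡ k → v ≈ᴹ vec k
    vec-≡ {v} ≡.refl = ≈ᴹ-sym (Inverse.strictlyInverseʳ size v)

    _≟ᴹ_ : Decidable _≈ᴹ_
    u ≟ᴹ v = Dec.map′ (λ eq → ≈ᴹ-trans (vec-≡ eq) (Inverse.strictlyInverseʳ size v)) (Inverse.to-cong size)
                      (Inverse.to size u Fin.≟ Inverse.to size v)

    spans? : ∀ {d} (x : Vectors d) v → Dec (Spans x v)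
    spans? x v = anyᵛ? (λ a≈b eq → ≈ᴹ-trans eq (lc-congˡ a≈b)) (λ a → v ≟ᴹ lc a x)

    adjoin : ∀ {d} {x : Vectors d} {v} → Independent x → ¬ Spans x v → Independent (v ∷ x)
    adjoin {x = x} {v} ind v∉ a eq = λ
      { zero → a₀≈0
      ; (suc j) → ind (a ∘ suc) (≈ᴹ-trans (≈ᴹ-sym (+ᴹ-identityˡ _)) (≈ᴹ-trans
          (+ᴹ-congʳ (≈ᴹ-sym (≈ᴹ-trans (*ₗ-congʳ a₀≈0) (*ₗ-zeroˡ v)))) split)) j }
      where
      split : a zero *ₗ v +ᴹ lc (a ∘ suc) x ≈ᴹ 0ᴹ
      split = ≈ᴹ-trans (≈ᴹ-sym (lc-suc a (v ∷ x))) eq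
      a₀≈0 : a zero ≈ 0#
      -- A nonzero coefficient of `v` could be inverted, which would express `v` through `x`.
      a₀≈0 = decidable-stable (a zero ≟ 0#) (λ a₀≉0 → let (b , ba₀≈1) = inverse a₀≉0 in
        v∉ (Subspace.resp (span x) (begin
          b *ₗ - 1# *ₗ lc (a ∘ suc) x     ≈⟨ *ₗ-congˡ (-1*ₗ _) ⟩
          b *ₗ -ᴹ lc (a ∘ suc) x          ≈⟨ *ₗ-congˡ (inverseˡ-uniqueᴹ _ _ split) ⟨
          b *ₗ a zero *ₗ v                ≈⟨ *ₗ-assoc b (a zero) v ⟨
          (b · a zero) *ₗ v               ≈⟨ *ₗ-congʳ ba₀≈1 ⟩
          1# *ₗ v                         ≈⟨ *ₗ-identityˡ v ⟩
          v                               ∎)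
          (Subspace.*ₗ-closed (span x) b (Subspace.*ₗ-closed (span x) (- 1#) (a ∘ suc , ≈ᴹ-refl)))))
        where
        open ≈-Reasoning ≈ᴹ-setoid
        open LeftModuleProperties V using (inverseˡ-uniqueᴹ)

    unspanned : ∀ {d} → d < t → (x : Vectors d) → ∃[ v ] ¬ Spans x v
    unspanned {d} d<t x with Fin.any? (λ k → ¬? (spans? x (vec k)))
    ... | yes (k , ¬spans) = vec k , ¬spans
    ... | no none = contradiction (Fin.injective⇒≤ coords-injective) (ℕ.<⇒≱ (ℕ.^-monoʳ-< q 1<m d<t))
      where
      spans : ∀ k → Spans x (vec k)
      spans k = decidable-stable (spans? x (vec k)) (λ ¬p → none (k , ¬p))
      coords : Fin (q ^ t) → Fin (q ^ d)
      coords k = codeᵛ (proj₁ (spans k))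
      coords-injective : Injective _≡_ _≡_ coords
      coords-injective {k} {l} eq = ≡.trans (≡.sym (Inverse.strictlyInverseˡ size k)) (≡.trans
        (Inverse.to-cong size (≈ᴹ-trans (proj₂ (spans k)) (≈ᴹ-trans
          (lc-congˡ (λ j → trans (sym (enumᵛ-codeᵛ {d} _ j)) (enumᵛ-≡codeᵛ {c = proj₁ (spans l)} eq j)))
          (≈ᴹ-sym (proj₂ (spans l)))))) (Inverse.strictlyInverseˡ size l))

    independentFamily : ∀ d → d ≤ t → ∃[ x ] Independent {d} x
    independentFamily zero _ = (λ ()) , λ _ _ ()
    independentFamily (suc d) d<t =
      let (x , ind) = independentFamily d (ℕ.<⇒≤ d<t) ; (v , v∉) = unspanned d<t x in v ∷ x , adjoin ind v∉

  -- The degree of K over F is known only through cardinalities. While `d < t`, a family of `d`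
  -- vectors spans at most `q ^ d` vectors, so another one can be adjoined; `t` independent vectors
  -- then have `q ^ t` distinct combinations, which exhaust the space.
  dimension : HasDim (whole K V) t
  dimension = let (x , ind) = independentFamily t ℕ.≤-refl in x , mkBasis (λ _ → tt) ind (λ {v} _ →
    let (k , eq) = injective⇒surjective {f = λ k → Inverse.to size (lc (enumᵛ k) x)}
                     (λ {k} {l} eq → enumᵛ-injective (lc-injective ind (≈ᴹ-trans (vec-≡ eq)
                       (Inverse.strictlyInverseʳ size _))))
                     (Inverse.to size v)
    in enumᵛ k , ≈ᴹ-trans (vec-≡ (≡.sym eq)) (Inverse.strictlyInverseʳ size _))

-- Normalised representatives of projective points and their number.

module NormalisedPoints {ℓ} (K : Field ℓ) {m : ℕ} (card : HasCardinality K m) where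
  open CommutativeRing (commRing K) hiding (zero) renaming (_*_ to _·_)
  open FiniteField K card

  -- The first summand counts a leading 1 followed by `n` free coordinates, the second a leading 0
  -- followed by a shorter normalised vector.
  #points : ℕ → ℕ
  #points zero = 0
  #points (suc n) = m ^ n ℕ.+ #points n

  -- The vectors of K ^ n whose first nonzero coordinate is 1.
  point : ∀ {n} → Fin (#points n) → Fin n → Carrier
  leading : ∀ {n} → Fin (m ^ n) ⊎ Fin (#points n) → Fin (suc n) → Carrier

  point {suc n} k = leading (splitAt (m ^ n) k)

  leading (inj₁ c) = 1# ∷ enumᵛ c
  leading (inj₂ r) = 0# ∷ point r

  point≉0 : ∀ {n} (k : Fin (#points n)) → ¬ (∀ j → point {n} k j ≈ 0#)
  point≉0 {suc n} k p≈0 with splitAt (m ^ n) k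
  ... | inj₁ c = 1≉0 (p≈0 zero)
  ... | inj₂ r = point≉0 {n} r (p≈0 ∘ suc)

  -- Leading ones in the same position force the factor `c` to be 1. In different positions they
  -- give either 1 = 0 or `c` = 0, and the latter would make a normalised vector vanish.
  point-injective : ∀ {n} {k l : Fin (#points n)} {c} → (∀ j → point {n} k j ≈ c · point l j) → k ≡ l
  point-injective {suc n} {k} {l} {c} eq with splitAt (m ^ n) k in k≡ | splitAt (m ^ n) l in l≡
  ... | inj₁ a | inj₁ b = ≡.trans (≡.sym (Fin.splitAt⁻¹-↑ˡ k≡)) (≡.trans (≡.cong (_↑ˡ #points n) (enumᵛ-injective {n} (λ j →
          trans (eq (suc j)) (trans (*-congʳ (trans (sym (*-identityʳ c)) (sym (eq zero)))) (*-identityˡ _)))))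
          (Fin.splitAt⁻¹-↑ˡ l≡))
  ... | inj₁ a | inj₂ s = contradiction (trans (eq zero) (zeroʳ c)) 1≉0
  ... | inj₂ r | inj₁ b = contradiction (λ j → trans (eq (suc j)) (trans (*-congʳ (trans (sym (*-identityʳ c)) (sym (eq zero)))) (zeroˡ _))) (point≉0 {n} r)
  ... | inj₂ r | inj₂ s = ≡.trans (≡.sym (Fin.splitAt⁻¹-↑ʳ k≡)) (≡.trans (≡.cong (m ^ n ↑ʳ_) (point-injective {n} (eq ∘ suc)))
          (Fin.splitAt⁻¹-↑ʳ l≡))

  scaled-∷ : ∀ {n} {a : Fin (suc n) → Carrier} {c h} {b : Fin n → Carrier} →
             a zero ≈ c · h → (∀ j → a (suc j) ≈ c · b j) → ∀ j → a j ≈ c · (h ∷ b) j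
  scaled-∷ a₀ a′ zero = a₀
  scaled-∷ a₀ a′ (suc j) = a′ j

  normalise : ∀ {n} (a : Fin n → Carrier) → ¬ (∀ j → a j ≈ 0#) → ∃[ k ] ∃[ c ] (∀ j → a j ≈ c · point {n} k j)
  normalise {zero} a a≉0 = contradiction (λ ()) a≉0
  normalise {suc n} a a≉0 with a zero ≟ 0#
  ... | yes a₀≈0 =
    let (r , c , eq) = normalise (a ∘ suc) (λ a′≈0 → a≉0 (λ { zero → a₀≈0 ; (suc j) → a′≈0 j })) in
    m ^ n ↑ʳ r , c , λ j → ≡.subst (λ s → a j ≈ c · leading {n} s j) (≡.sym (Fin.splitAt-↑ʳ (m ^ n) (#points n) r))
      (scaled-∷ {a = a} {b = point {n} r} (trans a₀≈0 (sym (zeroʳ c))) eq j)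
  ... | no a₀≉0 =
    let (b , ba₀≈1) = inverse a₀≉0 ; e = codeᵛ {n} (λ j → b · a (suc j)) in
    e ↑ˡ #points n , a zero , λ j → ≡.subst (λ s → a j ≈ a zero · leading {n} s j) (≡.sym (Fin.splitAt-↑ˡ (m ^ n) e (#points n)))
      (scaled-∷ {a = a} {b = enumᵛ {n} e} (sym (*-identityʳ _)) (λ j → sym (trans (*-congˡ (enumᵛ-codeᵛ {n} _ j))
        (trans (sym (*-assoc _ _ _)) (trans (*-congʳ (trans (*-comm _ _) ba₀≈1)) (*-identityˡ _))))) j)

  -- The geometric sum with the division cleared; for `m` equal to `q ^ t` it is the number of lines
  -- required of a pseudoregulus.
  #points-count : ∀ n → #points n * (m ∸ 1) ≡ m ^ n ∸ 1
  #points-count zero = ≡.refl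
  #points-count (suc n) = begin
    (m ^ n ℕ.+ #points n) * (m ∸ 1)         ≡⟨ ℕ.*-distribʳ-+ (m ∸ 1) (m ^ n) (#points n) ⟩
    m ^ n * (m ∸ 1) ℕ.+ #points n * (m ∸ 1) ≡⟨ ≡.cong (m ^ n * (m ∸ 1) ℕ.+_) (#points-count n) ⟩
    m ^ n * (m ∸ 1) ℕ.+ (m ^ n ∸ 1)         ≡⟨ ℕ.+-∸-assoc (m ^ n * (m ∸ 1)) (ℕ.m^n>0 m {{ℕ.>-nonZero (ℕ.<⇒≤ 1<m)}} n) ⟨
    (m ^ n * (m ∸ 1) ℕ.+ m ^ n) ∸ 1         ≡⟨ ≡.cong (_∸ 1) (≡.trans (ℕ.+-comm _ (m ^ n)) (≡.sym (ℕ.*-suc (m ^ n) (m ∸ 1)))) ⟩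
    m ^ n * suc (m ∸ 1) ∸ 1                 ≡⟨ ≡.cong (λ h → m ^ n * h ∸ 1) (ℕ.m+[n∸m]≡n (ℕ.<⇒≤ 1<m)) ⟩
    m ^ n * m ∸ 1                           ≡⟨ ≡.cong (_∸ 1) (ℕ.*-comm (m ^ n) m) ⟩
    m ^ suc n ∸ 1                           ∎
    where open ≡.≡-Reasoning

-- Semilinear maps applied to linear combinations.

module SemilinearMap {ℓ} (K : Field ℓ) (V W : VectorSpace K) where
  private
    module K = CommutativeRing (commRing K)
    module V where
      open LeftModule V public
      open LinearAlgebra K V public
    module W where
      open LeftModule W public
      open LinearAlgebra K W public

  module _ {σ : K.Carrier → K.Carrier} {f : V.Carrierᴹ → W.Carrierᴹ}
    (f-cong : ∀ {u v} → u V.≈ᴹ v → f u W.≈ᴹ f v) (f-+ : ∀ u v → f (u V.+ᴹ v) W.≈ᴹ f u W.+ᴹ f v)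
    (f-0 : f V.0ᴹ W.≈ᴹ W.0ᴹ) (f-* : ∀ k v → f (k V.*ₗ v) W.≈ᴹ σ k W.*ₗ f v) where

    -- The laws of `f` are separate arguments because the computation serves three maps: the
    -- rescaled collineation `φ`, the F-linear parametrisation of a line section, and the inclusion
    -- of `Λ` into `V`.
    map-lc : ∀ {d} (a : V.Scalars d) (x : V.Vectors d) → f (V.lc a x) W.≈ᴹ W.lc (σ ∘ a) (f ∘ x)
    map-lc {zero} a x = W.≈ᴹ-trans (f-cong (V.lc-0 (λ ()))) (W.≈ᴹ-trans f-0 (W.≈ᴹ-sym (W.lc-0 (λ ()))))
    map-lc {suc d} a x = W.≈ᴹ-trans (f-cong (V.lc-suc a x)) (W.≈ᴹ-trans (f-+ _ _)
      (W.≈ᴹ-trans (W.+ᴹ-cong (f-* _ _) (map-lc (a ∘ suc) (x ∘ suc))) (W.≈ᴹ-sym (W.lc-suc (σ ∘ a) (f ∘ x)))))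

    map-lc² : ∀ {m n} (c : Fin m → V.Scalars n) (b : Fin m → V.Vectors n) →
              f (V.lc² c b) W.≈ᴹ W.lc² (λ i → σ ∘ c i) (λ i → f ∘ b i)
    map-lc² {zero} c b = W.≈ᴹ-trans (f-cong (V.lc²-[] c b)) (W.≈ᴹ-trans f-0 (W.≈ᴹ-sym (W.lc²-[] _ _)))
    map-lc² {suc m} c b = W.≈ᴹ-trans (f-cong (V.lc²-suc c b)) (W.≈ᴹ-trans (f-+ _ _)
      (W.≈ᴹ-trans (W.+ᴹ-cong (map-lc (c zero) (b zero)) (map-lc² (c ∘ suc) (b ∘ suc))) (W.≈ᴹ-sym (W.lc²-suc _ _))))

-- Spaces that split into two halves with bases `x` and `y`.

module Decomposition {ℓ} (K : Field ℓ) {m : ℕ} (card : HasCardinality K m) (M : VectorSpace K) {n : ℕ}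
  (x y : Fin n → LeftModule.Carrierᴹ M) where
  open CommutativeRing (commRing K) hiding (zero) renaming (_*_ to _·_)
  open LeftModule M
  open LinearAlgebra K M
  open FiniteField K card
  private module R = ≈-Reasoning ≈ᴹ-setoid

  infixr 5 _⊕_

  _⊕_ : Scalars n → Scalars n → Carrierᴹ
  a ⊕ b = lc a x +ᴹ lc b y

  record IsDecomposition : Set ℓ where
    field
      ⊕-independent : ∀ {a b} → a ⊕ b ≈ᴹ 0ᴹ → (∀ j → a j ≈ 0#) × (∀ j → b j ≈ 0#)
      ⊕-spanning : ∀ v → ∃[ a ] ∃[ b ] v ≈ᴹ a ⊕ b

  ⊕-cong : ∀ {a b c d} → (∀ j → a j ≈ c j) → (∀ j → b j ≈ d j) → a ⊕ b ≈ᴹ c ⊕ d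
  ⊕-cong a≈c b≈d = +ᴹ-cong (lc-congˡ a≈c) (lc-congˡ b≈d)

  ⊕-+ : ∀ a b c d → (λ j → a j + c j) ⊕ (λ j → b j + d j) ≈ᴹ (a ⊕ b) +ᴹ (c ⊕ d)
  ⊕-+ a b c d = ≈ᴹ-trans (+ᴹ-cong (lc-+ a c x) (lc-+ b d y)) (+ᴹ-interchange _ _ _ _)
    where open CommutativeSemigroupProperties (CommutativeMonoid.commutativeSemigroup +ᴹ-commutativeMonoid)
            using () renaming (interchange to +ᴹ-interchange)

  ⊕-* : ∀ k a b → (λ j → k · a j) ⊕ (λ j → k · b j) ≈ᴹ k *ₗ (a ⊕ b)
  ⊕-* k a b = ≈ᴹ-trans (+ᴹ-cong (lc-* k a x) (lc-* k b y)) (≈ᴹ-sym (*ₗ-distribˡ k _ _))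

  0ᵛ : Scalars n
  0ᵛ _ = 0#

  joint : Subspace K M
  joint = record
    { ∣_∣ = λ v → ∃[ a ] ∃[ b ] v ≈ᴹ a ⊕ b
    ; resp = λ eq (a , b , v≈) → a , b , ≈ᴹ-trans (≈ᴹ-sym eq) v≈
    ; 0-closed = 0ᵛ , 0ᵛ , ≈ᴹ-sym (≈ᴹ-trans (+ᴹ-cong (lc-0 (λ _ → refl)) (lc-0 (λ _ → refl))) (+ᴹ-identityˡ 0ᴹ))
    ; +-closed = λ (a , b , u≈) (c , d , v≈) → _ , _ , ≈ᴹ-trans (+ᴹ-cong u≈ v≈) (≈ᴹ-sym (⊕-+ a b c d))
    ; *ₗ-closed = λ k (a , b , v≈) → _ , _ , ≈ᴹ-trans (*ₗ-congˡ v≈) (≈ᴹ-sym (⊕-* k a b))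
    }

  ⊕-0ʳ : ∀ a → lc a x ≈ᴹ a ⊕ 0ᵛ
  ⊕-0ʳ a = ≈ᴹ-sym (≈ᴹ-trans (+ᴹ-congˡ (lc-0 (λ _ → refl))) (+ᴹ-identityʳ _))

  ⊕-0ˡ : ∀ b → lc b y ≈ᴹ 0ᵛ ⊕ b
  ⊕-0ˡ b = ≈ᴹ-sym (≈ᴹ-trans (+ᴹ-congʳ (lc-0 (λ _ → refl))) (+ᴹ-identityˡ _))

  ⊕-0 : ∀ {a b} → (∀ j → a j ≈ 0#) → (∀ j → b j ≈ 0#) → a ⊕ b ≈ᴹ 0ᴹ
  ⊕-0 a≈0 b≈0 = ≈ᴹ-trans (+ᴹ-cong (lc-0 a≈0) (lc-0 b≈0)) (+ᴹ-identityˡ 0ᴹ)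

  pair-isBasis : ∀ {S : Subspace K M} → (∀ j → x j ∈ ∣ S ∣) → (∀ j → y j ∈ ∣ S ∣) →
                 (∀ {a b} → a ⊕ b ≈ᴹ 0ᴹ → (∀ j → a j ≈ 0#) × (∀ j → b j ≈ 0#)) →
                 (∀ {v} → v ∈ ∣ S ∣ → ∃[ a ] ∃[ b ] v ≈ᴹ a ⊕ b) → IsBasis S (flatten {m = 2} (x ∷ y ∷ []))
  pair-isBasis x∈S y∈S independent spanning = flatten-isBasis {m = 2} (λ { zero → x∈S ; (suc zero) → y∈S })
    (λ c eq → let (a≈0 , b≈0) = independent (≈ᴹ-trans (≈ᴹ-sym (lc²-pair c)) eq) in
      λ { zero → a≈0 ; (suc zero) → b≈0 })
    (λ v∈S → let (a , b , eq) = spanning v∈S in (a ∷ b ∷ []) , ≈ᴹ-trans eq (≈ᴹ-sym (lc²-pair (a ∷ b ∷ []))))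
    where
    lc²-pair : ∀ c → lc² c (x ∷ y ∷ []) ≈ᴹ c zero ⊕ c (suc zero)
    lc²-pair c = ≈ᴹ-trans (lc²-suc c (x ∷ y ∷ [])) (+ᴹ-congˡ (≈ᴹ-trans (lc²-suc (c ∘ suc) (y ∷ []))
      (≈ᴹ-trans (+ᴹ-congˡ (lc²-[] (λ i → c (suc (suc i))) [])) (+ᴹ-identityʳ _))))

  module _ (dec : IsDecomposition) where
    open IsDecomposition dec

    ⊕-injective : ∀ {a b c d} → a ⊕ b ≈ᴹ c ⊕ d → (∀ j → a j ≈ c j) × (∀ j → b j ≈ d j)
    ⊕-injective {a} {b} {c} {d} eq =
      let (a-c≈0 , b-d≈0) = ⊕-independent (begin
            (λ j → a j + - 1# · c j) ⊕ (λ j → b j + - 1# · d j)               ≈⟨ ⊕-+ a b _ _ ⟩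
            (a ⊕ b) +ᴹ ((λ j → - 1# · c j) ⊕ (λ j → - 1# · d j))              ≈⟨ +ᴹ-cong eq (⊕-* (- 1#) c d) ⟩
            (c ⊕ d) +ᴹ (- 1# *ₗ (c ⊕ d))                                      ≈⟨ +ᴹ-congˡ (-1*ₗ (c ⊕ d)) ⟩
            (c ⊕ d) +ᴹ (-ᴹ (c ⊕ d))                                           ≈⟨ -ᴹ‿inverseʳ (c ⊕ d) ⟩
            0ᴹ                                                                ∎)
      in (λ j → x-y≈0 (trans (+-congˡ (sym (-1*x≈-x (c j)))) (a-c≈0 j))) ,
         (λ j → x-y≈0 (trans (+-congˡ (sym (-1*x≈-x (d j)))) (b-d≈0 j)))
      where
      open R
      open RingProperties ring using (-1*x≈-x)

    x-independent : Independent x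
    x-independent a eq = proj₁ (⊕-independent (≈ᴹ-trans (≈ᴹ-sym (⊕-0ʳ a)) eq))

    y-independent : Independent y
    y-independent b eq = proj₂ (⊕-independent (≈ᴹ-trans (≈ᴹ-sym (⊕-0ˡ b)) eq))

    whole-isBasis : IsBasis (whole K M) (flatten {m = 2} (x ∷ y ∷ []))
    whole-isBasis = pair-isBasis (λ _ → tt) (λ _ → tt) ⊕-independent (λ {v} _ → ⊕-spanning v)

    -- `a` lifts when it lies in the projection of `T` along the span of `y`.
    lifts? : ∀ {T : Subspace K M} {d} {e : Vectors d} → IsBasis T e → ∀ a → Dec (∃[ b ] a ⊕ b ∈ ∣ T ∣)
    lifts? {T} basis a = anyᵛ? (λ b≈c → Subspace.resp T (⊕-cong (λ _ → refl) b≈c))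
      (λ b → member? card whole-isBasis basis (a ⊕ b))

    -- A vector space is not the union of two proper subspaces, so either f maps everything into T
    -- or T projects onto the span of x.  In the second case lifts of x to T form a basis of T.
    contains-or-avoids : ∀ {T : Subspace K M} {e : Vectors n} → IsBasis T e →
      (f : Scalars n → Carrierᴹ) → (∀ a b → f (λ j → a j + b j) ≈ᴹ f a +ᴹ f b) →
      (∀ a → (∃[ b ] a ⊕ b ∈ ∣ T ∣) ⊎ f a ∈ ∣ T ∣) →
      (∀ a → f a ∈ ∣ T ∣) ⊎ (∀ b → lc b y ∈ ∣ T ∣ → ∀ j → b j ≈ 0#)
    contains-or-avoids {T} {e} basis f f-+ meets with Fin.any? (λ j → ¬? (lifts? basis (δ j)))
    -- Since `δ i` does not lift, `f (δ i)` lies in `T`. If `a` lifts, then `a + δ i` does not, as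
    -- the difference would lift `δ i`; so `f (a + δ i)` lies in `T`, and subtracting `f (δ i)`
    -- leaves `f a`.
    ... | yes (i , ¬lift) = inj₁ λ a → [ (λ (b , ab∈T) → cancel∈ T (f-+ a (δ i)) (fδ∈T′ a b ab∈T) fδ∈T) , id ]′ (meets a)
      where
      fδ∈T : f (δ i) ∈ ∣ T ∣
      fδ∈T = [ (λ lift → contradiction lift ¬lift) , id ]′ (meets (δ i))
      fδ∈T′ : ∀ a b → a ⊕ b ∈ ∣ T ∣ → f (λ j → a j + δ i j) ∈ ∣ T ∣
      fδ∈T′ a b ab∈T with meets (λ j → a j + δ i j)
      ... | inj₂ f∈T = f∈T
      ... | inj₁ (c , ∈T) = contradiction
        ((λ j → c j + - 1# · b j) , Subspace.resp T (begin
          ((λ j → a j + δ i j) ⊕ c) +ᴹ (- 1# *ₗ (a ⊕ b))               ≈⟨ +ᴹ-congˡ (⊕-* (- 1#) a b) ⟨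
          ((λ j → a j + δ i j) ⊕ c) +ᴹ ((λ j → - 1# · a j) ⊕ (λ j → - 1# · b j)) ≈⟨ ⊕-+ _ _ _ _ ⟨
          (λ j → (a j + δ i j) + - 1# · a j) ⊕ (λ j → c j + - 1# · b j) ≈⟨ ⊕-cong (λ j → trans (+-congˡ (-1*x≈-x (a j))) (xyx⁻¹≈y (a j) (δ i j))) (λ _ → refl) ⟩
          δ i ⊕ (λ j → c j + - 1# · b j)                               ∎)
          (Subspace.+-closed T ∈T (Subspace.*ₗ-closed T (- 1#) ab∈T))) ¬lift
        where
        open R
        open RingProperties ring using (-1*x≈-x)
        open AbelianGroupProperties +-abelianGroup using (xyx⁻¹≈y)
    ... | no none = inj₂ λ b lcby∈T →
      let (c , eq) = independent⇒spanning card basis (λ i → proj₂ (lift i)) lifts-independent lcby∈T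
          -- The `x`-part of `lc b y` is zero, while that of the combination of lifts is `c`; so `c`
          -- vanishes.
          (0≈c , b≈) = ⊕-injective (≈ᴹ-trans (≈ᴹ-sym (⊕-0ˡ b)) (≈ᴹ-trans eq (proj₂ (lc-lifts c))))
      in y-independent b (≈ᴹ-trans eq (lc-0 (λ j → sym (0≈c j))))
      where
      lift : ∀ i → ∃[ b ] δ i ⊕ b ∈ ∣ T ∣
      lift i = decidable-stable (lifts? basis (δ i)) (λ ¬p → none (i , ¬p))
      lc-lifts : ∀ c → ∃[ b ] lc c (λ i → δ i ⊕ proj₁ (lift i)) ≈ᴹ c ⊕ b
      lc-lifts c = let (b , eq) = lc∈ (span y) (λ i → proj₁ (lift i) , ≈ᴹ-refl) c in
        b , ≈ᴹ-trans (lc-congʳ (λ i → +ᴹ-congʳ (lc-δ i x))) (≈ᴹ-trans (lc-+ʳ c x _) (+ᴹ-congˡ eq))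
      lifts-independent : Independent (λ i → δ i ⊕ proj₁ (lift i))
      lifts-independent c eq = proj₁ (⊕-independent (≈ᴹ-trans (≈ᴹ-sym (proj₂ (lc-lifts c))) eq))

-- Subspaces meeting every line that joins an `x`-vector `a` to the `y`-vector `τ ∘ a`.

module Transversals {ℓ} (K : Field ℓ) {m : ℕ} (card : HasCardinality K m) (M : VectorSpace K) {n : ℕ}
  {x y : Fin n → LeftModule.Carrierᴹ M} (dec : Decomposition.IsDecomposition K card M x y)
  {τ : Ring.Carrier (ringOf K) → Ring.Carrier (ringOf K)}
  (τ-iso : IsRingIsomorphism (Ring.rawRing (ringOf K)) (Ring.rawRing (ringOf K)) τ) where
  open CommutativeRing (commRing K) hiding (zero) renaming (_*_ to _·_)
  open LeftModule M
  open LinearAlgebra K M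
  open FiniteField K card
  open Decomposition K card M x y
  open IsDecomposition dec
  private
    module τ = IsRingIsomorphism τ-iso
    module Swap = Decomposition K card M y x
    module R = ≈-Reasoning (Ring.setoid (ringOf K))

  τ⁻¹ : Carrier → Carrier
  τ⁻¹ a = proj₁ (τ.surjective a)

  τ-τ⁻¹ : ∀ a → τ (τ⁻¹ a) ≈ a
  τ-τ⁻¹ a = proj₂ (τ.surjective a) refl

  τ⁻¹-τ : ∀ a → τ⁻¹ (τ a) ≈ a
  τ⁻¹-τ a = τ.injective (τ-τ⁻¹ (τ a))

  τ⁻¹-+ : ∀ a b → τ⁻¹ (a + b) ≈ τ⁻¹ a + τ⁻¹ b
  τ⁻¹-+ a b = τ.injective (trans (τ-τ⁻¹ _) (sym (trans (τ.+-homo _ _) (+-cong (τ-τ⁻¹ a) (τ-τ⁻¹ b)))))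

  τ≈0 : ∀ {a} → τ a ≈ 0# → a ≈ 0#
  τ≈0 eq = τ.injective (trans eq (sym τ.0#-homo))

  swapped : Swap.IsDecomposition
  swapped = record
    { ⊕-independent = λ eq → let (b , a) = ⊕-independent (≈ᴹ-trans (+ᴹ-comm _ _) eq) in a , b
    ; ⊕-spanning = λ v → let (a , b , eq) = ⊕-spanning v in b , a , ≈ᴹ-trans eq (+ᴹ-comm _ _)
    }

  module _ {T : Subspace K M} {e : Vectors n} (basis : IsBasis T e)
    (meets : (a : Scalars n) → ¬ (∀ j → a j ≈ 0#) → ∃[ α ] ∃[ β ] ¬ (α ≈ 0# × β ≈ 0#) ×
               (λ j → α · a j) ⊕ (λ j → β · τ (a j)) ∈ ∣ T ∣) where
    private
      module T = Subspace T

      all≈0? : (a : Scalars n) → Dec (∀ j → a j ≈ 0#)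
      all≈0? a = Fin.all? (λ j → a j ≟ 0#)

      -- Look at the nonzero vector of `T` on the line of `a`. If its `x`-coefficient is nonzero,
      -- divide by it; otherwise the vector is a nonzero multiple of the endpoint of the line in the
      -- `y`-half.
      lift-x : ∀ a → (∃[ γ ] a ⊕ (λ j → γ · τ (a j)) ∈ ∣ T ∣) ⊎ lc (τ ∘ a) y ∈ ∣ T ∣
      lift-x a with all≈0? a
      ... | yes a≈0 = inj₁ (0# , T.resp (≈ᴹ-sym (⊕-0 a≈0 (λ j → zeroˡ _))) T.0-closed)
      ... | no a≉0 with meets a a≉0
      ...   | α , β , αβ≉0 , ∈T with α ≟ 0#
      ...     | no α≉0 = let (h , hα≈1) = inverse α≉0 in
                inj₁ (h · β , T.resp (≈ᴹ-trans (≈ᴹ-sym (⊕-* h _ _)) (⊕-cong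
                  (λ j → trans (sym (*-assoc _ _ _)) (trans (*-congʳ hα≈1) (*-identityˡ _)))
                  (λ j → sym (*-assoc _ _ _)))) (T.*ₗ-closed h ∈T))
      ...     | yes α≈0 = let (h , hβ≈1) = inverse (λ β≈0 → αβ≉0 (α≈0 , β≈0)) in
                inj₂ (T.resp (≈ᴹ-trans (≈ᴹ-sym (⊕-* h _ _)) (≈ᴹ-trans (⊕-cong
                  (λ j → trans (*-congˡ (trans (*-congʳ α≈0) (zeroˡ _))) (zeroʳ h))
                  (λ j → trans (sym (*-assoc _ _ _)) (trans (*-congʳ hβ≈1) (*-identityˡ _)))) (≈ᴹ-sym (⊕-0ˡ _))))
                  (T.*ₗ-closed h ∈T))

      lift-y : ∀ a → (∃[ b ] lc (τ ∘ a) y +ᴹ lc b x ∈ ∣ T ∣) ⊎ lc a x ∈ ∣ T ∣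
      lift-y a with all≈0? a
      ... | yes a≈0 = inj₂ (T.resp (≈ᴹ-sym (lc-0 a≈0)) T.0-closed)
      ... | no a≉0 with meets a a≉0
      ...   | α , β , αβ≉0 , ∈T with β ≟ 0#
      ...     | no β≉0 = let (h , hβ≈1) = inverse β≉0 in
                inj₁ ((λ j → h · (α · a j)) , T.resp (≈ᴹ-trans (≈ᴹ-sym (⊕-* h _ _)) (≈ᴹ-trans (⊕-cong
                  (λ j → refl)
                  (λ j → trans (sym (*-assoc _ _ _)) (trans (*-congʳ hβ≈1) (*-identityˡ _)))) (+ᴹ-comm _ _)))
                  (T.*ₗ-closed h ∈T))
      ...     | yes β≈0 = let (h , hα≈1) = inverse (λ α≈0 → αβ≉0 (α≈0 , β≈0)) in
                inj₂ (T.resp (≈ᴹ-trans (≈ᴹ-sym (⊕-* h _ _)) (≈ᴹ-trans (⊕-cong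
                  (λ j → trans (sym (*-assoc _ _ _)) (trans (*-congʳ hα≈1) (*-identityˡ _)))
                  (λ j → trans (*-congˡ (trans (*-congʳ β≈0) (zeroˡ _))) (zeroʳ h))) (≈ᴹ-sym (⊕-0ʳ _))))
                  (T.*ₗ-closed h ∈T))

      y⊆T-or : (∀ a → lc (τ ∘ a) y ∈ ∣ T ∣) ⊎ (∀ b → lc b y ∈ ∣ T ∣ → ∀ j → b j ≈ 0#)
      y⊆T-or = contains-or-avoids dec basis (λ a → lc (τ ∘ a) y)
        (λ a b → ≈ᴹ-trans (lc-congˡ (λ j → τ.+-homo _ _)) (lc-+ _ _ y))
        (λ a → [ (λ (γ , ∈T) → inj₁ (_ , ∈T)) , inj₂ ]′ (lift-x a))

      -- The halves are exchanged. The parameter is now the `y`-part `b`, so the line to look at is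
      -- that of `τ⁻¹ ∘ b`. The map used is only additive, not linear, which is all that
      -- `contains-or-avoids` asks for.
      x⊆T-or : (∀ b → lc (τ⁻¹ ∘ b) x ∈ ∣ T ∣) ⊎ (∀ a → lc a x ∈ ∣ T ∣ → ∀ j → a j ≈ 0#)
      x⊆T-or = Swap.contains-or-avoids swapped basis (λ b → lc (τ⁻¹ ∘ b) x)
        (λ a b → ≈ᴹ-trans (lc-congˡ (λ j → τ⁻¹-+ _ _)) (lc-+ _ _ x))
        (λ b → [ (λ (a , ∈T) → inj₁ (a , T.resp (+ᴹ-congʳ (lc-congˡ (λ j → τ-τ⁻¹ (b j)))) ∈T)) , inj₂ ]′ (lift-y (τ⁻¹ ∘ b)))

    private module _ (avoids-x : ∀ a → lc a x ∈ ∣ T ∣ → ∀ j → a j ≈ 0#) (avoids-y : ∀ b → lc b y ∈ ∣ T ∣ → ∀ j → b j ≈ 0#) where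

      -- The second alternative of `lift-x` puts a vector of the `y`-half in `T`, which forces `a`
      -- to vanish; the factor 0 then serves as a default.
      graph : ∀ a → ∃[ γ ] a ⊕ (λ j → γ · τ (a j)) ∈ ∣ T ∣
      graph a = [ id , (λ ∈T → let a≈0 = λ j → τ≈0 (avoids-y _ ∈T j) in
        0# , T.resp (≈ᴹ-sym (⊕-0 a≈0 (λ _ → zeroˡ _))) T.0-closed) ]′ (lift-x a)

      graph-unique : ∀ {a b c} → a ⊕ b ∈ ∣ T ∣ → a ⊕ c ∈ ∣ T ∣ → ∀ j → b j ≈ c j
      graph-unique {a} {b} {c} ab∈T ac∈T j = x-y≈0 (trans (+-congˡ (sym (-1*x≈-x (c j))))
        (avoids-y _ (T.resp (≈ᴹ-trans (+ᴹ-congˡ (≈ᴹ-sym (⊕-* (- 1#) a c))) (≈ᴹ-trans (≈ᴹ-sym (⊕-+ _ _ _ _))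
          (≈ᴹ-trans (⊕-cong (λ j → trans (+-congˡ (-1*x≈-x (a j))) (-‿inverseʳ (a j))) (λ _ → refl))
            (≈ᴹ-sym (⊕-0ˡ (λ j → b j + - 1# · c j))))))
          (T.+-closed ab∈T (T.*ₗ-closed (- 1#) ac∈T))) j))
        where open RingProperties ring using (-1*x≈-x)

      -- T is the graph of a linear map sending each a to a multiple of τ ∘ a.  Linearity forces
      -- the factors at a₀, a₁ and k a₀ + a₁ to agree, which leaves τ k = k.
      graph⇒identity : 2 ≤ n → ∀ k → τ k ≈ k
      graph⇒identity (s≤s (s≤s _)) k = cancel (begin
        γ₀ · τ k   ≈⟨ *-congʳ γ₁≈γ₀ ⟨
        γ₁ · τ k   ≈⟨ compare k ⟩
        k · γ₀     ≈⟨ *-comm k γ₀ ⟩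
        γ₀ · k     ∎)
        where
        open R
        a₀ a₁ : Scalars n
        a₀ = δ zero
        a₁ = δ (suc zero)
        γ₀ γ₁ : Carrier
        γ₀ = proj₁ (graph a₀)
        γ₁ = proj₁ (graph a₁)
        γ₀≉0 : γ₀ ≉ 0#
        -- With factor zero the graph vector over `a₀` would be `lc a₀ x`, which `T` avoids.
        γ₀≉0 γ₀≈0 = 1≉0 (avoids-x a₀ (T.resp (≈ᴹ-trans (⊕-cong (λ _ → refl)
          (λ j → trans (*-congʳ γ₀≈0) (zeroˡ _))) (≈ᴹ-sym (⊕-0ʳ a₀))) (proj₂ (graph a₀))) zero)
        cancel : ∀ {a b} → γ₀ · a ≈ γ₀ · b → a ≈ b
        cancel {a} {b} eq = x-y≈0 (zero-product γ₀≉0 (trans (RingProperties.x[y-z]≈xy-xz ring γ₀ a b)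
          (trans (+-congʳ eq) (-‿inverseʳ (γ₀ · b)))))
        compare : ∀ k → γ₁ · τ k ≈ k · γ₀
        compare k = begin
          γ₁ · τ k                       ≈⟨ *-congʳ γ₁≈γ′ ⟩
          γ′ · τ k                       ≈⟨ *-congˡ (τ.⟦⟧-cong (trans (+-identityʳ _) (*-identityʳ k))) ⟨
          γ′ · τ (k · 1# + 0#)           ≈⟨ coords zero ⟨
          k · (γ₀ · τ 1#) + γ₁ · τ 0#    ≈⟨ +-cong (*-congˡ (trans (*-congˡ τ.1#-homo) (*-identityʳ _))) (trans (*-congˡ τ.0#-homo) (zeroʳ _)) ⟩
          k · γ₀ + 0#                    ≈⟨ +-identityʳ _ ⟩
          k · γ₀                         ∎
          where
          γ′ : Carrier
          γ′ = proj₁ (graph (λ j → k · a₀ j + a₁ j))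
          coords : ∀ j → k · (γ₀ · τ (a₀ j)) + γ₁ · τ (a₁ j) ≈ γ′ · τ (k · a₀ j + a₁ j)
          -- Both sides are `y`-parts over `k a₀ + a₁`: one from linearity of `T`, one from `graph`.
          -- The first coordinate relates `γ₀` to `γ′`, the second identifies `γ₁` with `γ′`.
          coords = graph-unique
            (T.resp (≈ᴹ-trans (+ᴹ-congʳ (≈ᴹ-sym (⊕-* k _ _))) (≈ᴹ-sym (⊕-+ _ _ _ _)))
              (T.+-closed (T.*ₗ-closed k (proj₂ (graph a₀))) (proj₂ (graph a₁))))
            (proj₂ (graph (λ j → k · a₀ j + a₁ j)))
          γ₁≈γ′ : γ₁ ≈ γ′
          γ₁≈γ′ = begin
            γ₁                             ≈⟨ trans (+-identityˡ _) (*-identityʳ _) ⟨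
            0# + γ₁ · 1#                   ≈⟨ +-cong (trans (*-congˡ (trans (*-congˡ τ.0#-homo) (zeroʳ _))) (zeroʳ k)) (*-congˡ τ.1#-homo) ⟨
            k · (γ₀ · τ 0#) + γ₁ · τ 1#    ≈⟨ coords (suc zero) ⟩
            γ′ · τ (k · 0# + 1#)           ≈⟨ *-congˡ (trans (τ.⟦⟧-cong (trans (+-congʳ (zeroʳ k)) (+-identityˡ _))) τ.1#-homo) ⟩
            γ′ · 1#                        ≈⟨ *-identityʳ _ ⟩
            γ′                             ∎
        γ₁≈γ₀ : γ₁ ≈ γ₀
        -- Specialising `k` to 1, which `τ` fixes, removes the twist.
        γ₁≈γ₀ = begin
          γ₁          ≈⟨ trans (*-congˡ τ.1#-homo) (*-identityʳ γ₁) ⟨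
          γ₁ · τ 1#   ≈⟨ compare 1# ⟩
          1# · γ₀     ≈⟨ *-identityˡ γ₀ ⟩
          γ₀          ∎

    transversal-unique : 2 ≤ n → ∃[ k ] ¬ τ k ≈ k → T ≐ₛ span x ⊎ T ≐ₛ span y
    transversal-unique 2≤n (k , τk≉k) = [ (λ y⊆T → inj₂ (basis⊆span (independent⇒isBasis card basis
          -- The inclusion is twisted by `τ`; evaluating it at `τ⁻¹ ∘ δ j` yields `y j` itself.
          (λ j → T.resp (≈ᴹ-trans (lc-congˡ (λ i → τ-τ⁻¹ (δ j i))) (lc-δ j y)) (y⊆T (τ⁻¹ ∘ δ j))) (y-independent dec))))
      , (λ avoids-y → inj₁ ([ (λ x⊆T → basis⊆span (independent⇒isBasis card basis
          (λ j → T.resp (≈ᴹ-trans (lc-congˡ (λ i → τ⁻¹-τ (δ j i))) (lc-δ j x)) (x⊆T (τ ∘ δ j))) (x-independent dec)))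
        , (λ avoids-x → contradiction (graph⇒identity avoids-x avoids-y 2≤n k) τk≉k) ]′ x⊆T-or)) ]′ y⊆T-or

-- The linear set of the graph of `τ`: rank, scatteredness, type and pseudoregulus.

module PseudoregulusType {ℓ} (E : FieldExtension ℓ) {q t n : ℕ} 
  (cardF : HasCardinality (FieldExtension.F E) q) (cardK : HasCardinality (FieldExtension.K E) (q ^ t))
  (M : VectorSpace (FieldExtension.K E))
  {x y : Fin n → LeftModule.Carrierᴹ M} (dec : Decomposition.IsDecomposition (FieldExtension.K E) cardK M x y)
  {τ : Ring.Carrier (ringOf (FieldExtension.K E)) → Ring.Carrier (ringOf (FieldExtension.K E))}
  (τ-iso : IsRingIsomorphism (Ring.rawRing (ringOf (FieldExtension.K E))) (Ring.rawRing (ringOf (FieldExtension.K E))) τ)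
  (fixed : ∀ a → Ring._≈_ (ringOf (FieldExtension.K E)) (τ a) a ⇔
                 (∃[ b ] Ring._≈_ (ringOf (FieldExtension.K E)) a (FieldExtension.ι E b))) where
  open FieldExtension E
  open CommutativeRing (commRing K) hiding (zero) renaming (_*_ to _·_)
  open LeftModule M
  open LinearAlgebra K M
  open FiniteField K cardK
  open NormalisedPoints K cardK
  open Decomposition K cardK M x y
  open IsDecomposition dec
  open Transversals K cardK M dec τ-iso
  private
    module τ = IsRingIsomorphism τ-iso
    module ι = IsRingMonomorphism ι-mono
    module F = Ring (ringOf F)
    K¹ : VectorSpace K
    K¹ = TensorUnit.leftModule
    module KF = LinearAlgebra F (restrictScalars E K¹)
    module MF = LinearAlgebra F (restrictScalars E M)
    open Sum +ᴹ-commutativeMonoid using (sum; ∑-distrib-+)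

    -- An F-basis of K, obtained by viewing K as a one-dimensional space over itself and restricting
    -- scalars to F.
    κ : Fin t → Carrier
    κ = proj₁ (FiniteSpace.dimension F (restrictScalars E K¹) cardF cardK)

    κ-basis : IsBasis (whole F (restrictScalars E K¹)) κ
    κ-basis = proj₂ (FiniteSpace.dimension F (restrictScalars E K¹) cardF cardK)

    coords : ∀ k → ∃[ c ] k ≈ KF.lc c κ
    coords k = KF.basis-spanning κ-basis {k} tt

    τι : ∀ c → τ (ι c) ≈ ι c
    τι c = Equivalence.from (fixed (ι c)) (c , refl)

    scaled≈0 : ∀ {a : Scalars n} {k} → ¬ (∀ j → a j ≈ 0#) → (∀ j → k · a j ≈ 0#) → k ≈ 0#
    scaled≈0 {a} {k} a≉0 ka≈0 = decidable-stable (k ≟ 0#) (λ k≉0 → a≉0 (λ j → zero-product k≉0 (ka≈0 j)))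

    τ≉0 : ∀ {a : Scalars n} → ¬ (∀ j → a j ≈ 0#) → ¬ (∀ j → τ (a j) ≈ 0#)
    τ≉0 a≉0 τa≈0 = a≉0 (λ j → τ≈0 (τa≈0 j))

  g : Scalars n → Carrierᴹ
  g a = a ⊕ (τ ∘ a)

  g-cong : ∀ {a b} → (∀ j → a j ≈ b j) → g a ≈ᴹ g b
  g-cong eq = ⊕-cong eq (λ j → τ.⟦⟧-cong (eq j))

  g≉0 : ∀ {a} → ¬ (∀ j → a j ≈ 0#) → g a ≉ᴹ 0ᴹ
  g≉0 a≉0 eq = a≉0 (proj₁ (⊕-independent eq))

  W : FSubspace E M
  W = record
    { ∣_∣ = λ v → ∃[ a ] v ≈ᴹ g a
    ; resp = λ eq (a , v≈) → a , ≈ᴹ-trans (≈ᴹ-sym eq) v≈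
    ; 0-closed = 0ᵛ , ≈ᴹ-sym (⊕-0 (λ _ → refl) (λ _ → τ.0#-homo))
    ; +-closed = λ (a , u≈) (b , v≈) → (λ j → a j + b j) , ≈ᴹ-trans (+ᴹ-cong u≈ v≈)
        (≈ᴹ-trans (≈ᴹ-sym (⊕-+ _ _ _ _)) (⊕-cong (λ _ → refl) (λ j → sym (τ.+-homo _ _))))
    ; *ₗ-closed = λ c (a , v≈) → (λ j → ι c · a j) , ≈ᴹ-trans (*ₗ-congˡ v≈)
        (≈ᴹ-trans (≈ᴹ-sym (⊕-* _ _ _)) (⊕-cong (λ _ → refl) (λ j → sym (trans (τ.*-homo _ _) (*-congʳ (τι c))))))
    }

  private
    -- For matching endpoints `u` and `w` of a line of the pseudoregulus, this parametrises the
    -- vectors of `W` on it by K. It is F-linear in `k` because `τ` fixes F.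
    h : Carrierᴹ → Carrierᴹ → Carrier → Carrierᴹ
    h u w k = k *ₗ u +ᴹ τ k *ₗ w

    h-lc : ∀ u w {d} (c : Fin d → F.Carrier) (k : Fin d → Carrier) → h u w (KF.lc c k) ≈ᴹ MF.lc c (h u w ∘ k)
    h-lc u w = SemilinearMap.map-lc F (restrictScalars E K¹) (restrictScalars E M) {σ = id}
      h-cong h-+ (≈ᴹ-trans (+ᴹ-cong (*ₗ-zeroˡ u) (≈ᴹ-trans (*ₗ-congʳ τ.0#-homo) (*ₗ-zeroˡ w))) (+ᴹ-identityˡ 0ᴹ)) h-*
      where
      open CommutativeSemigroupProperties (CommutativeMonoid.commutativeSemigroup +ᴹ-commutativeMonoid)
            using () renaming (interchange to +ᴹ-interchange)
      h-cong : ∀ {k l} → k ≈ l → h u w k ≈ᴹ h u w l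
      h-cong eq = +ᴹ-cong (*ₗ-congʳ eq) (*ₗ-congʳ (τ.⟦⟧-cong eq))
      h-+ : ∀ k l → h u w (k + l) ≈ᴹ h u w k +ᴹ h u w l
      h-+ k l = ≈ᴹ-trans (+ᴹ-cong (*ₗ-distribʳ u k l) (≈ᴹ-trans (*ₗ-congʳ (τ.+-homo k l)) (*ₗ-distribʳ w _ _)))
        (+ᴹ-interchange _ _ _ _)
      h-* : ∀ c k → h u w (ι c · k) ≈ᴹ ι c *ₗ h u w k
      h-* c k = ≈ᴹ-trans (+ᴹ-cong (*ₗ-assoc _ _ _) (≈ᴹ-trans (*ₗ-congʳ (trans (τ.*-homo _ _) (*-congʳ (τι c)))) (*ₗ-assoc _ _ _)))
        (≈ᴹ-sym (*ₗ-distribˡ _ _ _))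

    h-coords : ∀ u w k → h u w k ≈ᴹ MF.lc (proj₁ (coords k)) (h u w ∘ κ)
    h-coords u w k = ≈ᴹ-trans (+ᴹ-cong (*ₗ-congʳ (proj₂ (coords k))) (*ₗ-congʳ (τ.⟦⟧-cong (proj₂ (coords k))))) (h-lc u w _ κ)

    h-line : ∀ p k → h (lc p x) (lc (τ ∘ p) y) k ≈ᴹ g (λ j → k · p j)
    h-line p k = +ᴹ-cong (≈ᴹ-sym (lc-* k p x)) (≈ᴹ-trans (≈ᴹ-sym (lc-* (τ k) (τ ∘ p) y)) (lc-congˡ (λ j → sym (τ.*-homo k (p j)))))

    τ-δ : ∀ {d} (i j : Fin d) → τ (δ i j) ≈ δ i j
    τ-δ zero zero = τ.1#-homo
    τ-δ zero (suc j) = τ.0#-homo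
    τ-δ (suc i) zero = τ.0#-homo
    τ-δ (suc i) (suc j) = τ-δ i j

    b : Fin n → Fin t → Carrierᴹ
    b j i = h (x j) (y j) (κ i)

    b∈W : ∀ j i → b j i ∈ ∣ W ∣
    b∈W j i = (λ l → κ i · δ j l) , ≈ᴹ-trans (+ᴹ-cong (*ₗ-congˡ (≈ᴹ-sym (lc-δ j x)))
      (*ₗ-congˡ (≈ᴹ-sym (≈ᴹ-trans (lc-congˡ (τ-δ j)) (lc-δ j y))))) (h-line (δ j) (κ i))

    lc²-b : ∀ c → MF.lc² c b ≈ᴹ g (λ j → KF.lc (c j) κ)
    lc²-b c = ≈ᴹ-trans (MF.lc²-sum (λ j → ≈ᴹ-sym (h-lc (x j) (y j) (c j) κ)))
      (≈ᴹ-trans (∑-distrib-+ (λ j → KF.lc (c j) κ *ₗ x j) (λ j → τ (KF.lc (c j) κ) *ₗ y j))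
        (+ᴹ-cong (sum-*ₗ (λ j → KF.lc (c j) κ) x) (sum-*ₗ (λ j → τ (KF.lc (c j) κ)) y)))

  -- `g` is an F-linear bijection from the coordinate vectors of length `n` over K onto `W`, and `b`
  -- is the image of the F-basis formed by the vectors `κ i` times `δ j`.
  W-rank : HasDim W (t * n)
  W-rank = ≡.subst (HasDim W) (ℕ.*-comm n t) (_ , MF.flatten-isBasis b∈W
    (λ c eq j → KF.basis-independent κ-basis (c j) (proj₁ (⊕-independent (≈ᴹ-trans (≈ᴹ-sym (lc²-b c)) eq)) j))
    (λ (a , eq) → (λ j → proj₁ (coords (a j))) , ≈ᴹ-trans eq
      (≈ᴹ-trans (g-cong (λ j → proj₂ (coords (a j)))) (≈ᴹ-sym (lc²-b _)))))

  W-scattered : IsScattered E {V = M} W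
  W-scattered u (a , u≈ga) u≉0 = (λ _ → u) , MF.mkBasis (λ _ → (a , u≈ga) , incl ≈ᴹ-refl) independent spanning
    where
    a≉0 : ¬ (∀ j → a j ≈ 0#)
    a≉0 a≈0 = u≉0 (≈ᴹ-trans u≈ga (⊕-0 a≈0 (λ j → trans (τ.⟦⟧-cong (a≈0 j)) τ.0#-homo)))
    lc₁ : ∀ (c : Fin 1 → F.Carrier) → MF.lc c (λ _ → u) ≈ᴹ ι (c zero) *ₗ u
    lc₁ c = ≈ᴹ-trans (MF.lc-suc c (λ _ → u)) (≈ᴹ-trans (+ᴹ-congˡ (MF.lc-0 (λ ()))) (+ᴹ-identityʳ _))
    independent : MF.Independent {1} (λ _ → u)
    independent c eq zero = ι.injective (trans (decidable-stable (ι (c zero) ≟ 0#) (λ ιc≉0 →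
      u≉0 (*ₗ-zero-product cardK ιc≉0 (≈ᴹ-trans (≈ᴹ-sym (lc₁ c)) eq)))) (sym ι.0#-homo))
    multiple : ∀ {v} → v ∈ ∣ ⟨_⟩ {K = K} {V = M} (u ≈ᴹ_) ∣ → ∃[ k ] v ≈ᴹ k *ₗ u
    multiple = ⟨⟩-least (record
      { ∣_∣ = λ v → ∃[ k ] v ≈ᴹ k *ₗ u
      ; resp = λ eq (k , v≈) → k , ≈ᴹ-trans (≈ᴹ-sym eq) v≈
      ; 0-closed = 0# , ≈ᴹ-sym (*ₗ-zeroˡ u)
      ; +-closed = λ (k , v≈) (l , w≈) → k + l , ≈ᴹ-trans (+ᴹ-cong v≈ w≈) (≈ᴹ-sym (*ₗ-distribʳ u k l))
      ; *ₗ-closed = λ h (k , v≈) → h · k , ≈ᴹ-trans (*ₗ-congˡ v≈) (≈ᴹ-sym (*ₗ-assoc h k u))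
      }) (λ u≈v → 1# , ≈ᴹ-sym (≈ᴹ-trans (*ₗ-identityˡ u) u≈v))
    -- If g b = k g a, then τ k and k agree on the nonzero coordinates of τ ∘ a, so k lies in F.
    spanning : ∀ {v} → v ∈ ∣ W ∣ × v ∈ ∣ ⟨_⟩ {K = K} {V = M} (u ≈ᴹ_) ∣ → MF.Spans {1} (λ _ → u) v
    spanning {v} ((b , v≈gb) , v∈⟨u⟩) =
      let (k , v≈ku) = multiple v∈⟨u⟩
          (b≈ka , τb≈kτa) = ⊕-injective dec (≈ᴹ-trans (≈ᴹ-sym v≈gb) (≈ᴹ-trans v≈ku (≈ᴹ-trans (*ₗ-congˡ u≈ga) (≈ᴹ-sym (⊕-* k a (τ ∘ a))))))
          τk≈k = x-y≈0 (scaled≈0 (τ≉0 a≉0) (λ j → trans (RingProperties.[y-z]x≈yx-zx ring (τ (a j)) (τ k) k)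
            (trans (+-congʳ (trans (sym (τ.*-homo k (a j))) (trans (τ.⟦⟧-cong (sym (b≈ka j))) (τb≈kτa j)))) (-‿inverseʳ _))))
          (c , k≈ιc) = Equivalence.to (fixed k) τk≈k
      in (λ _ → c) , ≈ᴹ-trans v≈ku (≈ᴹ-trans (*ₗ-congʳ k≈ιc) (≈ᴹ-sym (lc₁ (λ _ → c))))

  line : Scalars n → Subspace K M
  line p = span (lc p x ∷ lc (τ ∘ p) y ∷ [])

  private
    scaled : Carrier → Carrier → Scalars n → Carrierᴹ
    scaled α β p = (λ j → α · p j) ⊕ (λ j → β · τ (p j))

    lc-line : ∀ (c : Scalars 2) p → lc c (lc p x ∷ lc (τ ∘ p) y ∷ []) ≈ᴹ scaled (c zero) (c (suc zero)) p
    lc-line c p = ≈ᴹ-trans (lc-pair c _ _) (+ᴹ-cong (≈ᴹ-sym (lc-* _ p x)) (≈ᴹ-sym (lc-* _ (τ ∘ p) y)))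

    scaled-0 : ∀ {α β} p → α ≈ 0# → β ≈ 0# → scaled α β p ≈ᴹ 0ᴹ
    scaled-0 p α≈0 β≈0 = ⊕-0 (λ j → trans (*-congʳ α≈0) (zeroˡ _)) (λ j → trans (*-congʳ β≈0) (zeroˡ _))

  line-dim : ∀ {p} → ¬ (∀ j → p j ≈ 0#) → HasDim (line p) 2
  line-dim {p} p≉0 = _ , span-isBasis (λ c eq →
    let (α≈0 , β≈0) = ⊕-independent (≈ᴹ-trans (≈ᴹ-sym (lc-line c p)) eq) in
    λ { zero → scaled≈0 p≉0 α≈0 ; (suc zero) → scaled≈0 (τ≉0 p≉0) β≈0 })

  -- A vector of `W` on the line has `x`-part `c zero` times `p`, and this scalar determines it. So
  -- `h u w` is an F-linear bijection from K onto the section and carries the basis `κ` over.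
  line-section : ∀ {p} → ¬ (∀ j → p j ≈ 0#) → HasDim (W ⊓ overF E {V = M} (line p)) t
  line-section {p} p≉0 = h u w ∘ κ , MF.mkBasis
    (λ i → ((λ j → κ i · p j) , h-line p (κ i)) , (κ i ∷ τ (κ i) ∷ []) , ≈ᴹ-sym (lc-pair (κ i ∷ τ (κ i) ∷ []) u w))
    (λ c eq → KF.basis-independent κ-basis c (scaled≈0 p≉0 (proj₁ (⊕-independent
      (≈ᴹ-trans (≈ᴹ-sym (h-line p (KF.lc c κ))) (≈ᴹ-trans (h-lc u w c κ) eq))))))
    (λ ((a , v≈ga) , (c , v≈)) →
      let (a≈cp , _) = ⊕-injective dec (≈ᴹ-trans (≈ᴹ-sym v≈ga) (≈ᴹ-trans v≈ (lc-line c p))) in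
      proj₁ (coords (c zero)) , ≈ᴹ-trans v≈ga (≈ᴹ-trans (g-cong a≈cp) (≈ᴹ-trans (≈ᴹ-sym (h-line p (c zero))) (h-coords u w (c zero)))))
    where
    u w : Carrierᴹ
    u = lc p x
    w = lc (τ ∘ p) y

  -- Compare the two halves of a common vector. A nonzero coefficient in either half would make one
  -- normalised vector a multiple of the other, after untwisting by `τ⁻¹` in the `y`-half; so all of
  -- the vector vanishes.
  lines-disjoint : ∀ {k l} → k ≢ l → PG (line (point {n} k)) ⊥ PG (line (point {n} l))
  lines-disjoint {k} {l} k≢l {P} ((c , P≈) , (d , P≈′)) = Point.rep≉0 P (≈ᴹ-trans P≈ (≈ᴹ-trans (lc-line c p) (scaled-0 p α≈0 β≈0)))
    where
    p p′ : Scalars n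
    p = point {n} k
    p′ = point {n} l
    eq : (∀ j → c zero · p j ≈ d zero · p′ j) × (∀ j → c (suc zero) · τ (p j) ≈ d (suc zero) · τ (p′ j))
    eq = ⊕-injective dec (≈ᴹ-trans (≈ᴹ-sym (lc-line c p)) (≈ᴹ-trans (≈ᴹ-sym P≈) (≈ᴹ-trans P≈′ (lc-line d p′))))
    cancel : ∀ {a b α β h} → h · α ≈ 1# → α · a ≈ β · b → a ≈ (h · β) · b
    cancel {a} {b} {α} {β} {h} hα≈1 αa≈βb = trans (sym (*-identityˡ a)) (trans (*-congʳ (sym hα≈1))
      (trans (*-assoc h α a) (trans (*-congˡ αa≈βb) (sym (*-assoc h β b)))))
    α≈0 : c zero ≈ 0#
    α≈0 = decidable-stable (c zero ≟ 0#) (λ α≉0 → let (h , hα≈1) = inverse α≉0 in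
      k≢l (point-injective {n} {c = h · d zero} (λ j → cancel hα≈1 (proj₁ eq j))))
    β≈0 : c (suc zero) ≈ 0#
    β≈0 = decidable-stable (c (suc zero) ≟ 0#) (λ β≉0 → let (h , hβ≈1) = inverse β≉0 in
      k≢l (point-injective {n} {c = τ⁻¹ (h · d (suc zero))} (λ j → τ.injective (trans (cancel hβ≈1 (proj₂ eq j))
        (sym (trans (τ.*-homo _ _) (*-congʳ (τ-τ⁻¹ _))))))))

  module _ {U₁ U₂ : Subspace K M} (basis₁ : IsBasis U₁ x) (basis₂ : IsBasis U₂ y)
    {L : PointSet K M} (L≐W : L ≐ linearSet E {V = M} W) where

    scatteredLinearSet : IsScatteredLinearSet E {V = M} (t * n) L
    scatteredLinearSet = W , W-rank , W-scattered , L≐W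

    private
      coords₁ : ∀ {v} → v ∈ ∣ U₁ ∣ → Scalars n
      coords₁ v∈U₁ = proj₁ (basis-spanning basis₁ v∈U₁)

      coords₁-correct : ∀ {v} (v∈U₁ : v ∈ ∣ U₁ ∣) → v ≈ᴹ lc (coords₁ v∈U₁) x
      coords₁-correct v∈U₁ = proj₂ (basis-spanning basis₁ v∈U₁)

      coords₁-unique : ∀ {v a} (v∈U₁ : v ∈ ∣ U₁ ∣) → v ≈ᴹ lc a x → ∀ j → coords₁ v∈U₁ j ≈ a j
      coords₁-unique v∈U₁ eq = lc-injective (x-independent dec) (≈ᴹ-trans (≈ᴹ-sym (coords₁-correct v∈U₁)) eq)

      image : ∃ ∣ U₁ ∣ → ∃ ∣ U₂ ∣
      image (v , v∈U₁) = lc (τ ∘ coords₁ v∈U₁) y , lc∈ U₂ (IsBasis.member basis₂) _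

      -- `image` reads coordinates off a membership proof. Uniqueness of coordinates makes the value
      -- depend on the vector alone, and every law of `f` is checked through this.
      image-lc : ∀ v a → proj₁ v ≈ᴹ lc a x → proj₁ (image v) ≈ᴹ lc (τ ∘ a) y
      image-lc (v , v∈U₁) a eq = lc-congˡ (λ j → τ.⟦⟧-cong (coords₁-unique v∈U₁ eq j))

    f : SemilinearIso K (asSpace U₁) (asSpace U₂)
    f = record
      { σ = τ
      ; σ-iso = τ-iso
      ; map = image
      ; map-iso = record
        { isGroupMonomorphism = record
          { isGroupHomomorphism = record
            { isMonoidHomomorphism = record
              { isMagmaHomomorphism = record
                { isRelHomomorphism = record { cong = λ {u} {v} eq → image-lc u _ (≈ᴹ-trans eq (coords₁-correct (proj₂ v))) }
                ; homo = image-+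
                }
              ; ε-homo = ≈ᴹ-trans (image-lc _ 0ᵛ (≈ᴹ-sym (lc-0 (λ _ → refl)))) (lc-0 (λ _ → τ.0#-homo))
              }
            ; ⁻¹-homo = λ u → inverseʳ-uniqueᴹ _ _ (≈ᴹ-trans (≈ᴹ-sym (image-+ u (-₁ u)))
                (≈ᴹ-trans (image-lc _ 0ᵛ (≈ᴹ-trans (-ᴹ‿inverseʳ (proj₁ u)) (≈ᴹ-sym (lc-0 (λ _ → refl))))) (lc-0 (λ _ → τ.0#-homo))))
            }
          ; injective = λ {u} {v} eq → ≈ᴹ-trans (coords₁-correct (proj₂ u)) (≈ᴹ-trans
              (lc-congˡ (λ j → τ.injective (lc-injective (y-independent dec) eq j))) (≈ᴹ-sym (coords₁-correct (proj₂ v))))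
          }
        ; surjective = λ (w , w∈U₂) → let (b , w≈) = basis-spanning basis₂ w∈U₂ in
            (lc (τ⁻¹ ∘ b) x , lc∈ U₁ (IsBasis.member basis₁) _) ,
            λ {z} z≈ → ≈ᴹ-trans (image-lc z (τ⁻¹ ∘ b) z≈) (≈ᴹ-trans (lc-congˡ (λ j → τ-τ⁻¹ (b j))) (≈ᴹ-sym w≈))
        }
      ; semilinear = λ k v → ≈ᴹ-trans (image-lc _ (λ j → k · coords₁ (proj₂ v) j)
          (≈ᴹ-trans (*ₗ-congˡ (coords₁-correct (proj₂ v))) (≈ᴹ-sym (lc-* k _ x))))
          (≈ᴹ-trans (lc-congˡ (λ j → τ.*-homo k _)) (lc-* (τ k) _ y))
      }
      where
      open LeftModule (asSpace U₁) using () renaming (_+ᴹ_ to _+₁_; -ᴹ_ to -₁_)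
      open LeftModuleProperties M using (inverseʳ-uniqueᴹ)
      image-+ : ∀ u v → proj₁ (image (u +₁ v)) ≈ᴹ proj₁ (image u) +ᴹ proj₁ (image v)
      image-+ u v = ≈ᴹ-trans (image-lc (u +₁ v) (λ j → coords₁ (proj₂ u) j + coords₁ (proj₂ v) j)
        (≈ᴹ-trans (+ᴹ-cong (coords₁-correct (proj₂ u)) (coords₁-correct (proj₂ v))) (≈ᴹ-sym (lc-+ _ _ x))))
        (≈ᴹ-trans (lc-congˡ (λ j → τ.+-homo _ _)) (lc-+ _ _ y))

    typeLρf : IsTypeLρf E {V = M} n L U₁ U₂
    typeLρf = (x , basis₁) , (y , basis₂)
      , (λ v → let (a , b , eq) = ⊕-spanning v in
          lc a x , lc b y , lc∈ U₁ (IsBasis.member basis₁) a , lc∈ U₂ (IsBasis.member basis₂) b , eq)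
      , (λ v v∈U₁ v∈U₂ → let (b , v≈) = basis-spanning basis₂ v∈U₂
                             (a≈0 , _) = ⊕-injective dec (≈ᴹ-trans (≈ᴹ-sym (⊕-0ʳ _)) (≈ᴹ-trans (≈ᴹ-sym (coords₁-correct v∈U₁))
                                           (≈ᴹ-trans v≈ (⊕-0ˡ b))))
                         in ≈ᴹ-trans (coords₁-correct v∈U₁) (lc-0 a≈0))
      -- The scalar ρ is 1: `f` already sends each `x j` to `y j`, so no rescaling remains.
      , f , fixed , 1# , 1≉0
      , (λ P∈L → let (u , (a , u≈ga) , u≉0 , (k , P≈ku)) = proj₁ L≐W P∈L
                     v = lc a x , lc∈ U₁ (IsBasis.member basis₁) a
                 in v
                  , (λ v≈0 → u≉0 (≈ᴹ-trans u≈ga (⊕-0 (x-independent dec a v≈0) (λ j →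
                      trans (τ.⟦⟧-cong (x-independent dec a v≈0 j)) τ.0#-homo))))
                  , k , ≈ᴹ-trans P≈ku (*ₗ-congˡ (≈ᴹ-trans u≈ga (≈ᴹ-sym (graph-point v a ≈ᴹ-refl)))))
      , (λ (v , v≉0 , (k , P≈)) → let a = coords₁ (proj₂ v) ; eq = graph-point v a (coords₁-correct (proj₂ v)) in
          proj₂ L≐W (g a , (a , ≈ᴹ-refl)
            , (λ ga≈0 → v≉0 (≈ᴹ-trans (coords₁-correct (proj₂ v)) (lc-0 (proj₁ (⊕-independent ga≈0)))))
            , k , ≈ᴹ-trans P≈ (*ₗ-congˡ eq)))
      where
      graph-point : ∀ v a → proj₁ v ≈ᴹ lc a x → proj₁ v +ᴹ 1# *ₗ proj₁ (image v) ≈ᴹ g a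
      graph-point v a eq = +ᴹ-cong eq (≈ᴹ-trans (*ₗ-identityˡ _) (image-lc v a eq))

    pseudoregulusType : 2 ≤ n → 2 ≤ t → IsPseudoregulusType E {V = M} q n t L U₁ U₂
    pseudoregulusType 2≤n 2≤t = (_ , whole-isBasis dec) , W , (W-rank , W-scattered , L≐W)
      , #points n
      , ≡.trans (#points-count n) (≡.cong (_∸ 1) (≡.trans (ℕ.^-*-assoc q t n) (≡.cong (q ^_) (ℕ.*-comm t n))))
      , (λ k → line (point {n} k))
      , (λ k → line-dim (point≉0 {n} k) , line-section (point≉0 {n} k))
      , (λ k l k≢l {P} → lines-disjoint k≢l {P})
      , ((x , basis₁) , (λ {P} (P∈U₁ , P∈L) → avoids₁ P P∈U₁ (proj₁ L≐W P∈L)) , λ k →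
          meets₁ (point {n} k) (point≉0 {n} k))
      , ((y , basis₂) , (λ {P} (P∈U₂ , P∈L) → avoids₂ P P∈U₂ (proj₁ L≐W P∈L)) , λ k →
          meets₂ (point {n} k) (point≉0 {n} k))
      , U₁≢U₂ 2≤n
      , λ T ((e , basis) , _ , meets) → ⊎.map (same {T = T} basis₁) (same {T = T} basis₂)
          (transversal-unique basis (meets-all T meets) 2≤n moved)
      where
      same : ∀ {S T : Subspace K M} {z : Vectors n} → IsBasis S z → T ≐ₛ span z → T ≐ₛ S
      same basis (T⊆ , ⊆T) = (λ v∈T → proj₂ (basis⊆span basis) (T⊆ v∈T)) , (λ v∈S → ⊆T (proj₁ (basis⊆span basis) v∈S))
      avoids₁ : ∀ P → rep P ∈ ∣ U₁ ∣ → ¬ (P ∈ linearSet E {V = M} W)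
      avoids₁ P P∈U₁ (u , (a , u≈ga) , u≉0 , (k , P≈ku)) = Point.rep≉0 P (≈ᴹ-trans P≈ku (≈ᴹ-trans (*ₗ-congʳ k≈0) (*ₗ-zeroˡ u)))
        where
        -- A vector of `U₁` has zero `y`-part, whereas a multiple by `k` of the graph vector of `a`
        -- has `y`-part `k · τ (a j)`.
        kτa≈0 : ∀ j → k · τ (a j) ≈ 0#
        kτa≈0 j = sym (proj₂ (⊕-injective dec (≈ᴹ-trans (≈ᴹ-sym (⊕-0ʳ _)) (≈ᴹ-trans (≈ᴹ-sym (coords₁-correct P∈U₁))
          (≈ᴹ-trans P≈ku (≈ᴹ-trans (*ₗ-congˡ u≈ga) (≈ᴹ-sym (⊕-* k a (τ ∘ a)))))))) j)
        k≈0 : k ≈ 0#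
        k≈0 = scaled≈0 (τ≉0 (λ a≈0 → u≉0 (≈ᴹ-trans u≈ga (⊕-0 a≈0 (λ j → trans (τ.⟦⟧-cong (a≈0 j)) τ.0#-homo))))) kτa≈0
      avoids₂ : ∀ P → rep P ∈ ∣ U₂ ∣ → ¬ (P ∈ linearSet E {V = M} W)
      avoids₂ P P∈U₂ (u , (a , u≈ga) , u≉0 , (k , P≈ku)) = Point.rep≉0 P (≈ᴹ-trans P≈ku (≈ᴹ-trans (*ₗ-congʳ k≈0) (*ₗ-zeroˡ u)))
        where
        ka≈0 : ∀ j → k · a j ≈ 0#
        ka≈0 j = sym (proj₁ (⊕-injective dec (≈ᴹ-trans (≈ᴹ-sym (⊕-0ˡ _)) (≈ᴹ-trans (≈ᴹ-sym (proj₂ (basis-spanning basis₂ P∈U₂)))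
          (≈ᴹ-trans P≈ku (≈ᴹ-trans (*ₗ-congˡ u≈ga) (≈ᴹ-sym (⊕-* k a (τ ∘ a)))))))) j)
        k≈0 : k ≈ 0#
        k≈0 = scaled≈0 (λ a≈0 → u≉0 (≈ᴹ-trans u≈ga (⊕-0 a≈0 (λ j → trans (τ.⟦⟧-cong (a≈0 j)) τ.0#-homo)))) ka≈0
      meets₁ : ∀ p → ¬ (∀ j → p j ≈ 0#) → PG U₁ ≬ PG (line p)
      meets₁ p p≉0 = record { rep = lc p x ; rep≉0 = λ eq → p≉0 (x-independent dec p eq) }
        , lc∈ U₁ (IsBasis.member basis₁) p
        , δ zero , ≈ᴹ-sym (lc-δ zero (lc p x ∷ lc (τ ∘ p) y ∷ []))
      meets₂ : ∀ p → ¬ (∀ j → p j ≈ 0#) → PG U₂ ≬ PG (line p)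
      meets₂ p p≉0 = record { rep = lc (τ ∘ p) y ; rep≉0 = λ eq → τ≉0 p≉0 (y-independent dec (τ ∘ p) eq) }
        , lc∈ U₂ (IsBasis.member basis₂) (τ ∘ p)
        , δ (suc zero) , ≈ᴹ-sym (lc-δ (suc zero) (lc p x ∷ lc (τ ∘ p) y ∷ []))
      U₁≢U₂ : 2 ≤ n → ¬ (U₁ ≐ₛ U₂)
      U₁≢U₂ (s≤s _) (U₁⊆U₂ , _) =
        let (b , eq) = basis-spanning basis₂ (U₁⊆U₂ (IsBasis.member basis₁ zero)) in
        1≉0 (proj₁ (⊕-injective dec (≈ᴹ-trans (≈ᴹ-sym (⊕-0ʳ (δ zero))) (≈ᴹ-trans (lc-δ zero x) (≈ᴹ-trans eq (⊕-0ˡ b))))) zero)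
      -- The lines are indexed by normalised vectors only. With `a` equal to `c` times such a vector
      -- and `h` inverse to `c`, the coefficients relative to `a` acquire the factor `h` in the
      -- `x`-half and `τ h` in the `y`-half.
      meets-all : ∀ T → (∀ k → PG T ≬ PG (line (point {n} k))) → (a : Scalars n) → ¬ (∀ j → a j ≈ 0#) →
                  ∃[ α ] ∃[ β ] ¬ (α ≈ 0# × β ≈ 0#) × scaled α β a ∈ ∣ T ∣
      meets-all T meets a a≉0 =
        let (k , c , a≈cp) = normalise a a≉0
            p = point {n} k
            (P , P∈T , (d , P≈)) = meets k
            (h , hc≈1) = inverse {c} (λ c≈0 → a≉0 (λ j → trans (a≈cp j) (trans (*-congʳ c≈0) (zeroˡ _))))
            τhτc≈1 = trans (sym (τ.*-homo h c)) (trans (τ.⟦⟧-cong hc≈1) τ.1#-homo)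
        in d zero · h , d (suc zero) · τ h
          , (λ (α≈0 , β≈0) → Point.rep≉0 P (≈ᴹ-trans P≈ (≈ᴹ-trans (lc-line d p) (scaled-0 p
              (unscale hc≈1 α≈0) (unscale τhτc≈1 β≈0)))))
          , Subspace.resp T (≈ᴹ-trans P≈ (≈ᴹ-trans (lc-line d p) (⊕-cong
              (λ j → sym (trans (*-congˡ (a≈cp j)) (absorb hc≈1)))
              (λ j → sym (trans (*-congˡ (trans (τ.⟦⟧-cong (a≈cp j)) (τ.*-homo c _))) (absorb τhτc≈1)))))) P∈T
        where
        unscale : ∀ {α e c} → e · c ≈ 1# → α · e ≈ 0# → α ≈ 0#
        unscale {α} {e} {c} ec≈1 αe≈0 = trans (sym (*-identityʳ α)) (trans (*-congˡ (sym ec≈1))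
          (trans (sym (*-assoc α e c)) (trans (*-congʳ αe≈0) (zeroˡ c))))
        absorb : ∀ {α e c z} → e · c ≈ 1# → (α · e) · (c · z) ≈ α · z
        absorb {α} {e} {c} {z} ec≈1 = trans (*-assoc α e _) (*-congˡ (trans (sym (*-assoc e c z))
          (trans (*-congʳ ec≈1) (*-identityˡ z))))
      moved : ∃[ k ] ¬ τ k ≈ k
      -- If `τ` fixed all of K, every scalar would come from F, and the `q ^ t` elements of K would
      -- inject into the `q` elements of F, although `t` is at least 2.
      moved = [ (λ fix → contradiction
          (Fin.injective⇒≤ {f = λ i → Inverse.to cardF (proj₁ (Equivalence.to (fixed (enum i)) (fix (enum i))))}
            (λ {i} {j} eq → ≡.trans (≡.sym (code-enum i)) (≡.trans (Inverse.to-cong cardK (trans (proj₂ (Equivalence.to (fixed _) (fix _)))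
              (trans (ι.⟦⟧-cong (F.trans (F.sym (Inverse.strictlyInverseʳ cardF _)) (F.trans (F.reflexive (≡.cong (Inverse.from cardF) eq))
                (Inverse.strictlyInverseʳ cardF _)))) (sym (proj₂ (Equivalence.to (fixed _) (fix _))))))) (code-enum j))))
          (ℕ.<⇒≱ (≡.subst (_< q ^ t) (ℕ.*-identityʳ q) (ℕ.^-monoʳ-< q (FiniteField.1<m F cardF) 2≤t))))
        , id ]′ (allOrCounterexample (λ a≈b eq → trans (τ.⟦⟧-cong (sym a≈b)) (trans eq a≈b)) (λ a → τ a ≟ a))

-- The collineation rescaled to a semilinear map fixing the basis of the subgeometry.

module Frobenius {ℓ} (E : FieldExtension ℓ) {q m : ℕ}
  (cardF : HasCardinality (FieldExtension.F E) q) (cardK : HasCardinality (FieldExtension.K E) m)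
  (V : VectorSpace (FieldExtension.K E)) (Ψ : SemilinearIso (FieldExtension.K E) V V)
  {d : ℕ} (subgeometry : IsSubgeometry E {V = V} d (Fix Ψ)) {i₀ i₁ : Fin d} (i₀≢i₁ : i₀ ≢ i₁) where
  open FieldExtension E
  open CommutativeRing (commRing K) hiding (zero) renaming (_*_ to _·_)
  open LeftModule V
  open LinearAlgebra K V
  open FiniteField K cardK
  open SemilinearIso Ψ
  private
    module σ = IsRingIsomorphism σ-iso
    module ψ = IsGroupIsomorphism map-iso
    module ι = IsRingMonomorphism ι-mono
    module F = Ring (ringOf F)
    module VF = LinearAlgebra F (restrictScalars E V)
    module R = ≈-Reasoning (Ring.setoid (ringOf K))

  e : Vectors d
  e = proj₁ subgeometry

  e-basis : IsBasis (whole K V) e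
  e-basis = proj₁ (proj₂ subgeometry)

  private
    e≉0 : ∀ i → e i ≉ᴹ 0ᴹ
    e≉0 i eq = 1≉0 (trans (sym (δ-diagonal i)) (basis-independent e-basis (δ i) (≈ᴹ-trans (lc-δ i e) eq) i))

    e-injective : ∀ {a b : Scalars d} → lc a e ≈ᴹ lc b e → ∀ j → a j ≈ b j
    e-injective = lc-injective (basis-independent e-basis)

    two : Fin d → Fin d → Carrier → Carrier → Scalars d
    two i j k l r = k · δ i r + l · δ j r

    lc-two : ∀ i j k l → lc (two i j k l) e ≈ᴹ k *ₗ e i +ᴹ l *ₗ e j
    lc-two i j k l = ≈ᴹ-trans (lc-+ _ _ e) (+ᴹ-cong (≈ᴹ-trans (lc-* k _ e) (*ₗ-congˡ (lc-δ i e)))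
                                                    (≈ᴹ-trans (lc-* l _ e) (*ₗ-congˡ (lc-δ j e))))

    two-at : ∀ {i j} → i ≢ j → ∀ k l → two i j k l i ≈ k × two i j k l j ≈ l
    two-at {i} {j} i≢j k l =
      trans (+-cong (trans (*-congˡ (δ-diagonal i)) (*-identityʳ k)) (trans (*-congˡ (δ-off (i≢j ∘ ≡.sym))) (zeroʳ l))) (+-identityʳ k) ,
      trans (+-cong (trans (*-congˡ (δ-off i≢j)) (zeroʳ k)) (trans (*-congˡ (δ-diagonal j)) (*-identityʳ l))) (+-identityˡ l)

    two-injective : ∀ {i j k l k′ l′} → i ≢ j → k *ₗ e i +ᴹ l *ₗ e j ≈ᴹ k′ *ₗ e i +ᴹ l′ *ₗ e j → k ≈ k′ × l ≈ l′
    two-injective {i} {j} {k} {l} {k′} {l′} i≢j eq =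
      trans (sym (proj₁ (two-at i≢j k l))) (trans (coords i) (proj₁ (two-at i≢j k′ l′))) ,
      trans (sym (proj₂ (two-at i≢j k l))) (trans (coords j) (proj₂ (two-at i≢j k′ l′)))
      where
      coords : ∀ r → two i j k l r ≈ two i j k′ l′ r
      coords = e-injective (≈ᴹ-trans (lc-two i j k l) (≈ᴹ-trans eq (≈ᴹ-sym (lc-two i j k′ l′))))

    two≉0 : ∀ {i j k} → i ≢ j → 1# *ₗ e i +ᴹ k *ₗ e j ≉ᴹ 0ᴹ
    two≉0 {i} {j} i≢j eq = 1≉0 (proj₁ (two-injective {k′ = 0#} {0#} i≢j (≈ᴹ-trans eq
      (≈ᴹ-sym (≈ᴹ-trans (+ᴹ-cong (*ₗ-zeroˡ _) (*ₗ-zeroˡ _)) (+ᴹ-identityˡ 0ᴹ))))))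

  Rational : FSubspace E V
  Rational = ⟨_⟩ {K = F} {V = restrictScalars E V} (λ v → Σ[ i ∈ Fin d ] e i ≈ᴹ v)

  private
    e-rational : ∀ i → e i ∈ ∣ Rational ∣
    e-rational i = incl (i , ≈ᴹ-refl)

    two-rational : ∀ i j c → 1# *ₗ e i +ᴹ ι c *ₗ e j ∈ ∣ Rational ∣
    two-rational i j c = add (resp (≈ᴹ-sym (*ₗ-identityˡ _)) (e-rational i)) (mul c (e-rational j))

    rational⇒combination : ∀ {v} → v ∈ ∣ Rational ∣ → ∣ VF.span e ∣ v
    rational⇒combination = VF.⟨⟩-least (VF.span e) (λ (i , e≈) → VF.δ i , ≈ᴹ-trans (≈ᴹ-sym e≈) (≈ᴹ-sym (VF.lc-δ i e)))

    rational⇒eigenvector : ∀ {v} → v ∈ ∣ Rational ∣ → v ≉ᴹ 0ᴹ → ∃[ k ] map v ≈ᴹ k *ₗ v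
    rational⇒eigenvector {v} v∈ v≉0 = proj₂ (proj₂ (proj₂ subgeometry)) {record { rep = v ; rep≉0 = v≉0 }}
      (v , v∈ , v≉0 , 1# , ≈ᴹ-sym (*ₗ-identityˡ v))

    map-two : ∀ {i j a b} k l → map (e i) ≈ᴹ a *ₗ e i → map (e j) ≈ᴹ b *ₗ e j →
              map (k *ₗ e i +ᴹ l *ₗ e j) ≈ᴹ (σ k · a) *ₗ e i +ᴹ (σ l · b) *ₗ e j
    map-two k l i≈ j≈ = ≈ᴹ-trans (ψ.∙-homo _ _) (+ᴹ-cong
      (≈ᴹ-trans (semilinear k _) (≈ᴹ-trans (*ₗ-congˡ i≈) (≈ᴹ-sym (*ₗ-assoc _ _ _))))
      (≈ᴹ-trans (semilinear l _) (≈ᴹ-trans (*ₗ-congˡ j≈) (≈ᴹ-sym (*ₗ-assoc _ _ _)))))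

    scale-two : ∀ {i j} k l h → h *ₗ (k *ₗ e i +ᴹ l *ₗ e j) ≈ᴹ (h · k) *ₗ e i +ᴹ (h · l) *ₗ e j
    scale-two k l h = ≈ᴹ-trans (*ₗ-distribˡ h _ _) (+ᴹ-cong (≈ᴹ-sym (*ₗ-assoc _ _ _)) (≈ᴹ-sym (*ₗ-assoc _ _ _)))

  scale : Carrier
  scale = proj₁ (rational⇒eigenvector (e-rational i₀) (e≉0 i₀))

  private
    -- The basis vectors are eigenvectors, but possibly for different eigenvalues. The sum of `e i₀`
    -- and `e i` is rational too, hence an eigenvector, and its single eigenvalue must equal both.
    map-e : ∀ i → map (e i) ≈ᴹ scale *ₗ e i
    map-e i = [ (λ { ≡.refl → proj₂ (rational⇒eigenvector (e-rational i₀) (e≉0 i₀)) }) , off ]′ (Dec.toSum (i₀ Fin.≟ i))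
      where
      off : i₀ ≢ i → map (e i) ≈ᴹ scale *ₗ e i
      off i₀≢i =
        let (k , map-ei) = rational⇒eigenvector (e-rational i) (e≉0 i)
            (l , map-sum) = rational⇒eigenvector (two-rational i₀ i F.1#) (two≉0 i₀≢i)
            (s≈l , k≈l) = two-injective i₀≢i (≈ᴹ-trans (≈ᴹ-sym (map-two 1# (ι F.1#)
              (proj₂ (rational⇒eigenvector (e-rational i₀) (e≉0 i₀))) map-ei)) (≈ᴹ-trans map-sum (scale-two 1# (ι F.1#) l)))
            unit = trans (σ.⟦⟧-cong ι.1#-homo) σ.1#-homo
        in ≈ᴹ-trans map-ei (*ₗ-congʳ (begin
          k              ≈⟨ trans (*-congʳ unit) (*-identityˡ k) ⟨
          σ (ι F.1#) · k ≈⟨ k≈l ⟩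
          l · ι F.1#     ≈⟨ *-congˡ ι.1#-homo ⟩
          l · 1#         ≈⟨ s≈l ⟨
          σ 1# · scale   ≈⟨ trans (*-congʳ σ.1#-homo) (*-identityˡ scale) ⟩
          scale          ∎))
        where open R

    scale≉0 : scale ≉ 0#
    scale≉0 eq = e≉0 i₀ (ψ.injective (≈ᴹ-trans (map-e i₀) (≈ᴹ-trans (*ₗ-congʳ eq) (≈ᴹ-trans (*ₗ-zeroˡ _) (≈ᴹ-sym ψ.ε-homo)))))

    scale⁻¹ : Carrier
    scale⁻¹ = proj₁ (inverse scale≉0)

    scale⁻¹·scale : scale⁻¹ · scale ≈ 1#
    scale⁻¹·scale = proj₂ (inverse scale≉0)

  -- A multiple of the map inducing Ψ, normalised so as to fix the basis e.
  φ : Carrierᴹ → Carrierᴹ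
  φ v = scale⁻¹ *ₗ map v

  φ-cong : ∀ {u v} → u ≈ᴹ v → φ u ≈ᴹ φ v
  φ-cong eq = *ₗ-congˡ (ψ.⟦⟧-cong eq)

  φ-+ : ∀ u v → φ (u +ᴹ v) ≈ᴹ φ u +ᴹ φ v
  φ-+ u v = ≈ᴹ-trans (*ₗ-congˡ (ψ.∙-homo u v)) (*ₗ-distribˡ _ _ _)

  φ-0 : φ 0ᴹ ≈ᴹ 0ᴹ
  φ-0 = ≈ᴹ-trans (*ₗ-congˡ ψ.ε-homo) (*ₗ-zeroʳ _)

  -- K is commutative, so the constant factor moves past `σ k` and rescaling leaves the companion
  -- automorphism unchanged.
  φ-* : ∀ k v → φ (k *ₗ v) ≈ᴹ σ k *ₗ φ v
  φ-* k v = ≈ᴹ-trans (*ₗ-congˡ (semilinear k v)) (≈ᴹ-trans (≈ᴹ-sym (*ₗ-assoc _ _ _))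
    (≈ᴹ-trans (*ₗ-congʳ (*-comm _ _)) (*ₗ-assoc _ _ _)))

  map≈scale*φ : ∀ v → map v ≈ᴹ scale *ₗ φ v
  map≈scale*φ v = ≈ᴹ-sym (≈ᴹ-trans (≈ᴹ-sym (*ₗ-assoc _ _ _)) (≈ᴹ-trans (*ₗ-congʳ (trans (*-comm _ _) scale⁻¹·scale)) (*ₗ-identityˡ _)))

  φ-surjective : ∀ w → ∃[ v ] φ v ≈ᴹ w
  φ-surjective w = let (v , eq) = ψ.surjective (scale *ₗ w) in
    v , ≈ᴹ-trans (*ₗ-congˡ (eq ≈ᴹ-refl)) (≈ᴹ-trans (≈ᴹ-sym (*ₗ-assoc _ _ _)) (≈ᴹ-trans (*ₗ-congʳ scale⁻¹·scale) (*ₗ-identityˡ w)))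

  φ-lc : ∀ {r} (a : Scalars r) (x : Vectors r) → φ (lc a x) ≈ᴹ lc (σ ∘ a) (φ ∘ x)
  φ-lc = SemilinearMap.map-lc K V V {σ = σ} φ-cong φ-+ φ-0 φ-*

  φ-e : ∀ i → φ (e i) ≈ᴹ e i
  φ-e i = ≈ᴹ-trans (*ₗ-congˡ (map-e i)) (≈ᴹ-trans (≈ᴹ-sym (*ₗ-assoc _ _ _)) (≈ᴹ-trans (*ₗ-congʳ scale⁻¹·scale) (*ₗ-identityˡ _)))

  private
    -- Test vectors turning points into scalars: `φ` acts on the parameter as `σ`, and the
    -- coefficient 1 at `e i₀` makes proportional test vectors equal. A second basis vector is
    -- essential here.
    vec : Carrier → Carrierᴹ
    vec c = 1# *ₗ e i₀ +ᴹ c *ₗ e i₁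

    φ-vec : ∀ c → φ (vec c) ≈ᴹ vec (σ c)
    φ-vec c = ≈ᴹ-trans (φ-+ _ _) (+ᴹ-cong
      (≈ᴹ-trans (φ-* 1# _) (*ₗ-cong σ.1#-homo (φ-e i₀))) (≈ᴹ-trans (φ-* c _) (*ₗ-congˡ (φ-e i₁))))

    vec-∼ : ∀ {b c k} → vec b ≈ᴹ k *ₗ vec c → b ≈ c
    vec-∼ {b} {c} {k} eq = let (1≈k1 , b≈kc) = two-injective i₀≢i₁ (≈ᴹ-trans eq (scale-two 1# c k)) in
      trans b≈kc (trans (*-congʳ (trans (sym (*-identityʳ k)) (sym 1≈k1))) (*-identityˡ c))

  -- If `c` comes from F, `vec c` is rational, hence an eigenvector, so `vec (σ c)` and `vec c` are
  -- proportional. Conversely a fixed `c` makes `vec c` a fixed point, thus a multiple of a vector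
  -- with coordinates in F; `c` is the ratio of two of these.
  fixed⇔rational : ∀ c → σ c ≈ c ⇔ (∃[ b ] c ≈ ι b)
  fixed⇔rational c = mk⇔ to from
    where
    from : (∃[ b ] c ≈ ι b) → σ c ≈ c
    from (b , c≈ιb) = trans (σ.⟦⟧-cong c≈ιb) (trans (vec-∼ (≈ᴹ-trans (≈ᴹ-sym (φ-vec (ι b)))
      (≈ᴹ-trans (*ₗ-congˡ (proj₂ eigen)) (≈ᴹ-sym (*ₗ-assoc _ _ _))))) (sym c≈ιb))
      where
      eigen : ∃[ k ] map (vec (ι b)) ≈ᴹ k *ₗ vec (ι b)
      eigen = rational⇒eigenvector (two-rational i₀ i₁ b) (two≉0 i₀≢i₁)
    ratio : ∀ {k b₀ b₁} → 1# ≈ k · ι b₀ → c ≈ k · ι b₁ → ∃[ b ] c ≈ ι b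
    ratio {k} {b₀} {b₁} 1≈ c≈ =
      let (h , hb≈1) = FiniteField.inverse F cardF {b₀} (λ b≈0 → 1≉0 (trans 1≈ (trans (*-congˡ (trans (ι.⟦⟧-cong b≈0) ι.0#-homo)) (zeroʳ k))))
      in h F.* b₁ , trans c≈ (trans (*-congʳ (begin
           k                    ≈⟨ *-identityʳ k ⟨
           k · 1#               ≈⟨ *-congˡ ι.1#-homo ⟨
           k · ι F.1#           ≈⟨ *-congˡ (ι.⟦⟧-cong hb≈1) ⟨
           k · ι (h F.* b₀)     ≈⟨ *-congˡ (trans (ι.*-homo _ _) (*-comm _ _)) ⟩
           k · (ι b₀ · ι h)     ≈⟨ *-assoc _ _ _ ⟨
           (k · ι b₀) · ι h     ≈⟨ *-congʳ 1≈ ⟨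
           1# · ι h             ≈⟨ *-identityˡ _ ⟩
           ι h                  ∎)) (sym (ι.*-homo _ _)))
      where open R
    coordinate : ∀ {k u} → vec c ≈ᴹ k *ₗ u → ∣ VF.span e ∣ u → ∃[ b ] c ≈ ι b
    coordinate {k} vec≈ku (b , u≈) = ratio (trans (sym (proj₁ at)) (eqs i₀)) (trans (sym (proj₂ at)) (eqs i₁))
      where
      eqs : ∀ j → two i₀ i₁ 1# c j ≈ k · ι (b j)
      eqs = e-injective (≈ᴹ-trans (lc-two i₀ i₁ 1# c) (≈ᴹ-trans vec≈ku (≈ᴹ-trans (*ₗ-congˡ (≈ᴹ-trans u≈ (restrict-lc E V b e)))
              (≈ᴹ-sym (lc-* k (ι ∘ b) e)))))
      at : two i₀ i₁ 1# c i₀ ≈ 1# × two i₀ i₁ 1# c i₁ ≈ c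
      at = two-at i₀≢i₁ 1# c
    to : σ c ≈ c → ∃[ b ] c ≈ ι b
    to σc≈c =
      let (u , u∈ , _ , (k , vec≈ku)) = proj₁ (proj₂ (proj₂ subgeometry)) {record { rep = vec c ; rep≉0 = two≉0 i₀≢i₁ }}
            (scale , ≈ᴹ-trans (map≈scale*φ _) (*ₗ-congˡ (≈ᴹ-trans (φ-vec c) (+ᴹ-congˡ (*ₗ-congʳ σc≈c)))))
      in coordinate vec≈ku (rational⇒combination u∈)

  rational⇒fixed : ∀ {v} → v ∈ ∣ Rational ∣ → φ v ≈ᴹ v
  rational⇒fixed = VF.⟨⟩-least (record
    { ∣_∣ = λ v → φ v ≈ᴹ v
    ; resp = λ u≈v eq → ≈ᴹ-trans (φ-cong (≈ᴹ-sym u≈v)) (≈ᴹ-trans eq u≈v)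
    ; 0-closed = φ-0
    ; +-closed = λ p q → ≈ᴹ-trans (φ-+ _ _) (+ᴹ-cong p q)
    ; *ₗ-closed = λ b p → ≈ᴹ-trans (φ-* _ _) (*ₗ-cong (Equivalence.from (fixed⇔rational (ι b)) (b , refl)) p)
    }) (λ (i , e≈) → ≈ᴹ-trans (φ-cong (≈ᴹ-sym e≈)) (≈ᴹ-trans (φ-e i) e≈))

  -- A fixed point yields only an eigenvector of `φ`. The subgeometry hypothesis supplies the
  -- multiple that `φ` fixes exactly.
  fixed-point : ∀ P → P ∈ Fix Ψ → ∃[ u ] ∃[ k ] φ u ≈ᴹ u × u ≉ᴹ 0ᴹ × rep P ≈ᴹ k *ₗ u
  fixed-point P P∈Fix = let (u , u∈ , u≉0 , (k , P≈ku)) = proj₁ (proj₂ (proj₂ subgeometry)) {P} P∈Fix in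
    u , k , rational⇒fixed u∈ , u≉0 , P≈ku

  φ^ : ℕ → Carrierᴹ → Carrierᴹ
  φ^ i v = fold v φ i

  σ^ : ℕ → Carrier → Carrier
  σ^ i c = fold c σ i

  σ^-cong : ∀ i {b c} → b ≈ c → σ^ i b ≈ σ^ i c
  σ^-cong zero eq = eq
  σ^-cong (suc i) eq = σ.⟦⟧-cong (σ^-cong i eq)

  φ^-cong : ∀ i {u v} → u ≈ᴹ v → φ^ i u ≈ᴹ φ^ i v
  φ^-cong zero eq = eq
  φ^-cong (suc i) eq = φ-cong (φ^-cong i eq)

  φ^-lc : ∀ i {r} (a : Scalars r) (x : Vectors r) → φ^ i (lc a x) ≈ᴹ lc (σ^ i ∘ a) (φ^ i ∘ x)
  φ^-lc zero a x = ≈ᴹ-refl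
  φ^-lc (suc i) a x = ≈ᴹ-trans (φ-cong (φ^-lc i a x)) (φ-lc _ _)

  φ^-surjective : ∀ i w → ∃[ v ] φ^ i v ≈ᴹ w
  φ^-surjective zero w = w , ≈ᴹ-refl
  φ^-surjective (suc i) w = let (v , eq) = φ-surjective w ; (u , eq′) = φ^-surjective i v in
    u , ≈ᴹ-trans (φ-cong eq′) eq

  σ^-iso : ∀ i → IsRingIsomorphism rawRing rawRing (σ^ i)
  σ^-iso zero = Identity.isRingIsomorphism rawRing refl
  σ^-iso (suc i) = Composition.isRingIsomorphism trans (σ^-iso i) σ-iso

  module _ {t : ℕ} (order : ∀ P → P ^ᴾ[ Ψ ] t ∼ P) where
    -- The order gives that `φ^ t (vec c)`, which is `vec (σ^ t c)`, is a multiple of `vec c`;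
    -- proportional test vectors coincide.
    σ^t : ∀ c → σ^ t c ≈ c
    σ^t c = let (k , eq) = order P ; (h , hs≈1) = inverse (scales≉0 t) in
      vec-∼ {k = h · k} (begin
        vec (σ^ t c)                         ≈⟨ φ^-vec t ⟨
        φ^ t (vec c)                         ≈⟨ *ₗ-identityˡ _ ⟨
        1# *ₗ φ^ t (vec c)                   ≈⟨ *ₗ-congʳ hs≈1 ⟨
        (h · scales t) *ₗ φ^ t (vec c)       ≈⟨ *ₗ-assoc _ _ _ ⟩
        h *ₗ (scales t *ₗ φ^ t (vec c))      ≈⟨ *ₗ-congˡ (rep-^ᴾ t) ⟨
        h *ₗ rep (P ^ᴾ[ Ψ ] t)               ≈⟨ *ₗ-congˡ eq ⟩
        h *ₗ (k *ₗ vec c)                    ≈⟨ *ₗ-assoc _ _ _ ⟨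
        (h · k) *ₗ vec c                     ∎)
      where
      open ≈-Reasoning ≈ᴹ-setoid
      P : Point K V
      P = record { rep = vec c ; rep≉0 = two≉0 i₀≢i₁ }
      φ^-vec : ∀ i → φ^ i (vec c) ≈ᴹ vec (σ^ i c)
      φ^-vec zero = ≈ᴹ-refl
      φ^-vec (suc i) = ≈ᴹ-trans (φ-cong (φ^-vec i)) (φ-vec _)
      -- The factor between the i-th iterate of `map` and `φ^ i`: each application of `map` twists
      -- the factor collected so far by `σ` and adds another `scale`.
      scales : ℕ → Carrier
      scales zero = 1#
      scales (suc i) = σ (scales i) · scale
      scales≉0 : ∀ i → scales i ≉ 0#
      scales≉0 zero = 1≉0
      scales≉0 (suc i) eq = scale≉0 (zero-product (λ σs≈0 → scales≉0 i (σ.injective (trans σs≈0 (sym σ.0#-homo)))) eq)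
      rep-^ᴾ : ∀ i → rep (P ^ᴾ[ Ψ ] i) ≈ᴹ scales i *ₗ φ^ i (vec c)
      rep-^ᴾ zero = ≈ᴹ-sym (*ₗ-identityˡ _)
      rep-^ᴾ (suc i) = ≈ᴹ-trans (ψ.⟦⟧-cong (rep-^ᴾ i)) (≈ᴹ-trans (semilinear _ _)
        (≈ᴹ-trans (*ₗ-congˡ (map≈scale*φ _)) (≈ᴹ-sym (*ₗ-assoc _ _ _))))

    -- As `σ^ t` is the identity, `φ^ t` is K-linear, and it fixes the basis `e`.
    φ^t : ∀ v → φ^ t v ≈ᴹ v
    φ^t v = let (c , v≈) = basis-spanning e-basis {v} tt in
      ≈ᴹ-trans (φ^-cong t v≈) (≈ᴹ-trans (φ^-lc t c e) (≈ᴹ-trans (lc-cong (λ j → σ^t (c j)) (λ j → φ^-e t j)) (≈ᴹ-sym v≈)))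
      where
      φ^-e : ∀ i j → φ^ i (e j) ≈ᴹ e j
      φ^-e zero j = ≈ᴹ-refl
      φ^-e (suc i) j = ≈ᴹ-trans (φ-cong (φ^-e i j)) (φ-e j)

  image-span : ∀ {S : Subspace K V} {r} {x : Vectors r} → S ≐ₛ span x → onSubspaces Ψ S ≐ₛ span (φ ∘ x)
  image-span {S} {x = x} (S⊆ , ⊆S) =
    (λ (u , u∈S , v≈) → let (c , u≈) = S⊆ u∈S in (λ j → scale · σ (c j)) ,
      ≈ᴹ-trans v≈ (≈ᴹ-trans (map≈scale*φ u) (≈ᴹ-trans (*ₗ-congˡ (≈ᴹ-trans (φ-cong u≈) (φ-lc c x))) (≈ᴹ-sym (lc-* _ _ _))))) ,
    -- `b` is chosen to solve `scale · σ (b j) ≈ c j`, since images of subspaces are taken under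
    -- `map` while the spanning vectors are moved by `φ`.
    (λ {v} (c , v≈) → let b = λ j → proj₁ (σ.surjective (scale⁻¹ · c j)) in
      lc b x , ⊆S (b , ≈ᴹ-refl) , (begin
        v                                          ≈⟨ v≈ ⟩
        lc c (φ ∘ x)                               ≈⟨ lc-congˡ (λ j → trans (trans (*-congʳ (trans (*-comm _ _) scale⁻¹·scale)) (*-identityˡ _)) refl) ⟨
        lc (λ j → (scale · scale⁻¹) · c j) (φ ∘ x) ≈⟨ lc-congˡ (λ j → trans (*-assoc _ _ _) (*-congˡ (sym (proj₂ (σ.surjective (scale⁻¹ · c j)) refl)))) ⟩
        lc (λ j → scale · σ (b j)) (φ ∘ x)         ≈⟨ lc-* _ _ _ ⟩
        scale *ₗ lc (σ ∘ b) (φ ∘ x)                ≈⟨ *ₗ-congˡ (φ-lc b x) ⟨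
        scale *ₗ φ (lc b x)                        ≈⟨ map≈scale*φ _ ⟨
        map (lc b x)                               ∎))
    where open ≈-Reasoning ≈ᴹ-setoid

  ^ˢ-span : ∀ {S : Subspace K V} {r} {x : Vectors r} → S ≐ₛ span x → ∀ i → S ^ˢ[ Ψ ] i ≐ₛ span (φ^ i ∘ x)
  ^ˢ-span S≐ zero = S≐
  ^ˢ-span {S} S≐ (suc i) = image-span {S ^ˢ[ Ψ ] i} (^ˢ-span {S} S≐ i)

-- Coordinates along the conjugates: singling out two indices, then the cyclic shift.

module SplitOff {ℓ} (K : Field ℓ) (V : VectorSpace K) {r : ℕ} {i₁ i₂ : Fin (suc (suc r))} (i₁≢i₂ : i₁ ≢ i₂) where
  open CommutativeRing (commRing K) hiding (zero) renaming (_*_ to _·_)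
  open LeftModule V
  open LinearAlgebra K V

  private
    j₂ : Fin (suc r)
    j₂ = punchOut i₁≢i₂

    i₂≡ : punchIn i₁ j₂ ≡ i₂
    i₂≡ = Fin.punchIn-punchOut i₁≢i₂

  rest : Fin r → Fin (suc (suc r))
  rest k = punchIn i₁ (punchIn j₂ k)

  rest≢i₁ : ∀ k → rest k ≢ i₁
  rest≢i₁ k = Fin.punchInᵢ≢i i₁ (punchIn j₂ k)

  rest≢i₂ : ∀ k → rest k ≢ i₂
  rest≢i₂ k eq = Fin.punchInᵢ≢i j₂ k (Fin.punchIn-injective i₁ _ _ (≡.trans eq (≡.sym i₂≡)))

  rest-surjective : ∀ {i} → i ≢ i₁ → i ≢ i₂ → ∃[ k ] rest k ≡ i
  rest-surjective {i} i≢i₁ i≢i₂ = punchOut j₂≢j , ≡.trans (≡.cong (punchIn i₁) (Fin.punchIn-punchOut j₂≢j)) (Fin.punchIn-punchOut (i≢i₁ ∘ ≡.sym))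
    where
    j₂≢j : j₂ ≢ punchOut (i≢i₁ ∘ ≡.sym)
    j₂≢j eq = i≢i₂ (≡.sym (Fin.punchOut-injective i₁≢i₂ (i≢i₁ ∘ ≡.sym) eq))

  module _ {n : ℕ} where
    lc²-split : ∀ (c : Fin (suc (suc r)) → Scalars n) b →
                lc² c b ≈ᴹ lc (c i₁) (b i₁) +ᴹ (lc (c i₂) (b i₂) +ᴹ lc² (c ∘ rest) (b ∘ rest))
    lc²-split c b = ≈ᴹ-trans (lc²-removeAt i₁ c b) (+ᴹ-congˡ (≈ᴹ-trans (lc²-removeAt j₂ (removeAt c i₁) (removeAt b i₁))
      (+ᴹ-congʳ (≈ᴹ-reflexive (≡.cong (λ i → lc (c i) (b i)) i₂≡)))))

    -- `j₂` is the position of `i₂` once `i₁` has been removed, so the row for `i₂` has to be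
    -- inserted first.
    merge : Scalars n → Scalars n → (Fin r → Scalars n) → Fin (suc (suc r)) → Scalars n
    merge a a′ c = insertAt (insertAt c j₂ a′) i₁ a

    merge-i₁ : ∀ a a′ c → merge a a′ c i₁ ≡ a
    merge-i₁ a a′ c = Vec.insertAt-lookup (insertAt c j₂ a′) i₁ a

    merge-i₂ : ∀ a a′ c → merge a a′ c i₂ ≡ a′
    merge-i₂ a a′ c = ≡.trans (≡.cong (merge a a′ c) (≡.sym i₂≡))
      (≡.trans (Vec.insertAt-punchIn (insertAt c j₂ a′) i₁ a j₂) (Vec.insertAt-lookup c j₂ a′))

    merge-rest : ∀ a a′ c k → merge a a′ c (rest k) ≡ c k
    merge-rest a a′ c k = ≡.trans (Vec.insertAt-punchIn (insertAt c j₂ a′) i₁ a (punchIn j₂ k)) (Vec.insertAt-punchIn c j₂ a′ k)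

    split-independent : ∀ {b : Fin (suc (suc r)) → Vectors n} → Independent² b → ∀ {a a′ c} →
      lc a (b i₁) +ᴹ (lc a′ (b i₂) +ᴹ lc² c (b ∘ rest)) ≈ᴹ 0ᴹ →
      (∀ j → a j ≈ 0#) × (∀ j → a′ j ≈ 0#) × (∀ k j → c k j ≈ 0#)
    split-independent {b} ind {a} {a′} {c} eq =
      (λ j → trans (at j (≡.sym (merge-i₁ a a′ c))) (zeros i₁ j)) ,
      (λ j → trans (at j (≡.sym (merge-i₂ a a′ c))) (zeros i₂ j)) ,
      (λ k j → trans (at j (≡.sym (merge-rest a a′ c k))) (zeros (rest k) j))
      where
      at : ∀ {a a′ : Scalars n} j → a ≡ a′ → a j ≈ a′ j
      at j eq = reflexive (≡.cong (λ a → a j) eq)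
      zeros : ∀ i j → merge a a′ c i j ≈ 0#
      zeros = ind (merge a a′ c) (≈ᴹ-trans (lc²-split (merge a a′ c) b) (≈ᴹ-trans
        (+ᴹ-cong (lc-congˡ (λ j → at j (merge-i₁ a a′ c)))
          (+ᴹ-cong (lc-congˡ (λ j → at j (merge-i₂ a a′ c))) (lc²-cong (λ k j → at j (merge-rest a a′ c k)) (λ _ _ → ≈ᴹ-refl)))) eq))

-- φ permutes the conjugates of θ cyclically, so on coordinates it acts as a cyclic shift composed with σ.
module Cyclic {ℓ} (K : Field ℓ) (V : VectorSpace K) {σ : Ring.Carrier (ringOf K) → Ring.Carrier (ringOf K)}
  {φ : LeftModule.Carrierᴹ V → LeftModule.Carrierᴹ V}
  (φ-cong : ∀ {u v} → LeftModule._≈ᴹ_ V u v → LeftModule._≈ᴹ_ V (φ u) (φ v))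
  (φ-+ : ∀ u v → LeftModule._≈ᴹ_ V (φ (LeftModule._+ᴹ_ V u v)) (LeftModule._+ᴹ_ V (φ u) (φ v)))
  (φ-0 : LeftModule._≈ᴹ_ V (φ (LeftModule.0ᴹ V)) (LeftModule.0ᴹ V))
  (φ-* : ∀ k v → LeftModule._≈ᴹ_ V (φ (LeftModule._*ₗ_ V k v)) (LeftModule._*ₗ_ V (σ k) (φ v)))
  {t′ n : ℕ} (θ : Fin n → LeftModule.Carrierᴹ V)
  (periodic : ∀ j → LeftModule._≈ᴹ_ V (fold (θ j) φ (suc t′)) (θ j)) where
  open CommutativeRing (commRing K) hiding (zero) renaming (_*_ to _·_)
  open LeftModule V
  open LinearAlgebra K V

  conjugate : Fin (suc t′) → Vectors n
  conjugate i j = fold (θ j) φ (toℕ i)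

  shift : (Fin (suc t′) → Scalars n) → Fin (suc t′) → Scalars n
  shift c zero = σ ∘ c (fromℕ t′)
  shift c (suc i) = σ ∘ c (inject₁ i)

  φ-shift : ∀ c → φ (lc² c conjugate) ≈ᴹ lc² (shift c) conjugate
  φ-shift c = begin
    φ (lc² c conjugate)                                                                          ≈⟨ φ-cong (lc²-last c conjugate) ⟩
    φ (lc² (c ∘ inject₁) (conjugate ∘ inject₁) +ᴹ lc (c (fromℕ t′)) (conjugate (fromℕ t′)))      ≈⟨ φ-+ _ _ ⟩
    φ (lc² (c ∘ inject₁) (conjugate ∘ inject₁)) +ᴹ φ (lc (c (fromℕ t′)) (conjugate (fromℕ t′)))  ≈⟨ +ᴹ-comm _ _ ⟩
    φ (lc (c (fromℕ t′)) (conjugate (fromℕ t′))) +ᴹ φ (lc² (c ∘ inject₁) (conjugate ∘ inject₁))  ≈⟨ +ᴹ-cong (map-lc φ-cong φ-+ φ-0 φ-* _ _) (map-lc² φ-cong φ-+ φ-0 φ-* _ _) ⟩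
    lc (shift c zero) (φ ∘ conjugate (fromℕ t′)) +ᴹ lc² (shift c ∘ suc) (λ i → φ ∘ conjugate (inject₁ i)) ≈⟨ +ᴹ-cong (lc-congʳ first) (lc²-cong (λ _ _ → refl) later) ⟩
    lc (shift c zero) (conjugate zero) +ᴹ lc² (shift c ∘ suc) (conjugate ∘ suc)                  ≈⟨ lc²-suc (shift c) conjugate ⟨
    lc² (shift c) conjugate                                                                      ∎
    where
    open ≈-Reasoning ≈ᴹ-setoid
    open SemilinearMap K V V
    first : ∀ j → φ (conjugate (fromℕ t′) j) ≈ᴹ θ j
    first j = ≈ᴹ-trans (≈ᴹ-reflexive (≡.cong (λ i → φ (fold (θ j) φ i)) (Fin.toℕ-fromℕ t′))) (periodic j)
    later : ∀ i j → φ (conjugate (inject₁ i) j) ≈ᴹ conjugate (suc i) j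
    later i j = ≈ᴹ-reflexive (≡.cong (λ i → φ (fold (θ j) φ i)) (Fin.toℕ-inject₁ i))

  module _ (σ-cong : ∀ {a b} → a ≈ b → σ a ≈ σ b) where
    private
      σ^-toℕ : ∀ (a : Carrier) (i : Fin t′) → σ (fold a σ (toℕ (inject₁ i))) ≈ fold a σ (suc (toℕ i))
      σ^-toℕ a i = reflexive (≡.cong (λ i → σ (fold a σ i)) (Fin.toℕ-inject₁ i))

    -- Fixed vectors have coordinates equal to their shift, so each row is `σ` of the row before;
    -- induction expresses all rows through row zero.
    fixed-coordinates : Independent² conjugate → ∀ c → φ (lc² c conjugate) ≈ᴹ lc² c conjugate →
                        ∀ i j → c i j ≈ fold (c zero j) σ (toℕ i)
    fixed-coordinates ind c eq i j = Fin.<-weakInduction (λ i → c i j ≈ fold (c zero j) σ (toℕ i)) refl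
      (λ i IH → trans (lc²-injective ind (≈ᴹ-trans (≈ᴹ-sym eq) (φ-shift c)) (suc i) j) (trans (σ-cong IH) (σ^-toℕ (c zero j) i))) i

    -- All rows but one match their predecessor by construction. The wrap-around from the last row
    -- to row zero is where periodicity of `σ` enters.
    fixed-combination : (∀ a → fold a σ (suc t′) ≈ a) → (a : Scalars n) →
      φ (lc² (λ i j → fold (a j) σ (toℕ i)) conjugate) ≈ᴹ lc² (λ i j → fold (a j) σ (toℕ i)) conjugate
    fixed-combination σ-periodic a = ≈ᴹ-trans (φ-shift _) (lc²-cong
      (λ { zero j → trans (reflexive (≡.cong (λ i → σ (fold (a j) σ i)) (Fin.toℕ-fromℕ t′))) (σ-periodic (a j))
         ; (suc i) j → σ^-toℕ (a j) i }) (λ _ _ → ≈ᴹ-refl))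

-- Periods of a scalar under iteration of `σ`.

module Periods {ℓ} (K : Field ℓ) {σ : Ring.Carrier (ringOf K) → Ring.Carrier (ringOf K)}
  (σ-cong : ∀ {a b} → Ring._≈_ (ringOf K) a b → Ring._≈_ (ringOf K) (σ a) (σ b)) (c : Ring.Carrier (ringOf K)) where
  open CommutativeRing (commRing K) hiding (zero; _*_; _-_; -_)

  Period : ℕ → Set ℓ
  Period k = fold c σ k ≈ c

  private
    fold-cong : ∀ k {a b} → a ≈ b → fold a σ k ≈ fold b σ k
    fold-cong zero eq = eq
    fold-cong (suc k) eq = σ-cong (fold-cong k eq)

  period-+ : ∀ k l → Period k → Period l → Period (k ℕ.+ l)
  period-+ k l pk pl = trans (reflexive (fold-+ c σ k)) (trans (fold-cong k pl) pk)

  period-cancel : ∀ k l → Period (k ℕ.+ l) → Period l → Period k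
  period-cancel k l pkl pl = trans (sym (fold-cong k pl)) (trans (reflexive (≡.sym (fold-+ c σ k))) pkl)

  period-* : ∀ k l → Period l → Period (k * l)
  period-* zero l pl = refl
  period-* (suc k) l pl = period-+ l (k * l) pl (period-* k l pl)

  -- Bézout over the natural numbers states that a multiple of one period exceeds a multiple of the
  -- other by 1; cancelling the smaller multiple leaves the period 1.
  period-gcd : ∀ {k l} → gcd k l ≡ 1 → Period k → Period l → Period 1
  period-gcd {k} {l} eq pk pl = go (Bézout.identity (≡.subst (GCD k l) eq (gcd-GCD k l)))
    where
    go : Bézout.Identity 1 k l → Period 1
    go (Bézout.+- x y eq) = period-cancel 1 (y * l) (≡.subst Period (≡.sym eq) (period-* x k pk)) (period-* y l pl)
    go (Bézout.-+ x y eq) = period-cancel 1 (x * k) (≡.subst Period (≡.sym eq) (period-* y l pl)) (period-* x k pk)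

  -- Links the exponent of the companion automorphism to the absolute difference in the gcd
  -- hypothesis. If `i ≤ j`, the exponent is the difference plus `t`; otherwise `t` is the
  -- difference plus the exponent. Cancellation finishes either case.
  period-difference : ∀ {i j t} → i ≤ t → Period t → Period (j ℕ.+ (t ∸ i)) → Period ∣ j - i ∣
  period-difference {i} {j} {t} i≤t pt p with ℕ.≤-total i j
  ... | inj₁ i≤j = ≡.subst Period (≡.sym (ℕ.m≤n⇒∣n-m∣≡n∸m i≤j)) (period-cancel (j ∸ i) t (≡.subst Period eq p) pt)
    where
    open ≡.≡-Reasoning
    eq : j ℕ.+ (t ∸ i) ≡ (j ∸ i) ℕ.+ t
    eq = begin
      j ℕ.+ (t ∸ i)                    ≡⟨ ≡.cong (ℕ._+ (t ∸ i)) (ℕ.m∸n+n≡m i≤j) ⟨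
      (j ∸ i ℕ.+ i) ℕ.+ (t ∸ i)        ≡⟨ ℕ.+-assoc (j ∸ i) i (t ∸ i) ⟩
      (j ∸ i) ℕ.+ (i ℕ.+ (t ∸ i))      ≡⟨ ≡.cong ((j ∸ i) ℕ.+_) (ℕ.m+[n∸m]≡n i≤t) ⟩
      (j ∸ i) ℕ.+ t                    ∎
  ... | inj₂ j≤i = ≡.subst Period (≡.sym (ℕ.m≤n⇒∣m-n∣≡n∸m j≤i)) (period-cancel (i ∸ j) (j ℕ.+ (t ∸ i)) (≡.subst Period eq pt) p)
    where
    open ≡.≡-Reasoning
    eq : t ≡ (i ∸ j) ℕ.+ (j ℕ.+ (t ∸ i))
    eq = begin
      t                                ≡⟨ ℕ.m+[n∸m]≡n i≤t ⟨
      i ℕ.+ (t ∸ i)                    ≡⟨ ≡.cong (ℕ._+ (t ∸ i)) (ℕ.m∸n+n≡m j≤i) ⟨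
      (i ∸ j ℕ.+ j) ℕ.+ (t ∸ i)        ≡⟨ ℕ.+-assoc (i ∸ j) j (t ∸ i) ⟩
      (i ∸ j) ℕ.+ (j ℕ.+ (t ∸ i))      ∎

-- The projection of the subgeometry from `Γ` onto `Λ`.

module DirectorProjection {ℓ} (E : FieldExtension ℓ) {q n r : ℕ}
  (cardF : HasCardinality (FieldExtension.F E) q) (cardK : HasCardinality (FieldExtension.K E) (q ^ suc (suc r)))
  (V : VectorSpace (FieldExtension.K E)) (Ψ : SemilinearIso (FieldExtension.K E) V V)
  (order : ∀ P → P ^ᴾ[ Ψ ] suc (suc r) ∼ P) {d : ℕ} (subgeometry : IsSubgeometry E {V = V} d (Fix Ψ))
  {k₀ k₁ : Fin d} (k₀≢k₁ : k₀ ≢ k₁)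
  {Θ : Subspace (FieldExtension.K E) V} {θ : LinearAlgebra.Vectors (FieldExtension.K E) V n}
  (Θ≐ : Θ ≐ₛ LinearAlgebra.span (FieldExtension.K E) V θ)
  (conjugates-independent : LinearAlgebra.Independent² (FieldExtension.K E) V {suc (suc r)}
     (λ i j → Frobenius.φ^ E cardF cardK V Ψ subgeometry k₀≢k₁ (toℕ i) (θ j)))
  (conjugates-span : ∀ v → ∃[ c ] LeftModule._≈ᴹ_ V v (LinearAlgebra.lc² (FieldExtension.K E) V {suc (suc r)} c
     (λ i j → Frobenius.φ^ E cardF cardK V Ψ subgeometry k₀≢k₁ (toℕ i) (θ j))))
  {i₁ i₂ : Fin (suc (suc r))} (coprime : gcd ∣ toℕ i₂ - toℕ i₁ ∣ (suc (suc r)) ≡ 1) where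
  open FieldExtension E
  open Frobenius E cardF cardK V Ψ subgeometry k₀≢k₁
  open CommutativeRing (commRing K) hiding (zero; _-_) renaming (_*_ to _·_; -_ to neg)
  open LeftModule V
  open LinearAlgebra K V
  open FiniteField K cardK
  open SemilinearIso Ψ using (σ; σ-iso; map)
  private
    t : ℕ
    t = suc (suc r)
    module σ = IsRingIsomorphism σ-iso

    i₁≢i₂ : i₁ ≢ i₂
    i₁≢i₂ ≡.refl = contradiction (≡.trans (≡.sym (≡.cong (λ k → gcd k t) (ℕ.∣n-n∣≡0 (toℕ i₁)))) coprime) λ ()

  open SplitOff K V i₁≢i₂
  open Cyclic K V {σ = σ} {φ = φ} φ-cong φ-+ φ-0 φ-* {suc r} θ (λ j → φ^t {t} order (θ j))

  -- Added to `toℕ i₁` this gives `toℕ i₂ + t`, so `τ` carries the twist at `i₁` to the twist at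
  -- `i₂`.
  shiftExponent : ℕ
  shiftExponent = toℕ i₂ ℕ.+ (t ∸ toℕ i₁)

  τ : Carrier → Carrier
  τ = σ^ shiftExponent

  private
    module τ = IsRingIsomorphism (σ^-iso shiftExponent)

    x y : Vectors n
    x = conjugate i₁
    y = conjugate i₂
    z : Fin r → Vectors n
    z = conjugate ∘ rest

  open Decomposition K cardK V x y

  τ-σ^i₁ : ∀ c → τ (σ^ (toℕ i₁) c) ≈ σ^ (toℕ i₂) c
  τ-σ^i₁ c = begin
    σ^ (toℕ i₂ ℕ.+ (t ∸ toℕ i₁)) (σ^ (toℕ i₁) c)  ≡⟨ fold-+ c σ shiftExponent ⟨
    σ^ (toℕ i₂ ℕ.+ (t ∸ toℕ i₁) ℕ.+ toℕ i₁) c     ≡⟨ ≡.cong (λ k → σ^ k c) (≡.trans (ℕ.+-assoc (toℕ i₂) _ _)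
                                                        (≡.cong (toℕ i₂ ℕ.+_) (ℕ.m∸n+n≡m (ℕ.<⇒≤ (Fin.toℕ<n i₁))))) ⟩
    σ^ (toℕ i₂ ℕ.+ t) c                            ≡⟨ fold-+ c σ (toℕ i₂) ⟩
    σ^ (toℕ i₂) (σ^ t c)                           ≈⟨ σ^-cong (toℕ i₂) (σ^t {t} order c) ⟩
    σ^ (toℕ i₂) c                                  ∎
    where open ≈-Reasoning (Ring.setoid (ringOf K))

  -- A scalar fixed by `τ` has both `t` and `shiftExponent` as periods under `σ`; coprimality
  -- reduces them to the period 1, that is, to being fixed by `σ`.
  τ-fixed : ∀ c → τ c ≈ c ⇔ (∃[ b ] c ≈ ι b)
  τ-fixed c = mk⇔
    (λ τc≈c → Equivalence.to (fixed⇔rational c) (period-gcd {∣ toℕ i₂ - toℕ i₁ ∣} {t} coprime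
      (period-difference {toℕ i₁} {toℕ i₂} {t} (ℕ.<⇒≤ (Fin.toℕ<n i₁)) (σ^t {t} order c) τc≈c) (σ^t {t} order c)))
    (λ rational → ≡.subst Period (ℕ.*-identityʳ shiftExponent)
      (period-* shiftExponent 1 (Equivalence.from (fixed⇔rational c) rational)))
    where open Periods K σ.⟦⟧-cong c

  conj≐ : ∀ i → Θ ^ˢ[ Ψ ] toℕ i ≐ₛ span (conjugate i)
  conj≐ i = ^ˢ-span {Θ} Θ≐ (toℕ i)

  Θ₁ Θ₂ Γ Λ : Subspace K V
  Θ₁ = Θ ^ˢ[ Ψ ] toℕ i₁
  Θ₂ = Θ ^ˢ[ Ψ ] toℕ i₂
  Γ = ⟨ (λ v → Σ[ i ∈ Fin t ] i ≢ i₁ × i ≢ i₂ × v ∈ ∣ Θ ^ˢ[ Ψ ] toℕ i ∣) ⟩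
  Λ = ⟨ ∣ Θ₁ ∣ ∪ ∣ Θ₂ ∣ ⟩

  Γ≐ : span (flatten z) ≐ₛ Γ
  Γ≐ = (λ (a , v≈) → Subspace.resp Γ (≈ᴹ-sym v≈) (lc∈ Γ (λ l → let (k , j) = remQuot {r} n l in
         incl (rest k , rest≢i₁ k , rest≢i₂ k , proj₂ (conj≐ (rest k)) (x∈span (z k) j))) a)) ,
       ⟨⟩-least (span (flatten z)) (λ {v} (i , i≢i₁ , i≢i₂ , v∈) → row v v∈ (rest-surjective i≢i₁ i≢i₂))
    where
    row : ∀ {i} v → v ∈ ∣ Θ ^ˢ[ Ψ ] toℕ i ∣ → ∃[ k ] rest k ≡ i → v ∈ ∣ span (flatten z) ∣
    row v v∈ (k , ≡.refl) = let (c , v≈) = proj₁ (conj≐ (rest k)) v∈ in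
      Subspace.resp (span (flatten z)) (≈ᴹ-sym v≈) (lc∈ (span (flatten z)) (row∈span z k) c)

  private
    lc²∈Γ : ∀ c → lc² c z ∈ ∣ Γ ∣
    lc²∈Γ c = proj₁ Γ≐ (lc²∈span z c)

    x∈Θ₁ : ∀ j → x j ∈ ∣ Θ₁ ∣
    x∈Θ₁ j = proj₂ (conj≐ i₁) (x∈span x j)

    y∈Θ₂ : ∀ j → y j ∈ ∣ Θ₂ ∣
    y∈Θ₂ j = proj₂ (conj≐ i₂) (x∈span y j)

    ⊕∈Λ : ∀ a b → a ⊕ b ∈ ∣ Λ ∣
    ⊕∈Λ a b = add (lc∈ Λ (λ j → incl (inj₁ (x∈Θ₁ j))) a) (lc∈ Λ (λ j → incl (inj₂ (y∈Θ₂ j))) b)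

    Λ⊆ : ∣ Λ ∣ ⊆ ∣ joint ∣
    Λ⊆ = ⟨⟩-least joint
      [ (λ v∈Θ₁ → let (a , v≈) = proj₁ (conj≐ i₁) v∈Θ₁ in a , 0ᵛ , ≈ᴹ-trans v≈ (⊕-0ʳ a))
      , (λ v∈Θ₂ → let (b , v≈) = proj₁ (conj≐ i₂) v∈Θ₂ in 0ᵛ , b , ≈ᴹ-trans v≈ (⊕-0ˡ b)) ]′

    independent₃ : ∀ {a b c} → (a ⊕ b) +ᴹ lc² c z ≈ᴹ 0ᴹ → (∀ j → a j ≈ 0#) × (∀ j → b j ≈ 0#) × (∀ k j → c k j ≈ 0#)
    independent₃ eq = split-independent conjugates-independent (≈ᴹ-trans (≈ᴹ-sym (+ᴹ-assoc _ _ _)) eq)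

    independent₂ : ∀ {a b} → a ⊕ b ≈ᴹ 0ᴹ → (∀ j → a j ≈ 0#) × (∀ j → b j ≈ 0#)
    independent₂ eq = let (a≈0 , b≈0 , _) = independent₃ {c = λ _ _ → 0#} (≈ᴹ-trans (+ᴹ-cong eq (lc²-0 (λ _ _ → refl))) (+ᴹ-identityˡ 0ᴹ)) in
      a≈0 , b≈0

  Γ-dim : HasDim Γ (n * r)
  Γ-dim = ≡.subst (HasDim Γ) (ℕ.*-comm r n) (flatten z , isBasis-resp {span (flatten z)} {Γ} Γ≐ (span-isBasis (flatten-independent
    (λ c eq → proj₂ (proj₂ (independent₃ {0ᵛ} {0ᵛ} {c} (≈ᴹ-trans (+ᴹ-cong (⊕-0 (λ _ → refl) (λ _ → refl)) eq) (+ᴹ-identityˡ 0ᴹ))))))))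

  Λ-dim : HasDim Λ (2 * n)
  Λ-dim = _ , pair-isBasis {Λ} (λ j → incl (inj₁ (x∈Θ₁ j))) (λ j → incl (inj₂ (y∈Θ₂ j))) independent₂ Λ⊆

  Γ∩Λ : ∀ {v} → v ∈ ∣ Γ ∣ → v ∈ ∣ Λ ∣ → v ≈ᴹ 0ᴹ
  Γ∩Λ {v} v∈Γ v∈Λ =
    let (c , v≈) = span-flatten⇒lc² z (proj₂ Γ≐ v∈Γ)
        (a , b , v≈ab) = Λ⊆ v∈Λ
    -- The `Λ`-coordinates are negated so that the two expressions for `v` sum to a vanishing
    -- combination of all conjugates.
    in ≈ᴹ-trans v≈ (lc²-0 (proj₂ (proj₂ (independent₃ {λ j → neg 1# · a j} {λ j → neg 1# · b j} {c} (≈ᴹ-trans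
         (+ᴹ-cong (≈ᴹ-trans (⊕-* (neg 1#) a b) (≈ᴹ-trans (*ₗ-congˡ (≈ᴹ-sym v≈ab)) (-1*ₗ v))) (≈ᴹ-sym v≈)) (-ᴹ‿inverseˡ v))))))

  Γ⊥Λ : PG Γ ⊥ PG Λ
  Γ⊥Λ {P} (P∈Γ , P∈Λ) = Point.rep≉0 P (Γ∩Λ P∈Γ P∈Λ)

  graph : Scalars n → Carrierᴹ
  graph a = a ⊕ (τ ∘ a)

  -- The vectors fixed by φ are the sums over i of the vectors with coordinates σ ^ i ∘ a in Θ ^ˢ i.
  fixed⇒graph : ∀ {u} → φ u ≈ᴹ u → u ≉ᴹ 0ᴹ → ∃[ a ] ¬ (∀ j → a j ≈ 0#) × ∃[ c ] u ≈ᴹ graph a +ᴹ lc² c z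
  fixed⇒graph {u} φu≈u u≉0 = c i₁ , a≉0 , c ∘ rest , (begin
    u                                                    ≈⟨ u≈ ⟩
    lc² c conjugate                                      ≈⟨ lc²-split c conjugate ⟩
    lc (c i₁) x +ᴹ (lc (c i₂) y +ᴹ lc² (c ∘ rest) z)     ≈⟨ +ᴹ-assoc _ _ _ ⟨
    (c i₁ ⊕ c i₂) +ᴹ lc² (c ∘ rest) z                    ≈⟨ +ᴹ-congʳ (⊕-cong (λ _ → refl) (λ j → trans (coords i₂ j)
                                                              (sym (trans (τ.⟦⟧-cong (coords i₁ j)) (τ-σ^i₁ (c zero j)))))) ⟩
    graph (c i₁) +ᴹ lc² (c ∘ rest) z                     ∎)
    where
    open ≈-Reasoning ≈ᴹ-setoid
    c : Fin t → Scalars n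
    c = proj₁ (conjugates-span u)
    u≈ : u ≈ᴹ lc² c conjugate
    u≈ = proj₂ (conjugates-span u)
    coords : ∀ i j → c i j ≈ σ^ (toℕ i) (c zero j)
    coords = fixed-coordinates σ.⟦⟧-cong conjugates-independent c (≈ᴹ-trans (φ-cong (≈ᴹ-sym u≈)) (≈ᴹ-trans φu≈u u≈))
    a≉0 : ¬ (∀ j → c i₁ j ≈ 0#)
    a≉0 a≈0 = u≉0 (≈ᴹ-trans u≈ (lc²-0 (λ i j → trans (coords i j) (trans (σ^-cong (toℕ i) (c₀≈0 j)) (IsRingIsomorphism.0#-homo (σ^-iso (toℕ i)))))))
      where
      c₀≈0 : ∀ j → c zero j ≈ 0#
      c₀≈0 j = IsRingIsomorphism.injective (σ^-iso (toℕ i₁))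
        (trans (sym (coords i₁ j)) (trans (a≈0 j) (sym (IsRingIsomorphism.0#-homo (σ^-iso (toℕ i₁))))))

  -- The coordinates are prescribed in row `i₁`. Undoing `σ^ (toℕ i₁)` gives row zero, and its
  -- twists form a vector fixed by `φ`.
  graph⇒fixed : ∀ a → ∃[ u ] φ u ≈ᴹ u × ∃[ c ] u ≈ᴹ graph a +ᴹ lc² c z
  graph⇒fixed a = lc² c conjugate , fixed-combination σ.⟦⟧-cong (σ^t {t} order) a₀ , c ∘ rest , (begin
    lc² c conjugate                                      ≈⟨ lc²-split c conjugate ⟩
    lc (c i₁) x +ᴹ (lc (c i₂) y +ᴹ lc² (c ∘ rest) z)     ≈⟨ +ᴹ-assoc _ _ _ ⟨
    (c i₁ ⊕ c i₂) +ᴹ lc² (c ∘ rest) z                    ≈⟨ +ᴹ-congʳ (⊕-cong a₀-correct (λ j → trans (sym (τ-σ^i₁ (a₀ j))) (τ.⟦⟧-cong (a₀-correct j)))) ⟩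
    graph a +ᴹ lc² (c ∘ rest) z                          ∎)
    where
    open ≈-Reasoning ≈ᴹ-setoid
    a₀ : Scalars n
    a₀ j = proj₁ (IsRingIsomorphism.surjective (σ^-iso (toℕ i₁)) (a j))
    a₀-correct : ∀ j → σ^ (toℕ i₁) (a₀ j) ≈ a j
    a₀-correct j = proj₂ (IsRingIsomorphism.surjective (σ^-iso (toℕ i₁)) (a j)) refl
    c : Fin t → Scalars n
    c i j = σ^ (toℕ i) (a₀ j)

  private
    graph≉0 : ∀ {a} → ¬ (∀ j → a j ≈ 0#) → graph a ≉ᴹ 0ᴹ
    graph≉0 a≉0 eq = a≉0 (proj₁ (independent₂ eq))

    unscale : ∀ {u v k} → u ≉ᴹ 0ᴹ → u ≈ᴹ k *ₗ v → ∃[ h ] v ≈ᴹ h *ₗ u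
    unscale {u} {v} {k} u≉0 u≈kv = let (h , hk≈1) = inverse (λ k≈0 → u≉0 (≈ᴹ-trans u≈kv (≈ᴹ-trans (*ₗ-congʳ k≈0) (*ₗ-zeroˡ v)))) in
      h , ≈ᴹ-sym (≈ᴹ-trans (*ₗ-congˡ u≈kv) (≈ᴹ-trans (≈ᴹ-sym (*ₗ-assoc h k v)) (≈ᴹ-trans (*ₗ-congʳ hk≈1) (*ₗ-identityˡ v))))

    unscale∈ : ∀ (S : Subspace K V) {u v k} → u ≉ᴹ 0ᴹ → u ≈ᴹ k *ₗ v → u ∈ ∣ S ∣ → v ∈ ∣ S ∣
    unscale∈ S u≉0 u≈kv u∈S = let (h , v≈) = unscale u≉0 u≈kv in Subspace.resp S (≈ᴹ-sym v≈) (Subspace.*ₗ-closed S h u∈S)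

  -- If a fixed vector lay in `Γ`, so would its `Λ`-component, a nonzero graph vector; but `Γ` and
  -- `Λ` meet only in zero.
  Γ⊥Fix : PG Γ ⊥ Fix Ψ
  Γ⊥Fix {P} (P∈Γ , P∈Fix) =
    let (u , k , φu≈u , u≉0 , P≈ku) = fixed-point P P∈Fix
        (a , a≉0 , c , u≈) = fixed⇒graph φu≈u u≉0
    in graph≉0 a≉0 (Γ∩Λ (cancel∈ Γ u≈ (unscale∈ Γ (Point.rep≉0 P) P≈ku P∈Γ) (lc²∈Γ c)) (⊕∈Λ a (τ ∘ a)))

  Join : Carrierᴹ → Subspace K V
  Join p = ⟨ ∣ Γ ∣ ∪ (p ≈ᴹ_) ⟩

  -- ⟨Γ, p⟩ ∩ Λ is spanned by the Λ-component g of a nonzero multiple u of p.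
  module _ {p u g : Carrierᴹ} {k : Carrier} {ζ : Carrierᴹ} (p≉0 : p ≉ᴹ 0ᴹ) (p≈ku : p ≈ᴹ k *ₗ u)
    (u≈ : u ≈ᴹ g +ᴹ ζ) (ζ∈Γ : ζ ∈ ∣ Γ ∣) (g∈Λ : g ∈ ∣ Λ ∣) where

    g∈Join : g ∈ ∣ Join p ∣
    g∈Join = cancel∈ (Join p) u≈ (unscale∈ (Join p) p≉0 p≈ku (incl (inj₂ ≈ᴹ-refl))) (incl (inj₁ ζ∈Γ))

    private
      -- The sum of `Γ` and the line of `g` in explicit form. It contains `p`, because `p` and
      -- `k *ₗ g` differ by a vector of `Γ`.
      Cone : Subspace K V
      Cone = record
        { ∣_∣ = λ v → ∃[ s ] ∃[ ξ ] ξ ∈ ∣ Γ ∣ × v ≈ᴹ ξ +ᴹ s *ₗ g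
        ; resp = λ eq (s , ξ , ξ∈Γ , v≈) → s , ξ , ξ∈Γ , ≈ᴹ-trans (≈ᴹ-sym eq) v≈
        ; 0-closed = 0# , 0ᴹ , zero , ≈ᴹ-sym (≈ᴹ-trans (+ᴹ-identityˡ _) (*ₗ-zeroˡ g))
        ; +-closed = λ (s , ξ , ξ∈Γ , v≈) (s′ , ξ′ , ξ′∈Γ , v′≈) → s + s′ , ξ +ᴹ ξ′ , add ξ∈Γ ξ′∈Γ ,
            ≈ᴹ-trans (+ᴹ-cong v≈ v′≈) (≈ᴹ-trans (+ᴹ-interchange _ _ _ _) (+ᴹ-congˡ (≈ᴹ-sym (*ₗ-distribʳ g s s′))))
        ; *ₗ-closed = λ h (s , ξ , ξ∈Γ , v≈) → h · s , h *ₗ ξ , mul h ξ∈Γ ,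
            ≈ᴹ-trans (*ₗ-congˡ v≈) (≈ᴹ-trans (*ₗ-distribˡ h _ _) (+ᴹ-congˡ (≈ᴹ-sym (*ₗ-assoc h s g))))
        }
        where open CommutativeSemigroupProperties (CommutativeMonoid.commutativeSemigroup +ᴹ-commutativeMonoid)
                using () renaming (interchange to +ᴹ-interchange)

      Join⊆Cone : ∣ Join p ∣ ⊆ ∣ Cone ∣
      Join⊆Cone = ⟨⟩-least Cone [ (λ v∈Γ → 0# , _ , v∈Γ , ≈ᴹ-sym (≈ᴹ-trans (+ᴹ-congˡ (*ₗ-zeroˡ g)) (+ᴹ-identityʳ _)))
        , (λ p≈v → k , k *ₗ ζ , mul k ζ∈Γ , ≈ᴹ-trans (≈ᴹ-sym p≈v) (≈ᴹ-trans p≈ku (≈ᴹ-trans (*ₗ-congˡ u≈)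
            (≈ᴹ-trans (*ₗ-distribˡ k g ζ) (+ᴹ-comm _ _))))) ]′

    Join∩Λ : ∀ {v} → v ∈ ∣ Join p ∣ → v ∈ ∣ Λ ∣ → ∃[ s ] v ≈ᴹ s *ₗ g
    Join∩Λ v∈Join v∈Λ = let (s , ξ , ξ∈Γ , v≈) = Join⊆Cone v∈Join in
      s , ≈ᴹ-trans v≈ (≈ᴹ-trans (+ᴹ-congʳ (Γ∩Λ ξ∈Γ (cancel∈ Λ v≈ v∈Λ (mul s g∈Λ)))) (+ᴹ-identityˡ _))

  private
    Λˢ : VectorSpace K
    Λˢ = asSpace Λ
    module Λᴸ = LinearAlgebra K Λˢ
    module Λᴹ = LeftModule Λˢ

    -- The bases of the two director spaces, moved into `Λ` as a space of its own, where the
    -- projected points live.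
    x′ y′ : Λᴸ.Vectors n
    x′ j = x j , incl (inj₁ (x∈Θ₁ j))
    y′ j = y j , incl (inj₂ (y∈Θ₂ j))

    proj-lc : ∀ {d} (a : Scalars d) (w : Λᴸ.Vectors d) → proj₁ (Λᴸ.lc a w) ≈ᴹ lc a (proj₁ ∘ w)
    proj-lc = SemilinearMap.map-lc K Λˢ V {σ = id} {f = proj₁} id (λ _ _ → ≈ᴹ-refl) ≈ᴹ-refl (λ _ _ → ≈ᴹ-refl)

    proj-⊕ : ∀ a b → proj₁ (Λᴸ.lc a x′ Λᴹ.+ᴹ Λᴸ.lc b y′) ≈ᴹ a ⊕ b
    proj-⊕ a b = +ᴹ-cong (proj-lc a x′) (proj-lc b y′)

    dec : Decomposition.IsDecomposition K cardK Λˢ x′ y′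
    dec = record
      { ⊕-independent = λ {a} {b} eq → independent₂ (≈ᴹ-trans (≈ᴹ-sym (proj-⊕ a b)) eq)
      ; ⊕-spanning = λ (v , v∈Λ) → let (a , b , v≈) = Λ⊆ v∈Λ in a , b , ≈ᴹ-trans v≈ (≈ᴹ-sym (proj-⊕ a b))
      }

    basis₁ : IsBasis (Θ₁ ↾ Λ) x′
    basis₁ = Λᴸ.mkBasis x∈Θ₁ (Decomposition.x-independent K cardK Λˢ x′ y′ dec)
      (λ v∈Θ₁ → let (a , v≈) = proj₁ (conj≐ i₁) v∈Θ₁ in a , ≈ᴹ-trans v≈ (≈ᴹ-sym (proj-lc a x′)))

    basis₂ : IsBasis (Θ₂ ↾ Λ) y′
    basis₂ = Λᴸ.mkBasis y∈Θ₂ (Decomposition.y-independent K cardK Λˢ x′ y′ dec)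
      (λ v∈Θ₂ → let (b , v≈) = proj₁ (conj≐ i₂) v∈Θ₂ in b , ≈ᴹ-trans v≈ (≈ᴹ-sym (proj-lc b y′)))

    module Graph = PseudoregulusType E {t = t} cardF cardK Λˢ dec (σ^-iso shiftExponent) τ-fixed

    -- The nonzero graph vector of the projected fixed vector lies in the intersection, which is the
    -- single point `Q`; so it is a nonzero multiple of the representative of `Q`.
    projection⊆ : ∀ Q → Q ∈ projection Γ Λ (Fix Ψ) → Q ∈ linearSet E {V = Λˢ} Graph.W
    projection⊆ Q (R , R∈Fix , meet) =
      let (u , k , φu≈u , u≉0 , R≈ku) = fixed-point R R∈Fix
          (a , a≉0 , c , u≈) = fixed⇒graph φu≈u u≉0
      in on a a≉0 (g∈Join (Point.rep≉0 R) R≈ku u≈ (lc²∈Γ c) (⊕∈Λ a (τ ∘ a)))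
      where
      on : ∀ a → ¬ (∀ j → a j ≈ 0#) → graph a ∈ ∣ Join (rep R) ∣ → Q ∈ linearSet E {V = Λˢ} Graph.W
      on a a≉0 g∈ =
        let (s , g≈sQ) = proj₁ meet {record { rep = Graph.g a ; rep≉0 = Graph.g≉0 a≉0 }} (Subspace.resp (Join (rep R)) (≈ᴹ-sym (proj-⊕ a (τ ∘ a))) g∈)
            (h , Q≈) = unscale {k = s} (graph≉0 a≉0) (≈ᴹ-trans (≈ᴹ-sym (proj-⊕ a (τ ∘ a))) g≈sQ)
        in Graph.g a , (a , ≈ᴹ-refl) , Graph.g≉0 a≉0 , h , ≈ᴹ-trans Q≈ (*ₗ-congˡ (≈ᴹ-sym (proj-⊕ a (τ ∘ a))))

    -- The point to project is the fixed vector built over `a`. The intersection is then the line of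
    -- `graph a`, which is also the line of the representative of `Q`.
    ⊆projection : ∀ Q → Q ∈ linearSet E {V = Λˢ} Graph.W → Q ∈ projection Γ Λ (Fix Ψ)
    ⊆projection Q (w , (a , w≈) , w≉0 , s , Q≈sw) =
      let (u , φu≈u , c , u≈) = graph⇒fixed a in on u φu≈u c u≈
      where
      w≈graph : proj₁ w ≈ᴹ graph a
      w≈graph = ≈ᴹ-trans w≈ (proj-⊕ a (τ ∘ a))
      on : ∀ u → φ u ≈ᴹ u → ∀ c → u ≈ᴹ graph a +ᴹ lc² c z → Q ∈ projection Γ Λ (Fix Ψ)
      on u φu≈u c u≈ = record { rep = u ; rep≉0 = u≉0 } ,
        (scale , ≈ᴹ-trans (map≈scale*φ u) (*ₗ-congˡ φu≈u)) ,
        (λ {R} R∈ → let (k , R≈kg) = Join∩Λ u≉0 u≈1u u≈ (lc²∈Γ c) (⊕∈Λ a (τ ∘ a)) R∈ (proj₂ (rep R)) in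
          k · h , ≈ᴹ-trans R≈kg (≈ᴹ-trans (*ₗ-congˡ g≈hQ) (≈ᴹ-sym (*ₗ-assoc k h _)))) ,
        (λ {R} (k , R≈kQ) → Subspace.resp (Join u) (≈ᴹ-sym (≈ᴹ-trans R≈kQ (*ₗ-congˡ Q≈sg)))
          (Subspace.*ₗ-closed (Join u) k (Subspace.*ₗ-closed (Join u) s
            (g∈Join u≉0 u≈1u u≈ (lc²∈Γ c) (⊕∈Λ a (τ ∘ a))))))
        where
        u≉0 : u ≉ᴹ 0ᴹ
        u≉0 u≈0 = w≉0 (≈ᴹ-trans w≈graph (⊕-0 a≈0 (λ j → trans (τ.⟦⟧-cong (a≈0 j)) τ.0#-homo)))
          where
          a≈0 : ∀ j → a j ≈ 0#
          a≈0 = proj₁ (independent₃ (≈ᴹ-trans (≈ᴹ-sym u≈) u≈0))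
        u≈1u : u ≈ᴹ 1# *ₗ u
        u≈1u = ≈ᴹ-sym (*ₗ-identityˡ u)
        Q≈sg : proj₁ (rep Q) ≈ᴹ s *ₗ graph a
        Q≈sg = ≈ᴹ-trans Q≈sw (*ₗ-congˡ w≈graph)
        h : Carrier
        h = proj₁ (unscale (Point.rep≉0 Q) Q≈sg)
        g≈hQ : graph a ≈ᴹ h *ₗ proj₁ (rep Q)
        g≈hQ = proj₂ (unscale (Point.rep≉0 Q) Q≈sg)

    L≐W : projection Γ Λ (Fix Ψ) ≐ linearSet E {V = Λˢ} Graph.W
    L≐W = (λ {Q} → projection⊆ Q) , (λ {Q} → ⊆projection Q)

  projection-properties : 2 ≤ n →
    HasDim Γ (n * r) × PG Γ ⊥ Fix Ψ × PG Γ ⊥ PG Λ × HasDim Λ (2 * n) ×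
    IsScatteredLinearSet E {V = Λˢ} (t * n) (projection Γ Λ (Fix Ψ)) ×
    IsTypeLρf E {V = Λˢ} n (projection Γ Λ (Fix Ψ)) (Θ₁ ↾ Λ) (Θ₂ ↾ Λ) ×
    IsPseudoregulusType E {V = Λˢ} q n t (projection Γ Λ (Fix Ψ)) (Θ₁ ↾ Λ) (Θ₂ ↾ Λ)
  projection-properties 2≤n = Γ-dim , (λ {P} → Γ⊥Fix {P}) , (λ {P} → Γ⊥Λ {P}) , Λ-dim ,
    Graph.scatteredLinearSet basis₁ basis₂ L≐W , Graph.typeLρf basis₁ basis₂ L≐W ,
    Graph.pseudoregulusType basis₁ basis₂ L≐W 2≤n (s≤s (s≤s z≤n))

-- The conjugates of an arbitrary director space form a basis.

module DirectorSpace {ℓ} (E : FieldExtension ℓ) {q m n t : ℕ}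
  (cardF : HasCardinality (FieldExtension.F E) q) (cardK : HasCardinality (FieldExtension.K E) m)
  (V : VectorSpace (FieldExtension.K E)) (Ψ : SemilinearIso (FieldExtension.K E) V V)
  (subgeometry : IsSubgeometry E {V = V} (t * n) (Fix Ψ)) {k₀ k₁ : Fin (t * n)} (k₀≢k₁ : k₀ ≢ k₁)
  {Θ₀ : Subspace (FieldExtension.K E) V} (Θ₀-dim : HasDim Θ₀ n)
  (generates : ⟨ ⋃ (Fin t) (λ i → ∣ Θ₀ ^ˢ[ Ψ ] toℕ i ∣) ⟩ ≐ₛ whole (FieldExtension.K E) V) where
  open FieldExtension E
  open LeftModule V
  open LinearAlgebra K V
  open Frobenius E cardF cardK V Ψ subgeometry k₀≢k₁

  private
    θ₀ : Vectors n
    θ₀ = proj₁ Θ₀-dim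

    conjugates₀ : Fin t → Vectors n
    conjugates₀ i j = φ^ (toℕ i) (θ₀ j)

    conj₀≐ : ∀ i → Θ₀ ^ˢ[ Ψ ] i ≐ₛ span (φ^ i ∘ θ₀)
    conj₀≐ = ^ˢ-span {Θ₀} (basis⊆span (proj₂ Θ₀-dim))

    spanned₀ : ∀ v → v ∈ ∣ span (flatten conjugates₀) ∣
    spanned₀ v = ⟨⟩-least (span (flatten conjugates₀)) (λ (i , v∈) → let (c , v≈) = proj₁ (conj₀≐ (toℕ i)) v∈ in
      Subspace.resp (span (flatten conjugates₀)) (≈ᴹ-sym v≈) (lc∈ (span (flatten conjugates₀)) (row∈span conjugates₀ i) c))
      (proj₂ generates {v} tt)

  module _ (k : ℕ) {Θ : Subspace K V} (Θ≐Θ₀ : Θ ≐ₛ Θ₀ ^ˢ[ Ψ ] k) where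
    θ : Vectors n
    θ = φ^ k ∘ θ₀

    Θ≐span : Θ ≐ₛ span θ
    Θ≐span = (λ v∈ → proj₁ (conj₀≐ k) (proj₁ Θ≐Θ₀ v∈)) , (λ v∈ → proj₂ Θ≐Θ₀ (proj₂ (conj₀≐ k) v∈))

    conjugates : Fin t → Vectors n
    conjugates i j = φ^ (toℕ i) (θ j)

    private
      φ^-comm : ∀ i j v → φ^ i (φ^ j v) ≡ φ^ j (φ^ i v)
      φ^-comm i j v = ≡.trans (≡.sym (fold-+ v φ i)) (≡.trans (≡.cong (λ l → φ^ l v) (ℕ.+-comm i j)) (fold-+ v φ j))

    -- `Θ` is the k-th conjugate of the space `Θ₀` that defines the spread. As `φ^ k` is onto and
    -- commutes with powers of `φ`, it carries the spanning conjugates of `θ₀` to those of `θ`, with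
    -- no reindexing modulo `t`.
    conjugates-spanned : ∀ v → v ∈ ∣ span (flatten conjugates) ∣
    conjugates-spanned v =
      let (w , φw≈v) = φ^-surjective k v
          (a , w≈) = spanned₀ w
      in σ^ k ∘ a , ≈ᴹ-trans (≈ᴹ-sym φw≈v) (≈ᴹ-trans (φ^-cong k w≈) (≈ᴹ-trans (φ^-lc k a (flatten conjugates₀))
           (lc-congʳ (λ l → let (i , j) = remQuot {t} n l in ≈ᴹ-reflexive (φ^-comm k (toℕ i) (θ₀ j))))))

    -- The family has `t * n` members, exactly as many as the basis `e`, so spanning suffices.
    conjugates-independent : Independent² conjugates
    conjugates-independent = unflatten-independent (spanning⇒independent cardK e-basis (λ {v} _ → conjugates-spanned v))

    conjugates-span : ∀ v → ∃[ c ] v ≈ᴹ lc² c conjugates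
    conjugates-span v = span-flatten⇒lc² conjugates (conjugates-spanned v)

theorem3p9 :
    ∀ {ℓ} (q n t : ℕ) → 2 ≤ n → 3 ≤ t →
    (E : FieldExtension ℓ) → HasCardinality (FieldExtension.F E) q →
    HasCardinality (FieldExtension.K E) (q ^ t) →
    (V : VectorSpace (FieldExtension.K E)) → HasDim (whole (FieldExtension.K E) V) (t * n) →
    (Ψ : SemilinearIso (FieldExtension.K E) V V) → HasOrder Ψ t →
    IsSubgeometry E (t * n) (Fix Ψ) →
    (𝒟 : Pred (PointSet (FieldExtension.K E) V) ℓ) → IsDesarguesianSpread Ψ n t 𝒟 →
    (Θ : Subspace (FieldExtension.K E) V) → IsDirectorSpace Ψ n t 𝒟 Θ →
    (i₁ i₂ : Fin t) → gcd ∣ toℕ i₂ - toℕ i₁ ∣ t ≡ 1 →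
    let Θ₁ = Θ ^ˢ[ Ψ ] toℕ i₁
        Θ₂ = Θ ^ˢ[ Ψ ] toℕ i₂
        Γ  = ⟨ (λ v → Σ[ i ∈ Fin t ] i ≢ i₁ × i ≢ i₂ × v ∈ ∣ Θ ^ˢ[ Ψ ] toℕ i ∣) ⟩
        Λ  = ⟨ ∣ Θ₁ ∣ ∪ ∣ Θ₂ ∣ ⟩
        L  = projection Γ Λ (Fix Ψ)
    in HasDim Γ (n * (t ∸ 2)) × PG Γ ⊥ Fix Ψ × PG Γ ⊥ PG Λ × HasDim Λ (2 * n) ×
       IsScatteredLinearSet E (t * n) L ×
       IsTypeLρf E n L (Θ₁ ↾ Λ) (Θ₂ ↾ Λ) ×
       IsPseudoregulusType E q n t L (Θ₁ ↾ Λ) (Θ₂ ↾ Λ)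
theorem3p9 q (suc (suc n)) (suc (suc (suc r))) 2≤n@(s≤s (s≤s _)) (s≤s (s≤s (s≤s _))) E cardF cardK V _ Ψ (order , _) subgeometry
  𝒟 _ Θ (Θ₀ , (Θ₀-dim , generates , _) , k , Θ≐Θ₀) i₁ i₂ coprime =
  DirectorProjection.projection-properties E cardF cardK V Ψ order subgeometry k₀≢k₁
    (D.Θ≐span (toℕ k) {Θ} Θ≐Θ₀) (D.conjugates-independent (toℕ k) {Θ} Θ≐Θ₀) (D.conjugates-span (toℕ k) {Θ} Θ≐Θ₀) coprime 2≤n
  where
  -- The test vectors need two distinct basis indices; the successor patterns for `n` and `t` make
  -- `t * n` visibly at least 2.
  k₀≢k₁ : _≢_ {A = Fin (suc (suc (suc r)) * suc (suc n))} zero (suc zero)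
  k₀≢k₁ ()
  module D = DirectorSpace E {t = suc (suc (suc r))} cardF cardK V Ψ subgeometry k₀≢k₁ {Θ₀} Θ₀-dim generates
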